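{- Let $l\geq 2$ be an integer. Every graph $G$ with $L(G)=\{3,3+2l\}$ satisfies $\chi(G)=\max\{3,\omega(G)\}$.
   Context: All graphs are finite and simple. For a graph $G$, $\chi(G)$ denotes the chromatic number, $\omega(G)$ the number of vertices of a largest clique, and $L(G)$ the set of all lengths of odd cycles contained in $G$. -}

module Defs where

open import Data.Nat using (ℕ; zero; suc; _+_; _*_; _≤_; _<_)
open import Data.Fin using (Fin; zero; suc; inject₁; fromℕ)
open import Data.Bool using (Bool; true; false)
open import Data.Product using (Σ; _×_; ∃-syntax)
open import Relation.Binary.PropositionalEquality using (_≡_; _≢_)
open import Relation.Nullary using (¬_)
open import Function.Definitions using (Injective)

record Graph : Set where
  field
    n     : ℕ
    adj   : Fin n → Fin n → Bool
    sym   : ∀ u v → adj u v ≡ adj v u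
    irrefl : ∀ v → adj v v ≡ false

open Graph public

Vertex : Graph → Set
Vertex G = Fin (n G)

Adj : (G : Graph) → Vertex G → Vertex G → Set
Adj G u v = adj G u v ≡ true

record CycleOfLength (G : Graph) (k : ℕ) : Set where
  field
    m        : ℕ
    len      : k ≡ suc m
    long     : 3 ≤ k
    vtx      : Fin (suc m) → Vertex G
    distinct : Injective _≡_ _≡_ vtx
    step     : ∀ (i : Fin m) → Adj G (vtx (inject₁ i)) (vtx (suc i))
    close    : Adj G (vtx (fromℕ m)) (vtx zero)

Odd : ℕ → Set
Odd k = ∃[ j ] k ≡ suc (2 * j)

InL : Graph → ℕ → Set
InL G k = Odd k × CycleOfLength G k

Clique : (G : Graph) → ℕ → Set
Clique G k = Σ (Fin k → Vertex G) λ c →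
  Injective _≡_ _≡_ c × (∀ i j → i ≢ j → Adj G (c i) (c j))

IsCliqueNumber : Graph → ℕ → Set
IsCliqueNumber G w = Clique G w × (∀ k → w < k → ¬ Clique G k)

Colouring : (G : Graph) → ℕ → Set
Colouring G k = Σ (Vertex G → Fin k) λ f → ∀ u v → Adj G u v → f u ≢ f v

IsChromaticNumber : Graph → ℕ → Set
IsChromaticNumber G k = Colouring G k × (∀ j → j < k → ¬ Colouring G j)

{-# OPTIONS --safe #-}
module Submission where

-- A largest clique gives the lower bound, and it remains to find four colours in general and three without K₄.
-- Write c = 3 + 2l and pass to an edge-minimal counterexample: it has no cut vertex and no separation by two
-- adjacent vertices. If it contains K₄ then c > 5 leaves every other vertex at most one neighbour in K₄,
-- and an odd cycle disjoint from K₄, joined to it by two disjoint paths, gives odd cycles of lengths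
-- differing by 2; so the rest is bipartite and four colours suffice. From now on there is no K₄.
--
-- If there is a triangle, some triangle xyz has xy and yz in no other triangle. After deleting z and the edge
-- xy, all x–y paths have length c − 2 or c − 1. If every remaining edge lies on such a path, three colours
-- are found from the distances to x: parity, except that an independent set meeting every edge inside a
-- distance layer receives the third colour. Otherwise there is a 2-separation {z, d} with z and d
-- non-adjacent, neither side being bipartite; as one side contains the triangle, the path lengths on the two sides are {κ, κ + 1} and
-- {κ₂, κ₂ + 1} with κ + κ₂ = c − 1 even, and the same colouring, applied to both sides, agrees at z and d.
--
-- Without triangles all odd cycles have length c = 2h + 1, and any two of them share two vertices. If some
-- ball of radius j < h meets every odd cycle, colour the outside with two colours, the sphere of radius j with the
-- third and the inside by parity. Otherwise a ball about a vertex of an odd cycle C yields an odd cycle meeting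
-- C in just the edge opposite to that vertex, that is, two paths of length 2h between the ends of an edge ab; a ball
-- of radius 1 about b yields an odd cycle meeting both of them off a and b. Length considerations show that
-- a path connecting the interiors is a single edge, and two disjoint ones close up to a cycle of length c + 2.

open import Defs hiding (n; sym)
open import Data.Nat using (ℕ; zero; suc; _+_; _*_; _∸_; _≤_; _<_; _⊔_; z≤n; s≤s; _≤?_; _<?_)
import Data.Nat as ℕ
open import Data.Nat.Properties hiding (_≟_)
open import Data.Nat.Induction using (<-wellFounded)
open import Data.Nat.Tactic.RingSolver using (solve-∀)
open import Induction.WellFounded using (Acc; acc)
open import Data.Fin using (Fin; zero; suc; inject₁; fromℕ)
import Data.Fin as Fin
import Data.Fin.Properties as Finₚ
open import Data.Fin.Permutation.Components using (transpose; transpose-inverse)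
open import Data.Fin.Properties using (_≟_; any?; all?; pigeonhole; inject₁-injective)
open import Data.Bool using (Bool; true; false; not; _xor_)
import Data.Bool as Bool
open import Data.Bool.Properties using (not-involutive)
open import Data.List using (List; []; _∷_; length; filter; allFin; cartesianProduct)
open import Data.List.Relation.Unary.Any using (here; there)
import Data.List.Membership.Propositional as List
open import Data.List.Membership.Propositional.Properties using (∈-filter⁺; ∈-filter⁻; ∈-cartesianProduct⁺; ∈-allFin)
open import Data.Sum using (_⊎_; inj₁; inj₂; [_,_]′; swap)
open import Data.Product using (Σ; _×_; _,_; proj₁; proj₂; ∃; ∃-syntax; Σ-syntax)
open import Data.Unit using (⊤; tt)
open import Data.Empty using (⊥; ⊥-elim)
open import Function using (_∘_; id; case_of_)
open import Function.Definitions using (Injective)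
open import Relation.Nullary using (¬_; Dec; yes; no)
open import Relation.Nullary.Decidable using (_×-dec_; _⊎-dec_; ¬?; map′; toWitness)
open import Relation.Unary using (Decidable)
open import Relation.Binary.PropositionalEquality using (_≡_; _≢_; refl; sym; trans; cong; cong₂; subst; ≢-sym)
open import Relation.Binary.Definitions using (tri<; tri≈; tri>)

-- Walks, paths and cycles

private
  variable
    n k m i j : ℕ
    u v w x : Fin n

Edges : ℕ → Set₁
Edges n = Fin n → Fin n → Set

Subset : ℕ → Set₁
Subset n = Fin n → Set

private
  variable
    E F : Edges n

Symm : Edges n → Set
Symm E = ∀ {u v} → E u v → E v u

data Walk {n} (E : Edges n) : Fin n → Fin n → ℕ → Set where
  []  : Walk E u u 0
  _∷_ : E u w → Walk E w v m → Walk E u v (suc m)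

data _∈_ {n} {E : Edges n} : Fin n → {u v : Fin n} {m : ℕ} → Walk E u v m → Set where
  here  : {p : Walk E u v m} → u ∈ p
  there : {e : E u w} {p : Walk E w v m} → x ∈ p → x ∈ (e ∷ p)

Simple : Walk E u v m → Set
Simple []              = ⊤
Simple (_∷_ {u = u} _ p) = ¬ (u ∈ p) × Simple p

_∈?_ : (x : Fin n) (p : Walk E u v m) → Dec (x ∈ p)
_∈?_ {u = u} x p with x ≟ u
... | yes refl = yes here
_∈?_ x []      | no x≢u = no λ { here → x≢u refl }
_∈?_ x (e ∷ p) | no x≢u = map′ there (λ { here → ⊥-elim (x≢u refl) ; (there q) → q }) (x ∈? p)

end∈ : (p : Walk E u v m) → v ∈ p
end∈ []      = here
end∈ (e ∷ p) = there (end∈ p)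

walk₀ : Walk E u v 0 → u ≡ v
walk₀ [] = refl

mapʷ : (∀ {u v} → E u v → F u v) → Walk E u v m → Walk F u v m
mapʷ f []      = []
mapʷ f (e ∷ p) = f e ∷ mapʷ f p

mapʷ-∈ : (f : ∀ {u v} → E u v → F u v) (p : Walk E u v m) → x ∈ mapʷ f p → x ∈ p
mapʷ-∈ f []      here      = here
mapʷ-∈ f (e ∷ p) here      = here
mapʷ-∈ f (e ∷ p) (there q) = there (mapʷ-∈ f p q)

mapʷ-simple : (f : ∀ {u v} → E u v → F u v) (p : Walk E u v m) → Simple p → Simple (mapʷ f p)
mapʷ-simple f []      s       = tt
mapʷ-simple f (e ∷ p) (h , s) = h ∘ mapʷ-∈ f p , mapʷ-simple f p s

_++_ : Walk E u v i → Walk E v w j → Walk E u w (i + j)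
[]      ++ q = q
(e ∷ p) ++ q = e ∷ (p ++ q)

++-∈ : (p : Walk E u v i) {q : Walk E v w j} → x ∈ (p ++ q) → x ∈ p ⊎ x ∈ q
++-∈ []      h         = inj₂ h
++-∈ (e ∷ p) here      = inj₁ here
++-∈ (e ∷ p) (there h) with ++-∈ p h
... | inj₁ h′ = inj₁ (there h′)
... | inj₂ h′ = inj₂ h′

++-simple : (p : Walk E u v i) (q : Walk E v w j) → Simple p → Simple q →
  (∀ {x} → x ∈ p → x ∈ q → x ≡ v) → Simple (p ++ q)
++-simple []      q sp sq meet = sq
++-simple (e ∷ p) q (h , sp) sq meet =
  (λ h′ → [ h , (λ hq → h (subst (_∈ p) (sym (meet here hq)) (end∈ p))) ]′ (++-∈ p h′)) ,
  ++-simple p q sp sq (meet ∘ there)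

reverseʷ : Symm E → Walk E u v m → Walk E v u m
reverseʷ s []                = []
reverseʷ {m = suc m} s (e ∷ p) = subst (Walk _ _ _) (+-comm m 1) (reverseʷ s p ++ (s e ∷ []))

record Path {n} (E : Edges n) (u v : Fin n) (m : ℕ) : Set where
  constructor path
  field
    walk   : Walk E u v m
    simple : Simple walk
open Path public

infix 4 _∈ᵖ_
_∈ᵖ_ : ∀ {n} {E : Edges n} {u v m} → Fin n → Path E u v m → Set
x ∈ᵖ p = x ∈ walk p

end∈ᵖ : (p : Path E u v m) → v ∈ᵖ p
end∈ᵖ p = end∈ (walk p)

trivial : Path E u u 0
trivial = path [] tt

edge : E u v → u ≢ v → Path E u v 1
edge e u≢v = path (e ∷ []) ((λ { here → u≢v refl }) , tt)

edge-∈ : {e : E u v} {h : u ≢ v} → x ∈ᵖ edge {E = E} e h → x ≡ u ⊎ x ≡ v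
edge-∈ here         = inj₁ refl
edge-∈ (there here) = inj₂ refl

-- Here and below, operations on paths return the inclusion of vertex sets with the new path; a bare
-- `subst` on the length would hide the vertices.
cast : i ≡ j → (p : Path E u v i) → Σ[ q ∈ Path E u v j ] (∀ {x} → x ∈ᵖ q → x ∈ᵖ p)
cast refl p = p , id

mapᵖ : (f : ∀ {u v} → E u v → F u v) → Path E u v m → Path F u v m
mapᵖ f p = path (mapʷ f (walk p)) (mapʷ-simple f (walk p) (simple p))

mapᵖ-∈ : {f : ∀ {u v} → E u v → F u v} (p : Path E u v m) → x ∈ᵖ mapᵖ {F = F} f p → x ∈ᵖ p
mapᵖ-∈ {f = f} p = mapʷ-∈ f (walk p)

cons : (e : E u v) (p : Path E v w m) → ¬ (u ∈ᵖ p) → Path E u w (suc m)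
cons e p h = path (e ∷ walk p) (h , simple p)

cons-∈ : {e : E u v} {p : Path E v w m} {h : ¬ (u ∈ᵖ p)} → x ∈ᵖ cons e p h → x ≡ u ⊎ x ∈ᵖ p
cons-∈ here      = inj₁ refl
cons-∈ (there h) = inj₂ h

join : (p : Path E u v i) (q : Path E v w j) → (∀ {x} → x ∈ᵖ p → x ∈ᵖ q → x ≡ v) →
  Σ[ r ∈ Path E u w (i + j) ] (∀ {x} → x ∈ᵖ r → x ∈ᵖ p ⊎ x ∈ᵖ q)
join p q meet = path (walk p ++ walk q) (++-simple (walk p) (walk q) (simple p) (simple q) meet) , ++-∈ (walk p)

reverse : Symm E → (p : Path E u v m) → Σ[ q ∈ Path E v u m ] (∀ {x} → x ∈ᵖ q → x ∈ᵖ p)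
reverse s (path [] _) = trivial , id
reverse {m = suc m} s (path (_∷_ {u = u} e p) (h , sp)) =
  let q , q⊆ = reverse s (path p sp)
      w≢u : _ ≢ u
      w≢u eq = h (subst (_∈ p) eq here)
      r , r⊆ = join q (edge (s e) w≢u) λ hq he → case edge-∈ {h = w≢u} he of λ
        { (inj₁ eq) → eq ; (inj₂ refl) → ⊥-elim (h (q⊆ hq)) }
      t , t⊆ = cast (+-comm m 1) r
  in t , λ hx → case r⊆ (t⊆ hx) of λ
       { (inj₁ hq) → there (q⊆ hq)
       ; (inj₂ he) → case edge-∈ {h = w≢u} he of λ { (inj₁ refl) → there here ; (inj₂ refl) → here } }

record Split {n} {E : Edges n} {u v m} (p : Path E u v m) (a : Fin n) : Set where
  field
    {ℓ₁ ℓ₂} : ℕ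
    total  : ℓ₁ + ℓ₂ ≡ m
    front  : Path E u a ℓ₁
    back   : Path E a v ℓ₂
    front⊆ : ∀ {x} → x ∈ᵖ front → x ∈ᵖ p
    back⊆  : ∀ {x} → x ∈ᵖ back → x ∈ᵖ p
    meet   : ∀ {x} → x ∈ᵖ front → x ∈ᵖ back → x ≡ a

split : ∀ {a} (p : Path E u v m) → a ∈ᵖ p → Split p a
split p here = record
  { total = refl ; front = trivial ; back = p ; front⊆ = λ { here → here } ; back⊆ = id
  ; meet = λ { here _ → refl } }
split (path (e ∷ p) (h , sp)) (there a∈) = record
  { total  = cong suc S.total
  ; front  = cons e S.front (h ∘ S.front⊆)
  ; back   = S.back
  ; front⊆ = λ { here → here ; (there h′) → there (S.front⊆ h′) }
  ; back⊆  = there ∘ S.back⊆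
  ; meet   = λ { here hb → ⊥-elim (h (S.back⊆ hb)) ; (there hf) hb → S.meet hf hb } }
  where module S = Split (split (path p sp) a∈)

split-cover : ∀ {a} (p : Path E u v m) (a∈ : a ∈ᵖ p) → x ∈ᵖ p → x ∈ᵖ Split.front (split p a∈) ⊎ x ∈ᵖ Split.back (split p a∈)
split-cover p                    here       h         = inj₂ h
split-cover (path (e ∷ p) (_ , sp)) (there a∈) here      = inj₁ here
split-cover (path (e ∷ p) (_ , sp)) (there a∈) (there h) = [ inj₁ ∘ there , inj₂ ]′ (split-cover (path p sp) a∈ h)

-- Loop erasure: if the new first vertex recurs in the shortened rest, only the part from that
-- occurrence on is kept.
shorten : (p : Walk E u v m) → Σ[ i ∈ ℕ ] i ≤ m × (Σ[ q ∈ Path E u v i ] (∀ {x} → x ∈ᵖ q → x ∈ p))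
shorten []      = 0 , z≤n , trivial , id
shorten {u = u} (e ∷ p) with shorten p
... | i , i≤m , q , q⊆ with u ∈? walk q
...   | no u∉   = suc i , s≤s i≤m , cons e q u∉ , λ { here → here ; (there h) → there (q⊆ h) }
...   | yes u∈ = Split.ℓ₂ S , ≤-trans (m≤n+m _ _) (≤-trans (≤-reflexive (Split.total S)) (≤-trans i≤m (n≤1+n _)))
               , Split.back S , there ∘ q⊆ ∘ Split.back⊆ S
  where S = split q u∈

record Trim {n} {E : Edges n} {u v m} (p : Path E u v m) (Y : Subset n) : Set where
  field
    {y}   : Fin n
    {ℓ}   : ℕ
    path′ : Path E u y ℓ
    y∈Y   : Y y
    sub   : ∀ {x} → x ∈ᵖ path′ → x ∈ᵖ p
    first : ∀ {x} → x ∈ᵖ path′ → Y x → x ≡ y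

trim : {Y : Subset n} → Decidable Y → (p : Path E u v m) → Y v → Trim p Y
trim {u = u} Y? p yv with Y? u
... | yes yu = record { path′ = trivial ; y∈Y = yu ; sub = λ { here → here } ; first = λ { here _ → refl } }
trim Y? (path [] _) yv | no ¬yu = ⊥-elim (¬yu yv)
trim Y? (path (e ∷ p) (h , sp)) yv | no ¬yu = record
  { path′ = cons e T.path′ (h ∘ T.sub) ; y∈Y = T.y∈Y
  ; sub   = λ { here → here ; (there h′) → there (T.sub h′) }
  ; first = λ { here yx → ⊥-elim (¬yu yx) ; (there h′) yx → T.first h′ yx } }
  where module T = Trim (trim Y? (path p sp) yv)

-- A path closed by one edge, without a lower bound on the length: length 1 is a loop, length 2 an
-- edge there and back. Restrictions on odd lengths thus also exclude loops.
record Cycle {n} (E : Edges n) (m : ℕ) : Set where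
  constructor cycle
  field
    {a b} : Fin n
    {ℓ}   : ℕ
    len   : suc ℓ ≡ m
    round : Path E a b ℓ
    back  : E b a
open Cycle public using (round)

infix 4 _∈ᶜ_
_∈ᶜ_ : ∀ {n} {E : Edges n} {m} → Fin n → Cycle E m → Set
x ∈ᶜ Z = x ∈ᵖ round Z

mapᶜ : (f : ∀ {u v} → E u v → F u v) → Cycle E m → Cycle F m
mapᶜ f (cycle l p e) = cycle l (mapᵖ f p) (f e)

-- The first edge of `q` becomes the closing edge; the rest of `q` followed by `p` is the round
-- path.
closeUp : (p : Path E u v i) (q : Path E v u j) → u ≢ v → (∀ {x} → x ∈ᵖ p → x ∈ᵖ q → x ≡ u ⊎ x ≡ v) →
  Σ[ Z ∈ Cycle E (i + j) ] (∀ {x} → x ∈ᶜ Z → x ∈ᵖ p ⊎ x ∈ᵖ q)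
closeUp p (path [] _) u≢v meet = ⊥-elim (u≢v refl)
closeUp {i = i} {j = suc j} p (path (e ∷ q) (h , sq)) u≢v meet =
  let r , r⊆ = join (path q sq) p λ hq hp → case meet hp (there hq) of λ
        { (inj₁ eq) → eq ; (inj₂ refl) → ⊥-elim (h hq) }
  in cycle (trans (cong suc (+-comm j i)) (sym (+-suc i j))) r e , [ inj₂ ∘ there , inj₁ ]′ ∘ r⊆

record Arcs {n} {E : Edges n} {m} (Z : Cycle E m) (a b : Fin n) : Set where
  field
    {s t} : ℕ
    total : s + t ≡ m
    out   : Path E a b s
    ret   : Path E b a t
    out⊆  : ∀ {x} → x ∈ᵖ out → x ∈ᶜ Z
    ret⊆  : ∀ {x} → x ∈ᵖ ret → x ∈ᶜ Z
    meet  : ∀ {x} → x ∈ᵖ out → x ∈ᵖ ret → x ≡ a ⊎ x ≡ b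

record Split₃ {n} {E : Edges n} {u v m} (p : Path E u v m) (a b : Fin n) : Set where
  field
    {ℓ₁ ℓ₂ ℓ₃}  : ℕ
    total       : ℓ₁ + ℓ₂ + ℓ₃ ≡ m
    front       : Path E u a ℓ₁
    mid         : Path E a b ℓ₂
    back        : Path E b v ℓ₃
    front⊆      : ∀ {x} → x ∈ᵖ front → x ∈ᵖ p
    mid⊆        : ∀ {x} → x ∈ᵖ mid → x ∈ᵖ p
    back⊆       : ∀ {x} → x ∈ᵖ back → x ∈ᵖ p
    front∩mid   : ∀ {x} → x ∈ᵖ front → x ∈ᵖ mid → x ≡ a
    mid∩back    : ∀ {x} → x ∈ᵖ mid → x ∈ᵖ back → x ≡ b
    front∩back  : ∀ {x} → x ∈ᵖ front → ¬ x ∈ᵖ back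

split₃ : ∀ {a b} (p : Path E u v m) → a ≢ b → a ∈ᵖ p → b ∈ᵖ p → Split₃ p a b ⊎ Split₃ p b a
split₃ {a = a} {b} p a≢b a∈ b∈ with split p a∈ | split-cover p a∈ b∈
... | A | inj₂ b∈back = inj₁ record
  { total = trans (+-assoc A.ℓ₁ S.ℓ₁ S.ℓ₂) (trans (cong (A.ℓ₁ +_) S.total) A.total)
  ; front = A.front ; mid = S.front ; back = S.back
  ; front⊆ = A.front⊆ ; mid⊆ = A.back⊆ ∘ S.front⊆ ; back⊆ = A.back⊆ ∘ S.back⊆
  ; front∩mid = λ hf hm → A.meet hf (S.front⊆ hm) ; mid∩back = S.meet
  ; front∩back = λ hf hb → a≢b (S.meet here (subst (_∈ᵖ S.back) (A.meet hf (S.back⊆ hb)) hb)) }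
  where
  module A = Split A
  module S = Split (split A.back b∈back)
... | A | inj₁ b∈front = inj₂ record
  { total = trans (cong (_+ A.ℓ₂) S.total) A.total
  ; front = S.front ; mid = S.back ; back = A.back
  ; front⊆ = A.front⊆ ∘ S.front⊆ ; mid⊆ = A.front⊆ ∘ S.back⊆ ; back⊆ = A.back⊆
  ; front∩mid = S.meet ; mid∩back = λ hm hb → A.meet (S.back⊆ hm) hb
  ; front∩back = λ hf hb → a≢b (S.meet (subst (_∈ᵖ S.front) (A.meet (S.front⊆ hf) hb) hf) (end∈ᵖ S.back)) }
  where
  module A = Split A
  module S = Split (split A.front b∈front)

arcs : ∀ {a b} (Z : Cycle E m) → a ≢ b → a ∈ᶜ Z → b ∈ᶜ Z → Arcs Z a b
arcs {E = E} {m = m} {a} {b} (cycle {a = u} {v} {ℓ} len p e) a≢b a∈ b∈ =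
  [ ordered , (λ S → let module A = Arcs (ordered S) in record
      { total = trans (+-comm A.t A.s) A.total ; out = A.ret ; ret = A.out ; out⊆ = A.ret⊆ ; ret⊆ = A.out⊆
      ; meet = λ ho hr → swap (A.meet hr ho) }) ]′ (split₃ p a≢b a∈ b∈)
  where
  Z = cycle len p e
  arith : ∀ x y z → y + (z + suc x) ≡ suc (x + y + z)
  arith = solve-∀
  ordered : ∀ {a b} → Split₃ p a b → Arcs Z a b
  ordered {a} {b} S = record
    { total = trans (arith S.ℓ₁ S.ℓ₂ S.ℓ₃) (trans (cong suc S.total) len)
    ; out = S.mid ; ret = proj₁ R ; out⊆ = S.mid⊆
    ; ret⊆ = [ S.back⊆ , (λ { here → end∈ᵖ p ; (there h) → S.front⊆ h }) ]′ ∘ proj₂ R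
    ; meet = λ ho hr → case proj₂ R hr of λ
        { (inj₁ hb)         → inj₂ (S.mid∩back ho hb)
        ; (inj₂ here)       → inj₂ (S.mid∩back ho (end∈ᵖ S.back))
        ; (inj₂ (there hf)) → inj₁ (S.front∩mid hf ho) } }
    where
    module S = Split₃ S
    -- The return arc runs from `b` to the end of the round path, over the closing edge, and from
    -- its start on to `a`.
    R = join S.back (cons e S.front (λ h → S.front∩back h (end∈ᵖ S.back)))
      λ { hb here → refl ; hb (there hf) → ⊥-elim (S.front∩back hf hb) }

-- Parity and bipartite graphs

par : ℕ → Bool
par zero    = false
par (suc m) = not (par m)

not-xor : ∀ a b → not (a xor b) ≡ not a xor b
not-xor false b     = refl
not-xor true  false = refl
not-xor true  true  = refl

par-+ : ∀ a b → par (a + b) ≡ par a xor par b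
par-+ zero    b = refl
par-+ (suc a) b = trans (cong not (par-+ a b)) (not-xor (par a) (par b))

par-double : ∀ a → par (a + a) ≡ false
par-double a = trans (par-+ a a) (xor-self (par a))
  where
  xor-self : ∀ b → b xor b ≡ false
  xor-self false = refl
  xor-self true  = refl

-- Loop erasure that watches parity: an erased closed piece of odd length is itself the odd cycle,
-- and erasing an even one leaves the parity as it was.
parityShorten : (p : Walk E u v m) →
  (∃[ k ] k ≤ m × Cycle E k × par k ≡ true) ⊎ (∃[ i ] i ≤ m × Path E u v i × par i ≡ par m)
parityShorten [] = inj₂ (0 , z≤n , trivial , refl)
parityShorten {u = u} {m = suc m} (e ∷ p) with parityShorten p
... | inj₁ (k , k≤m , Z , odd) = inj₁ (k , m≤n⇒m≤1+n k≤m , Z , odd)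
... | inj₂ (i , i≤m , q , same) with u ∈? walk q
...   | no u∉ = inj₂ (suc i , s≤s i≤m , cons e q u∉ , cong not same)
...   | yes u∈ with split q u∈
...     | S with par (Split.ℓ₁ S) in eq
...       | false = inj₁ (suc S.ℓ₁ , s≤s (≤-trans (m+n≤o⇒m≤o S.ℓ₁ (≤-reflexive S.total)) i≤m)
                         , cycle refl S.front e , cong not eq)
  where module S = Split S
...       | true  = inj₂ (S.ℓ₂ , m≤n⇒m≤1+n (≤-trans (m+n≤o⇒n≤o S.ℓ₁ (≤-reflexive S.total)) i≤m) , S.back
                         , back-par)
  where
  module S = Split S
  flip : ∀ {a b c} → a ≡ true → c ≡ a xor b → b ≡ not c
  flip {b = false} refl refl = refl
  flip {b = true}  refl refl = refl
  back-par : par S.ℓ₂ ≡ not (par m)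
  back-par = trans (flip eq (trans (cong par (sym S.total)) (par-+ S.ℓ₁ S.ℓ₂))) (cong not same)

loop-trivial : Path E u u m → m ≡ 0
loop-trivial (path []      _)       = refl
loop-trivial (path (e ∷ p) (h , _)) = ⊥-elim (h (end∈ p))

oddClosed : Walk E u u m → par m ≡ true → ∃[ k ] k ≤ m × Cycle E k × par k ≡ true
oddClosed p odd with parityShorten p
... | inj₁ c = c
... | inj₂ (i , _ , q , same) with loop-trivial q
... | refl with () ← trans same odd

-- Lists allow induction edge by edge in `reach`, `bipartite` and `linkOrSep`; `⟦_⟧` reads each pair
-- in both directions.
Edgeset : ℕ → Set
Edgeset n = List (Fin n × Fin n)

⟦_⟧ : Edgeset n → Edges n
⟦ L ⟧ u v = (u , v) List.∈ L ⊎ (v , u) List.∈ L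

weaken : ∀ {L : Edgeset n} {e} → ⟦ L ⟧ u v → ⟦ e ∷ L ⟧ u v
weaken (inj₁ h) = inj₁ (there h)
weaken (inj₂ h) = inj₂ (there h)

data Last {n} (a b : Fin n) (L : Edgeset n) : Fin n → Fin n → Set where
  new  : Last a b L a b
  new′ : Last a b L b a
  old  : ⟦ L ⟧ u v → Last a b L u v

last : ∀ {a b : Fin n} {L} → ⟦ (a , b) ∷ L ⟧ u v → Last a b L u v
last (inj₁ (here refl)) = new
last (inj₁ (there h))   = old (inj₁ h)
last (inj₂ (here refl)) = new′
last (inj₂ (there h))   = old (inj₂ h)

record Cut {n} (E : Edges n) (a b : Fin n) : Set₁ where
  field
    W      : Subset n
    W?     : Decidable W
    inside : W a
    outside : ¬ W b
    closed : ∀ {u v} → E u v → W u → W v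

-- If the new edge `ab` leaves the old cut at `a`, the old graph is asked for walks from `u` to `a`
-- and from `b` to `v`. Two walks join up across `ab`; a cut against `a` is intersected with the old
-- one, a cut around `b` is united with it.
reach : (L : Edgeset n) (u v : Fin n) → Cut ⟦ L ⟧ u v ⊎ (∃[ m ] Walk ⟦ L ⟧ u v m)
reach [] u v with u ≟ v
... | yes refl = inj₂ (0 , [])
... | no u≢v   = inj₁ record
  { W = _≡ u ; W? = _≟ u ; inside = refl ; outside = u≢v ∘ sym ; closed = λ { (inj₁ ()) ; (inj₂ ()) } }
reach ((a , b) ∷ L) u v with reach L u v
... | inj₂ (m , p) = inj₂ (m , mapʷ weaken p)
... | inj₁ C = across (W? a) (W? b)
  where
  open Cut C
  E′ = ⟦ (a , b) ∷ L ⟧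
  extend : ∀ {a b} → W a → ¬ W b → E′ a b → (∀ {u v} → E′ u v → Last a b L u v) →
    Cut E′ u v ⊎ (∃[ m ] Walk E′ u v m)
  extend {a} {b} wa ¬wb e cases with reach L u a
  ... | inj₁ C′ = inj₁ record
    { W = λ x → W x × C′.W x ; W? = λ x → W? x ×-dec C′.W? x ; inside = inside , C′.inside
    ; outside = outside ∘ proj₁
    ; closed = λ h (w , w′) → case cases h of λ
        { new → ⊥-elim (C′.outside w′) ; new′ → ⊥-elim (¬wb w) ; (old o) → closed o w , C′.closed o w′ } }
    where module C′ = Cut C′
  ... | inj₂ (_ , p) with reach L b v
  ...   | inj₂ (_ , q) = inj₂ (_ , (mapʷ weaken p ++ (e ∷ mapʷ weaken q)))
  ...   | inj₁ C″ = inj₁ record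
    { W = λ x → W x ⊎ C″.W x ; W? = λ x → W? x ⊎-dec C″.W? x ; inside = inj₁ inside
    ; outside = [ outside , C″.outside ]′
    ; closed = λ h w → case cases h of λ
        { new → inj₂ C″.inside ; new′ → inj₁ wa ; (old o) → [ inj₁ ∘ closed o , inj₂ ∘ C″.closed o ]′ w } }
    where module C″ = Cut C″
  same : (W a → W b) → (W b → W a) → Cut E′ u v
  same f g = record
    { W = W ; W? = W? ; inside = inside ; outside = outside
    ; closed = λ h w → case last h of λ { new → f w ; new′ → g w ; (old o) → closed o w } }
  last′ : ∀ {u v} → E′ u v → Last b a L u v
  last′ h = case last h of λ { new → new′ ; new′ → new ; (old o) → old o }
  across : Dec (W a) → Dec (W b) → Cut E′ u v ⊎ (∃[ m ] Walk E′ u v m)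
  across (yes wa) (yes wb) = inj₁ (same (λ _ → wb) (λ _ → wa))
  across (no ¬wa) (no ¬wb) = inj₁ (same (λ w → ⊥-elim (¬wa w)) (λ w → ⊥-elim (¬wb w)))
  across (yes wa) (no ¬wb) = extend wa ¬wb (inj₁ (here refl)) last
  across (no ¬wa) (yes wb) = extend wb ¬wa (inj₂ (here refl)) last′

Bipartition : Edges n → Set
Bipartition {n} E = Σ[ f ∈ (Fin n → Bool) ] (∀ {u v} → E u v → f v ≡ not (f u))

walk-parity : ((f , _) : Bipartition E) → Walk E u v m → f v ≡ par m xor f u
walk-parity B         []      = refl
walk-parity B@(f , h) (_∷_ {m = m} e p) =
  trans (walk-parity B p) (trans (cong (par m xor_) (h e)) (swap-not (par m) _))
  where
  swap-not : ∀ a b → a xor not b ≡ not a xor b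
  swap-not false b     = refl
  swap-not true  false = refl
  swap-not true  true  = refl

OddCycle : Edges n → Set
OddCycle E = ∃[ m ] Cycle E m × par m ≡ true

differ : ∀ {a b} → a ≢ b → b ≡ not a
differ {false} {false} h = ⊥-elim (h refl)
differ {false} {true}  h = refl
differ {true}  {false} h = refl
differ {true}  {true}  h = ⊥-elim (h refl)

-- A new edge within a colour class either closes a path between its ends, necessarily of even
-- length, to an odd cycle, or its ends are separated by a cut and the colours are exchanged on one
-- side.
bipartite : (L : Edgeset n) → Bipartition ⟦ L ⟧ ⊎ OddCycle ⟦ L ⟧
bipartite [] = inj₁ ((λ _ → false) , λ { (inj₁ ()) ; (inj₂ ()) })
bipartite ((a , b) ∷ L) with bipartite L
... | inj₂ (m , Z , odd) = inj₂ (m , mapᶜ weaken Z , odd)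
... | inj₁ B@(f , proper) with f a Bool.≟ f b
...   | no h = inj₁ (f , λ e → case last e of λ
          { new → differ h ; new′ → differ (h ∘ sym) ; (old o) → proper o })
...   | yes h with reach L a b
...     | inj₂ (m , p) = inj₂ (suc ℓ , cycle refl (mapᵖ weaken q) (inj₂ (here refl)) , cong not even)
  where
  ℓ = proj₁ (shorten p)
  q = proj₁ (proj₂ (proj₂ (shorten p)))
  cancel : ∀ {x y} → y ≡ x xor y → x ≡ false
  cancel {false} _ = refl
  cancel {true} {false} ()
  cancel {true} {true}  ()
  even : par ℓ ≡ false
  even = cancel (trans h (walk-parity B (walk q)))
...     | inj₁ C = inj₁ (g , λ e → case last e of λ
          { new  → trans g-out (trans (sym h) (sym (trans (cong not g-in) (not-involutive _))))
          ; new′ → trans g-in (cong not (trans h (sym g-out)))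
          ; (old o) → g-old o })
  where
  open Cut C
  g : Fin _ → Bool
  g v with W? v
  ... | yes _ = not (f v)
  ... | no  _ = f v
  g-in : g a ≡ not (f a)
  g-in with W? a
  ... | yes _ = refl
  ... | no h′ = ⊥-elim (h′ inside)
  g-out : g b ≡ f b
  g-out with W? b
  ... | yes h′ = ⊥-elim (outside h′)
  ... | no  _ = refl
  g-old : ∀ {u v} → ⟦ L ⟧ u v → g v ≡ not (g u)
  g-old {u} {v} o with W? u | W? v
  ... | yes _ | yes _ = cong not (proper o)
  ... | no  _ | no  _ = proper o
  ... | yes p | no q  = ⊥-elim (q (closed o p))
  ... | no p  | yes q = ⊥-elim (p (closed (swap o) q))

-- Menger's theorem for two paths

-- A separation of order at most one: `W` is the side of `X` without the cut vertex `d`, so every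
-- walk from `X` to `Y` passes through `d`.
record Sep {n} (E : Edges n) (X Y : Subset n) : Set₁ where
  field
    W      : Subset n
    W?     : Decidable W
    d      : Fin n
    d∉W    : ¬ W d
    X⊆     : ∀ {x} → X x → W x ⊎ x ≡ d
    Y∩     : ∀ {x} → Y x → ¬ W x
    closed : ∀ {u v} → E u v → W u → W v ⊎ v ≡ d

record Linkage {n} (E : Edges n) (X Y : Subset n) : Set where
  field
    {x₁ y₁ x₂ y₂} : Fin n
    {ℓ₁ ℓ₂}  : ℕ
    p        : Path E x₁ y₁ ℓ₁
    q        : Path E x₂ y₂ ℓ₂
    X₁       : X x₁
    Y₁       : Y y₁
    X₂       : X x₂
    Y₂       : Y y₂
    disjoint : ∀ {x} → x ∈ᵖ p → ¬ x ∈ᵖ q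

reverseˡ : ∀ {X Y : Subset n} → Symm E → Linkage E X Y → Linkage E Y X
reverseˡ s Λ = record
  { p = proj₁ (reverse s L.p) ; q = proj₁ (reverse s L.q) ; X₁ = L.Y₁ ; Y₁ = L.X₁ ; X₂ = L.Y₂ ; Y₂ = L.X₂
  ; disjoint = λ h h′ → L.disjoint (proj₂ (reverse s L.p) h) (proj₂ (reverse s L.q) h′) }
  where module L = Linkage Λ

mapˡ : ∀ {X Y : Subset n} → (∀ {u v} → E u v → F u v) → Linkage E X Y → Linkage F X Y
mapˡ f Λ = record
  { p = mapᵖ f L.p ; q = mapᵖ f L.q ; X₁ = L.X₁ ; Y₁ = L.Y₁ ; X₂ = L.X₂ ; Y₂ = L.Y₂
  ; disjoint = λ h h′ → L.disjoint (mapᵖ-∈ {f = f} L.p h) (mapᵖ-∈ {f = f} L.q h′) }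
  where module L = Linkage Λ

record Towards {n} (E : Edges n) (X : Subset n) (a b : Fin n) : Set where
  field
    {x₁ x₂}  : Fin n
    {ℓ₁ ℓ₂}  : ℕ
    p        : Path E x₁ a ℓ₁
    q        : Path E x₂ b ℓ₂
    Xx       : X x₁
    Xy       : X x₂
    disjoint : ∀ {x} → x ∈ᵖ p → ¬ x ∈ᵖ q

towards : ∀ {X : Subset n} {a b} → Linkage E X (λ v → v ≡ a ⊎ v ≡ b) → Towards E X a b
towards Λ = go L.Y₁ L.Y₂ L.p L.q L.disjoint L.X₁ L.X₂
  where
  module L = Linkage Λ
  go : ∀ {n} {E : Edges n} {X : Subset n} {a b x₁ x₂ y₁ y₂ i j} → y₁ ≡ a ⊎ y₁ ≡ b → y₂ ≡ a ⊎ y₂ ≡ b →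
    (p : Path E x₁ y₁ i) (q : Path E x₂ y₂ j) → (∀ {x} → x ∈ᵖ p → ¬ x ∈ᵖ q) → X x₁ → X x₂ → Towards E X a b
  go (inj₁ refl) (inj₁ refl) p q dis X₁ X₂ = ⊥-elim (dis (end∈ᵖ p) (end∈ᵖ q))
  go (inj₁ refl) (inj₂ refl) p q dis X₁ X₂ = record { p = p ; q = q ; Xx = X₁ ; Xy = X₂ ; disjoint = dis }
  go (inj₂ refl) (inj₁ refl) p q dis X₁ X₂ =
    record { p = q ; q = p ; Xx = X₂ ; Xy = X₁ ; disjoint = λ h h′ → dis h′ h }
  go (inj₂ refl) (inj₂ refl) p q dis X₁ X₂ = ⊥-elim (dis (end∈ᵖ p) (end∈ᵖ q))

module _ {n} {E : Edges n} {W : Subset n} {d : Fin n} (closed : ∀ {u v} → E u v → W u → W v ⊎ v ≡ d) where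

  stays : (p : Walk E u v m) → W u → ¬ d ∈ p → x ∈ p → W x
  stays p       wu d∉ here      = wu
  stays (e ∷ p) wu d∉ (there h) with closed e wu
  ... | inj₁ w    = stays p w (d∉ ∘ there) h
  ... | inj₂ refl = ⊥-elim (d∉ (there here))

  stays-until : (p : Path E u d m) → W u ⊎ u ≡ d → x ∈ᵖ p → W x ⊎ x ≡ d
  stays-until p                wu          here      = wu
  stays-until (path (e ∷ p) (h , _)) (inj₂ refl) (there _) = ⊥-elim (h (end∈ p))
  stays-until (path (e ∷ p) (_ , s)) (inj₁ wu)   (there h) = stays-until (path p s) (closed e wu) h

  module _ (s : Symm E) where

    avoids : (p : Walk E u v m) → ¬ W u → ¬ d ∈ p → x ∈ p → ¬ W x
    avoids p       ¬wu d∉ here      = ¬wu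
    avoids (e ∷ p) ¬wu d∉ (there h) =
      avoids p (λ wv → [ ¬wu , (λ { refl → d∉ here }) ]′ (closed (s e) wv)) (d∉ ∘ there) h

    avoids-until : ¬ W d → (p : Path E u d m) → ¬ W u → x ∈ᵖ p → ¬ W x
    avoids-until ¬wd p                      ¬wu here      = ¬wu
    avoids-until ¬wd (path (e ∷ p) (h , sp)) ¬wu (there x∈) =
      avoids-until ¬wd (path p sp) (λ wv → [ ¬wu , (λ { refl → h (end∈ p) }) ]′ (closed (s e) wv)) x∈

-- Induction on the edges, for all `X` and `Y` at once. If the new edge `ab` leaves `W` at `a`, the
-- old graph is asked for linkages from `X` to {`d`, `a`} and from {`d`, `b`} to `Y`. Two linkages
-- are combined through `d` and across `ab`; a separation in either place yields one for the new
-- graph. Without edges, the linked paths are common vertices.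
linkOrSep : (L : Edgeset n) (d₀ : Fin n) {X Y : Subset n} → Decidable X → Decidable Y →
  Linkage ⟦ L ⟧ X Y ⊎ Sep ⟦ L ⟧ X Y
linkOrSep [] d₀ {X} {Y} X? Y? with any? (λ u → any? (λ v → (X? u ×-dec Y? u) ×-dec (X? v ×-dec Y? v) ×-dec ¬? (u ≟ v)))
... | yes (u , v , (xu , yu) , (xv , yv) , u≢v) = inj₁ record
  { p = trivial {u = u} ; q = trivial {u = v} ; X₁ = xu ; Y₁ = yu ; X₂ = xv ; Y₂ = yv
  ; disjoint = λ { here here → u≢v refl } }
... | no none = inj₂ record
  { W = λ x → X x × x ≢ d ; W? = λ x → X? x ×-dec ¬? (x ≟ d) ; d = d ; d∉W = λ (_ , h) → h refl
  ; X⊆ = λ {x} xx → case x ≟ d of λ { (yes eq) → inj₂ eq ; (no h) → inj₁ (xx , h) }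
  ; Y∩ = λ yx (xx , h) → h (proj₂ D xx yx)
  ; closed = λ { (inj₁ ()) ; (inj₂ ()) } }
  where
  D : Σ[ d ∈ Fin _ ] (∀ {x} → X x → Y x → x ≡ d)
  D with any? (λ u → X? u ×-dec Y? u)
  -- `d₀` is a default for disjoint `X` and `Y`.
  ... | no h = d₀ , λ xx yx → ⊥-elim (h (_ , xx , yx))
  ... | yes (d , xd , yd) = d , λ {x} xx yx → case x ≟ d of λ
    { (yes eq) → eq ; (no h) → ⊥-elim (none (x , d , (xx , yx) , (xd , yd) , h)) }
  d = proj₁ D
linkOrSep {n} ((a , b) ∷ L) d₀ {X} {Y} X? Y? with linkOrSep L d₀ X? Y?
... | inj₁ Λ = inj₁ (mapˡ weaken Λ)
... | inj₂ S = across (W? a) (W? b)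
  where
  open Sep S
  E′ = ⟦ (a , b) ∷ L ⟧
  sym′ : Symm E′
  sym′ = swap
  extend : ∀ {a b} → E′ a b → (∀ {u v} → E′ u v → Last a b L u v) → W a → ¬ W b → Linkage E′ X Y ⊎ Sep E′ X Y
  extend {a} {b} e cases wa ¬wb with linkOrSep L d₀ {Y = λ v → v ≡ d ⊎ v ≡ a} X? (λ v → (v ≟ d) ⊎-dec (v ≟ a))
  -- Neither `d` nor `a` lies in `S₁.W`, so the intersection with `W` can be left only through
  -- `S₁.d`.
  ... | inj₂ S₁ = inj₂ record
    { W = λ x → W x × S₁.W x ; W? = λ x → W? x ×-dec S₁.W? x ; d = S₁.d ; d∉W = S₁.d∉W ∘ proj₂
    ; X⊆ = λ xx → case S₁.X⊆ xx of λ
        { (inj₂ eq) → inj₂ eq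
        ; (inj₁ w₁) → [ (λ w → inj₁ (w , w₁)) , (λ eq → ⊥-elim (S₁.Y∩ (inj₁ eq) w₁)) ]′ (X⊆ xx) }
    ; Y∩ = λ yx → Y∩ yx ∘ proj₁
    ; closed = λ h (w , w₁) → case cases h of λ
        { new → ⊥-elim (S₁.Y∩ (inj₂ refl) w₁)
        ; new′ → ⊥-elim (¬wb w)
        ; (old o) → case S₁.closed o w₁ of λ
            { (inj₂ eq) → inj₂ eq
            ; (inj₁ w₁′) → [ (λ w′ → inj₁ (w′ , w₁′)) , (λ eq → ⊥-elim (S₁.Y∩ (inj₁ eq) w₁′)) ]′ (closed o w) } } }
    where module S₁ = Sep S₁
  ... | inj₁ Λ₁ with linkOrSep L d₀ {X = λ v → v ≡ d ⊎ v ≡ b} (λ v → (v ≟ d) ⊎-dec (v ≟ b)) Y?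
  -- Leaving `W` means entering `d` or crossing to `b`, and both belong to `S₂.W` or equal `S₂.d`.
  -- The latter may lie in `W` and is taken out of the union.
  ...   | inj₂ S₂ = inj₂ record
    { W = λ x → (W x ⊎ S₂.W x) × x ≢ S₂.d ; W? = λ x → (W? x ⊎-dec S₂.W? x) ×-dec ¬? (x ≟ S₂.d)
    ; d = S₂.d ; d∉W = λ (_ , h) → h refl
    ; X⊆ = λ xx → off ([ inj₁ ∘ inj₁ , via-d ]′ (X⊆ xx))
    ; Y∩ = λ yx (w , _) → [ Y∩ yx , S₂.Y∩ yx ]′ w
    ; closed = λ h (w , _) → off (case cases h of λ
        { new     → [ inj₁ ∘ inj₂ , inj₂ ]′ (S₂.X⊆ (inj₂ refl))
        ; new′    → inj₁ (inj₁ wa)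
        ; (old o) → [ (λ w₁ → [ inj₁ ∘ inj₁ , via-d ]′ (closed o w₁))
                    , (λ w₂ → [ inj₁ ∘ inj₂ , inj₂ ]′ (S₂.closed o w₂)) ]′ w }) }
    where
    module S₂ = Sep S₂
    off : ∀ {x} → (W x ⊎ S₂.W x) ⊎ x ≡ S₂.d → ((W x ⊎ S₂.W x) × x ≢ S₂.d) ⊎ x ≡ S₂.d
    off (inj₂ eq) = inj₂ eq
    off {x} (inj₁ w) with x ≟ S₂.d
    ... | yes eq = inj₂ eq
    ... | no h   = inj₁ (w , h)
    via-d : ∀ {x} → x ≡ d → (W x ⊎ S₂.W x) ⊎ x ≡ S₂.d
    via-d refl = [ inj₁ ∘ inj₂ , inj₂ ]′ (S₂.X⊆ (inj₁ refl))
  ...   | inj₁ Λ₂ = inj₁ record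
    { p = proj₁ r₁ ; q = proj₁ r₂ ; X₁ = P.Xx ; X₂ = P.Xy ; Y₁ = Q.Xx ; Y₂ = Q.Xy
    ; disjoint = λ h₁ h₂ → case r₁⊆ h₁ , r₂⊆ h₂ of λ
        { (inj₁ hp , inj₁ hq) → P.disjoint hp hq
        ; (inj₂ hp , inj₂ hq) → Q.disjoint hp hq
        ; (inj₁ hp , inj₂ hq) → [ out-Qb hq , (λ eq → d∉Qb (subst (_∈ᵖ Q.q) eq hq)) ]′ (in-Pd hp)
        ; (inj₂ hp , inj₁ hq) → out-Qd hp (in-Pa hq) } }
    where
    module P = Towards (towards Λ₁)
    module Q = Towards (towards (reverseˡ swap Λ₂))
    -- The paths from `X` stay in `W` until `d`, those to `Y` avoid `W`; hence the two families meet
    -- at most in `d`.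
    in-Pd : ∀ {x} → x ∈ᵖ P.p → W x ⊎ x ≡ d
    in-Pd = stays-until closed P.p (X⊆ P.Xx)
    d∉Pa : ¬ d ∈ᵖ P.q
    d∉Pa = P.disjoint (end∈ᵖ P.p)
    in-Pa : ∀ {x} → x ∈ᵖ P.q → W x
    in-Pa = stays closed (walk P.q) ([ id , (λ eq → ⊥-elim (d∉Pa (subst (_∈ᵖ P.q) eq here))) ]′ (X⊆ P.Xy)) d∉Pa
    out-Qd : ∀ {x} → x ∈ᵖ Q.p → ¬ W x
    out-Qd = avoids-until closed swap d∉W Q.p (Y∩ Q.Xx)
    d∉Qb : ¬ d ∈ᵖ Q.q
    d∉Qb = Q.disjoint (end∈ᵖ Q.p)
    out-Qb : ∀ {x} → x ∈ᵖ Q.q → ¬ W x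
    out-Qb = avoids closed swap (walk Q.q) (Y∩ Q.Xy) d∉Qb
    R₁ = reverse sym′ (mapᵖ {F = E′} weaken Q.p)
    R₂ = reverse sym′ (mapᵖ {F = E′} weaken Q.q)
    R₁⊆ : ∀ {x} → x ∈ᵖ proj₁ R₁ → x ∈ᵖ Q.p
    R₁⊆ = mapᵖ-∈ {f = weaken} Q.p ∘ proj₂ R₁
    R₂⊆ : ∀ {x} → x ∈ᵖ proj₁ R₂ → x ∈ᵖ Q.q
    R₂⊆ = mapᵖ-∈ {f = weaken} Q.q ∘ proj₂ R₂
    P₁⊆ : ∀ {x} → x ∈ᵖ mapᵖ {F = E′} weaken P.p → x ∈ᵖ P.p
    P₁⊆ = mapᵖ-∈ {f = weaken} P.p
    P₂⊆ : ∀ {x} → x ∈ᵖ mapᵖ {F = E′} weaken P.q → x ∈ᵖ P.q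
    P₂⊆ = mapᵖ-∈ {f = weaken} P.q
    a∉R₂ : ¬ a ∈ᵖ proj₁ R₂
    a∉R₂ h = out-Qb (R₂⊆ h) wa
    r₁ = join (mapᵖ weaken P.p) (proj₁ R₁) λ hp hq → [ (λ w → ⊥-elim (out-Qd (R₁⊆ hq) w)) , id ]′ (in-Pd (P₁⊆ hp))
    r₂ = join (mapᵖ weaken P.q) (cons e (proj₁ R₂) a∉R₂) λ
      { hp here → refl ; hp (there hq) → ⊥-elim (out-Qb (R₂⊆ hq) (in-Pa (P₂⊆ hp))) }
    r₁⊆ : ∀ {x} → x ∈ᵖ proj₁ r₁ → x ∈ᵖ P.p ⊎ x ∈ᵖ Q.p
    r₁⊆ h = [ inj₁ ∘ P₁⊆ , inj₂ ∘ R₁⊆ ]′ (proj₂ r₁ h)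
    r₂⊆ : ∀ {x} → x ∈ᵖ proj₁ r₂ → x ∈ᵖ P.q ⊎ x ∈ᵖ Q.q
    r₂⊆ h = [ inj₁ ∘ P₂⊆ , (λ { here → inj₁ (end∈ᵖ P.q) ; (there hq) → inj₂ (R₂⊆ hq) }) ]′ (proj₂ r₂ h)
  same : (W a → W b) → (W b → W a) → Sep E′ X Y
  same f g = record { Sep S ; closed = λ h w → case last h of λ
    { new → inj₁ (f w) ; new′ → inj₁ (g w) ; (old o) → closed o w } }
  last′ : ∀ {u v} → E′ u v → Last b a L u v
  last′ h = case last h of λ { new → new′ ; new′ → new ; (old o) → old o }
  across : Dec (W a) → Dec (W b) → Linkage E′ X Y ⊎ Sep E′ X Y
  across (yes wa) (yes wb) = inj₂ (same (λ _ → wb) (λ _ → wa))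
  across (no ¬wa) (no ¬wb) = inj₂ (same (λ w → ⊥-elim (¬wa w)) (λ w → ⊥-elim (¬wb w)))
  across (yes wa) (no ¬wb) = extend (inj₁ (here refl)) last wa ¬wb
  across (no ¬wa) (yes wb) = extend (inj₂ (here refl)) last′ wb ¬wa

-- Colourings and separations

Colourable : Edges n → ℕ → Set
Colourable {n} E k = Σ[ f ∈ (Fin n → Fin k) ] (∀ {u v} → E u v → f u ≢ f v)

-- A subgraph keeps the vertex set and conjoins a predicate to `Edge`. Loops are excluded later, by
-- the conditions on odd cycle lengths.
record Net (n : ℕ) : Set₁ where
  field
    Edge     : Edges n
    edge?    : ∀ u v → Dec (Edge u v)
    edge-sym : Symm Edge

restrict : (G : Net n) {P : Edges n} → (∀ u v → Dec (P u v)) → Symm P → Net n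
restrict G {P} P? s = record
  { Edge = λ u v → Edge u v × P u v ; edge? = λ u v → edge? u v ×-dec P? u v
  ; edge-sym = λ (e , p) → edge-sym e , s p }
  where open Net G

edges : Net n → Edgeset n
edges {n} G = filter (λ (u , v) → Net.edge? G u v) (cartesianProduct (allFin n) (allFin n))

module _ {n} (G : Net n) where
  open Net G

  listed : Edge u v → ⟦ edges G ⟧ u v
  listed {u} {v} e = inj₁ (∈-filter⁺ _ (∈-cartesianProduct⁺ (∈-allFin u) (∈-allFin v)) e)

  unlisted : ⟦ edges G ⟧ u v → Edge u v
  unlisted = [ at , edge-sym ∘ at ]′
    where
    at : (u , v) List.∈ edges G → Edge u v
    at h = proj₂ (∈-filter⁻ (λ (u , v) → edge? u v) {xs = cartesianProduct (allFin _) (allFin _)} h)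

  bipartiteᴳ : Bipartition Edge ⊎ OddCycle Edge
  bipartiteᴳ with bipartite (edges G)
  ... | inj₁ (f , proper)  = inj₁ (f , proper ∘ listed)
  ... | inj₂ (m , Z , odd) = inj₂ (m , mapᶜ unlisted Z , odd)

-- Minimality in positive form: every subgraph lacking at least one edge is colourable. Instead of
-- reaching a contradiction, each argument ends with a colouring.
Critical : Net n → ℕ → Set₁
Critical {n} G k = {P : Edges n} (P? : ∀ u v → Dec (P u v)) (s : Symm P) → ∀ {u v} →
  Net.Edge G u v → ¬ P u v → Colourable (Net.Edge (restrict G P? s)) k

Trimmed : ∀ {X Y : Subset n} → Linkage E X Y → Set
Trimmed {X = X} {Y} Λ = (∀ {x} → x ∈ᵖ p → X x → x ≡ x₁) × (∀ {x} → x ∈ᵖ p → Y x → x ≡ y₁)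
                      × (∀ {x} → x ∈ᵖ q → X x → x ≡ x₂) × (∀ {x} → x ∈ᵖ q → Y x → x ≡ y₂)
  where open Linkage Λ

module _ {n} {E : Edges n} {X Y : Subset n} (s : Symm E) (X? : Decidable X) (Y? : Decidable Y) where

  record Tight (p : Path E u v m) : Set where
    field
      {a b}  : Fin n
      {ℓ}    : ℕ
      path′  : Path E a b ℓ
      a∈X    : X a
      b∈Y    : Y b
      sub    : ∀ {x} → x ∈ᵖ path′ → x ∈ᵖ p
      only-a : ∀ {x} → x ∈ᵖ path′ → X x → x ≡ a
      only-b : ∀ {x} → x ∈ᵖ path′ → Y x → x ≡ b

  -- The path is cut at its first vertex in `Y` and then, run backwards, at the first vertex in `X`;
  -- the second cut only removes vertices and so preserves the effect of the first.
  tighten : (p : Path E u v m) → X u → Y v → Tight p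
  tighten p xu yv = record
    { path′ = proj₁ R′ ; a∈X = T′.y∈Y ; b∈Y = T.y∈Y ; sub = T.sub ∘ sub′
    ; only-a = T′.first ∘ proj₂ R′ ; only-b = T.first ∘ sub′ }
    where
    module T = Trim (trim Y? p yv)
    R = reverse s T.path′
    module T′ = Trim (trim X? (proj₁ R) xu)
    R′ = reverse s T′.path′
    sub′ : ∀ {x} → x ∈ᵖ proj₁ R′ → x ∈ᵖ T.path′
    sub′ = proj₂ R ∘ T′.sub ∘ proj₂ R′

  tightenˡ : Linkage E X Y → Σ (Linkage E X Y) Trimmed
  tightenˡ Λ = record
    { p = P.path′ ; q = Q.path′ ; X₁ = P.a∈X ; Y₁ = P.b∈Y ; X₂ = Q.a∈X ; Y₂ = Q.b∈Y
    ; disjoint = λ hp hq → L.disjoint (P.sub hp) (Q.sub hq) }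
    , P.only-a , P.only-b , Q.only-a , Q.only-b
    where
    module L = Linkage Λ
    module P = Tight (tighten L.p L.X₁ L.Y₁)
    module Q = Tight (tighten L.q L.X₂ L.Y₂)

  -- The cycle runs along `p`, `B`, `q` backwards and `A`. Allowing `A` and `B` to share `x₁` or
  -- `y₂` covers sets `X` and `Y` that meet.
  closeLink : (T : Σ (Linkage E X Y) Trimmed) → let open Linkage (proj₁ T) in
    (A : Path E x₂ x₁ i) → (∀ {x} → x ∈ᵖ A → X x) →
    (B : Path E y₁ y₂ j) → (∀ {x} → x ∈ᵖ B → Y x) →
    (∀ {x} → x ∈ᵖ A → x ∈ᵖ B → x ≡ x₁ ⊎ x ≡ y₂) → Cycle E ((ℓ₁ + j) + (ℓ₂ + i))
  closeLink (Λ , pX , pY , qX , qY) A A⊆ B B⊆ AB = proj₁ (closeUp (proj₁ pB) (proj₁ qA)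
      (λ eq → disjoint here (subst (_∈ᵖ q) (sym eq) (end∈ᵖ q)))
      λ h h′ → case proj₂ pB h , proj₂ qA h′ of λ
        { (inj₁ hp , inj₁ hq) → ⊥-elim (disjoint hp (proj₂ q⁻¹ hq))
        ; (inj₁ hp , inj₂ hA) → inj₁ (pX hp (A⊆ hA))
        ; (inj₂ hB , inj₁ hq) → inj₂ (qY (proj₂ q⁻¹ hq) (B⊆ hB))
        ; (inj₂ hB , inj₂ hA) → AB hA hB })
    where
    open Linkage Λ
    q⁻¹ = reverse s q
    pB = join p B (λ hp hB → pY hp (B⊆ hB))
    qA = join (proj₁ q⁻¹) A (λ hq hA → qX (proj₂ q⁻¹ hq) (A⊆ hA))

module _ {n} (G : Net n) (d₀ : Fin n) where
  open Net G

  linkageᴳ : {X Y : Subset n} → Decidable X → Decidable Y → Σ (Linkage Edge X Y) Trimmed ⊎ Sep Edge X Y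
  linkageᴳ X? Y? with linkOrSep (edges G) d₀ X? Y?
  ... | inj₁ Λ = inj₁ (tightenˡ edge-sym X? Y? (mapˡ (unlisted G) Λ))
  ... | inj₂ S = inj₂ record { Sep S ; closed = Sep.closed S ∘ listed G }

⁅_∣_⁆ : Fin n → Fin n → Subset n
⁅ a ∣ b ⁆ v = v ≡ a ⊎ v ≡ b

⁅_∣_⁆? : (a b : Fin n) → Decidable ⁅ a ∣ b ⁆
⁅ a ∣ b ⁆? v = (v ≟ a) ⊎-dec (v ≟ b)

record Through {n} (E : Edges n) (s t u v : Fin n) : Set where
  field
    {ℓ₁ ℓ₂}  : ℕ
    front    : Path E s u ℓ₁
    back     : Path E v t ℓ₂
    disjoint : ∀ {x} → x ∈ᵖ front → ¬ x ∈ᵖ back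

whole : ∀ {s t} → (T : Through E s t u v) → E u v → Path E s t (Through.ℓ₁ T + suc (Through.ℓ₂ T))
whole T e = proj₁ (join front (cons e back (disjoint (end∈ᵖ front)))
  λ { _ here → refl ; hf (there hb) → ⊥-elim (disjoint hf hb) })
  where open Through T

-- Menger between {`u`, `v`} and {`s`, `t`}: two disjoint paths extend the edge to an `s`-`t` path
-- in one of the two directions.
throughOrSep : (G : Net n) (s t u v : Fin n) → let open Net G in
  (Through Edge s t u v ⊎ Through Edge s t v u) ⊎ Sep Edge ⁅ u ∣ v ⁆ ⁅ s ∣ t ⁆
throughOrSep G s t u v with linkageᴳ G s ⁅ u ∣ v ⁆? ⁅ s ∣ t ⁆?
... | inj₂ S = inj₂ S
... | inj₁ (Λ , _) = inj₁ (orient L.Xx L.Xy L.p L.q L.disjoint)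
  where
  open Net G
  module L = Towards (towards (reverseˡ edge-sym Λ))
  orient : ∀ {a b i j} → ⁅ s ∣ t ⁆ a → ⁅ s ∣ t ⁆ b → (p : Path Edge a u i) (q : Path Edge b v j) →
    (∀ {x} → x ∈ᵖ p → ¬ x ∈ᵖ q) → Through Edge s t u v ⊎ Through Edge s t v u
  orient (inj₁ refl) (inj₁ refl) p q dis = ⊥-elim (dis here here)
  orient (inj₂ refl) (inj₂ refl) p q dis = ⊥-elim (dis here here)
  orient (inj₁ refl) (inj₂ refl) p q dis = inj₁ record
    { front = p ; back = proj₁ (reverse edge-sym q) ; disjoint = λ hp hq → dis hp (proj₂ (reverse edge-sym q) hq) }
  orient (inj₂ refl) (inj₁ refl) p q dis = inj₂ record
    { front = q ; back = proj₁ (reverse edge-sym p) ; disjoint = λ hq hp → dis (proj₂ (reverse edge-sym p) hp) hq }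

-- Makes "otherwise the goal is reached" constructive: each member of a finite family may deliver
-- the goal `B` in place of its own claim.
collect : ∀ {n} {A : Fin n → Set} {B : Set} → (∀ i → A i ⊎ B) → (∀ i → A i) ⊎ B
collect {zero}  f = inj₁ λ ()
collect {suc n} f with f zero | collect (f ∘ suc)
... | inj₂ b | _      = inj₂ b
... | _      | inj₂ b = inj₂ b
... | inj₁ a | inj₁ g = inj₁ λ { zero → a ; (suc i) → g i }

collectEdges : ∀ {n} (G : Net n) {A : Edges n} {B : Set} → let open Net G in
  (∀ {u v} → Edge u v → A u v ⊎ B) → (∀ {u v} → Edge u v → A u v) ⊎ B
collectEdges {n} G {A} {B} f = [ (λ g → inj₁ λ {u} {v} → g u v) , inj₂ ]′ (collect λ u → collect (at u))
  where
  open Net G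
  at : ∀ u v → (Edge u v → A u v) ⊎ B
  at u v with edge? u v
  ... | yes e = [ (λ a → inj₁ λ _ → a) , inj₂ ]′ (f e)
  ... | no ¬e = inj₁ (⊥-elim ∘ ¬e)

swap-inj : ∀ (a b : Fin k) → Injective _≡_ _≡_ (transpose a b)
swap-inj a b {x} {y} eq = trans (sym (transpose-inverse b a)) (trans (cong (transpose b a) eq) (transpose-inverse b a))

swap-left : ∀ (a b : Fin k) → transpose a b a ≡ b
swap-left a b with a ≟ a
... | yes _ = refl
... | no h  = ⊥-elim (h refl)

swap-other : ∀ {a b c : Fin k} → c ≢ a → c ≢ b → transpose a b c ≡ c
swap-other {a = a} {b} {c} c≢a c≢b with c ≟ a
... | yes h = ⊥-elim (c≢a h)
... | no _ with c ≟ b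
...   | yes h = ⊥-elim (c≢b h)
...   | no _  = refl

realign₂ : ∀ {a b a′ b′ : Fin k} → a ≢ b → a′ ≢ b′ →
  Σ[ π ∈ (Fin k → Fin k) ] Injective _≡_ _≡_ π × π a ≡ a′ × π b ≡ b′
realign₂ {a = a} {b} {a′} {b′} a≢b a′≢b′ =
  τ₂ ∘ τ₁ , swap-inj a a′ ∘ swap-inj b₁ b′
  , trans (cong τ₂ (swap-left a a′)) (swap-other (λ eq → a≢b (swap-inj a a′ (trans (swap-left a a′) eq))) a′≢b′)
  , swap-left b₁ b′
  where
  τ₁ = transpose a a′
  b₁ = τ₁ b
  τ₂ = transpose b₁ b′

module _ {n} (G : Net n) where
  open Net G

  -- `f` is proper on all edges with an end in `W` and therefore also colours the boundary, where it
  -- has to agree with `g`.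
  paste : {W : Subset n} → Decidable W → (f g : Fin n → Fin k) →
    (∀ {u v} → Edge u v → W u ⊎ W v → f u ≢ f v) →
    (∀ {u v} → Edge u v → ¬ W u → ¬ W v → g u ≢ g v) →
    (∀ {u v} → Edge u v → W u → ¬ W v → f v ≡ g v) → Colourable Edge k
  paste {k} {W} W? f g pf pg agree = h , proper
    where
    h : Fin n → Fin k
    h v with W? v
    ... | yes _ = f v
    ... | no _  = g v
    proper : ∀ {u v} → Edge u v → h u ≢ h v
    proper {u} {v} e eq with W? u | W? v
    ... | yes a | yes b = pf e (inj₁ a) eq
    ... | no a  | no b  = pg e a b eq
    ... | yes a | no b  = pf e (inj₁ a) (trans eq (sym (agree e a b)))
    ... | no a  | yes b = pf e (inj₂ b) (trans (agree (edge-sym e) b a) eq)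

  module _ {W : Subset n} (W? : Decidable W) where

    touches : Edges n
    touches u v = W u ⊎ W v

    touches? : ∀ u v → Dec (touches u v)
    touches? u v = W? u ⊎-dec W? v

    misses : Edges n
    misses u v = ¬ W u × ¬ W v

    misses? : ∀ u v → Dec (misses u v)
    misses? u v = ¬? (W? u) ×-dec ¬? (W? v)

    -- Both sides of a cut vertex `d` lack an edge and are colourable by criticality; one
    -- transposition of colours makes them agree at `d`.
    glue₁ : Critical G k → (d : Fin n) → (∀ {u v} → Edge u v → W u → W v ⊎ v ≡ d) →
      ∀ {a b a′ b′} → Edge a b → touches a b → Edge a′ b′ → misses a′ b′ → Colourable Edge k
    glue₁ crit d closed e t e′ (m₁ , m₂) = paste W? (τ ∘ f) g
        (λ e t → pf (e , t) ∘ swap-inj (f d) (g d)) (λ e a b → pg (e , a , b))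
        (λ e w ¬w → case closed e w of λ { (inj₁ w′) → ⊥-elim (¬w w′) ; (inj₂ refl) → swap-left (f d) (g d) })
      where
      C₁ = crit touches? swap e′ [ m₁ , m₂ ]′
      C₂ = crit misses? (λ (a , b) → b , a) e (λ (a , b) → [ a , b ]′ t)
      f = proj₁ C₁
      pf = proj₂ C₁
      g = proj₁ C₂
      pg = proj₂ C₂
      τ = transpose (f d) (g d)

    -- The ends of the edge `zd` have different colours on both sides, so a permutation of the
    -- colours matches both at once.
    glue₂ : Critical G k → (z d : Fin n) → Edge z d → ¬ W z → ¬ W d →
      (∀ {u v} → Edge u v → W u → W v ⊎ ⁅ z ∣ d ⁆ v) →
      ∀ {a b a′ b′} → Edge a b → touches a b → Edge a′ b′ → misses a′ b′ → ¬ (⁅ z ∣ d ⁆ a′ × ⁅ z ∣ d ⁆ b′) →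
      Colourable Edge k
    glue₂ crit z d zd ¬wz ¬wd closed e t e′ (m₁ , m₂) off = paste W? (π ∘ f) g
        (λ e t → pf (e , inj₁ t) ∘ π-inj) (λ e a b → pg (e , a , b))
        (λ e w ¬w → case closed e w of λ
          { (inj₁ w′) → ⊥-elim (¬w w′) ; (inj₂ (inj₁ refl)) → πz ; (inj₂ (inj₂ refl)) → πd })
      where
      -- The edge `zd` is kept on this side too; the condition `off` ensures that some other edge is
      -- missing.
      C₁ = crit (λ u v → touches? u v ⊎-dec (⁅ z ∣ d ⁆? u ×-dec ⁅ z ∣ d ⁆? v))
        [ inj₁ ∘ swap , (λ (a , b) → inj₂ (b , a)) ]′ e′ [ [ m₁ , m₂ ]′ , off ]′
      C₂ = crit misses? (λ (a , b) → b , a) e (λ (a , b) → [ a , b ]′ t)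
      f = proj₁ C₁
      pf = proj₂ C₁
      g = proj₁ C₂
      pg = proj₂ C₂
      R = realign₂ (pf (zd , inj₂ (inj₁ refl , inj₂ refl))) (pg (zd , ¬wz , ¬wd))
      π = proj₁ R
      π-inj = proj₁ (proj₂ R)
      πz = proj₁ (proj₂ (proj₂ R))
      πd = proj₂ (proj₂ (proj₂ R))

spare-same : ∀ (α β : Fin 3) → ∃[ γ ] ∃[ δ ] γ ≢ α × γ ≢ β × γ ≢ δ
spare-same = toWitness {a? = all? λ α → all? λ β → any? λ γ → any? λ δ →
  ¬? (γ ≟ α) ×-dec ¬? (γ ≟ β) ×-dec ¬? (γ ≟ δ)} tt

spare-diff : ∀ (α β : Fin 3) → ∃[ γ ] ∃[ δ ] γ ≢ α × δ ≢ β × γ ≢ δ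
spare-diff = toWitness {a? = all? λ α → all? λ β → any? λ γ → any? λ δ →
  ¬? (γ ≟ α) ×-dec ¬? (δ ≟ β) ×-dec ¬? (γ ≟ δ)} tt

choose : Bool → Fin 3 → Fin 3 → Bool → Fin 3
choose s γ δ b with s Bool.≟ b
... | yes _ = δ
... | no _  = γ

choose-same : ∀ s {γ δ} → choose s γ δ s ≡ δ
choose-same false = refl
choose-same true  = refl

choose-not : ∀ s {γ δ} → choose s γ δ (not s) ≡ γ
choose-not false = refl
choose-not true  = refl

choose-≢ : ∀ s {γ δ} → γ ≢ δ → ∀ b → choose s γ δ b ≢ choose s γ δ (not b)
choose-≢ false h false = ≢-sym h
choose-≢ false h true  = h
choose-≢ true  h false = h
choose-≢ true  h true  = ≢-sym h

-- Two colours for the classes of a bipartition in which a vertex of class s already has colour α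
-- and a vertex of class t has colour β.
classColours : ∀ (α β : Fin 3) (s t : Bool) →
  Σ[ c ∈ (Bool → Fin 3) ] (∀ b → c b ≢ c (not b)) × c (not s) ≢ α × c (not t) ≢ β
classColours α β s t with s Bool.≟ t
... | yes refl = let γ , δ , γα , γβ , γδ = spare-same α β in
  choose s γ δ , choose-≢ s γδ , γα ∘ trans (sym (choose-not s)) , γβ ∘ trans (sym (choose-not s))
... | no s≢t = let γ , δ , γα , δβ , γδ = spare-diff α β in
  choose s γ δ , choose-≢ s γδ , γα ∘ trans (sym (choose-not s))
  , δβ ∘ trans (sym (trans (cong (choose s γ δ) (trans (cong not (differ s≢t)) (not-involutive s))) (choose-same s)))

module _ {n} (G : Net n) {W : Subset n} (W? : Decidable W) where
  open Net G

  -- Only the neighbours of `z` and `d` in `W` are constrained. They lie in the class opposite to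
  -- `z` or `d`, and `classColours` keeps the given colour off that class.
  extendBipartite : (z d : Fin n) → z ≢ d → ¬ W z → ¬ W d → (∀ {u v} → Edge u v → W u → W v ⊎ ⁅ z ∣ d ⁆ v) →
    (b : Fin n → Bool) → (∀ {u v} → Edge u v → touches G W? u v → b v ≡ not (b u)) →
    Colourable (λ u v → Edge u v × misses G W? u v) 3 → Colourable Edge 3
  extendBipartite z d z≢d ¬wz ¬wd closed b alt (g , pg) = paste G W? f g proper (λ e a b → pg (e , a , b))
      (λ e w ¬w → case closed e w of λ
          { (inj₁ w′) → ⊥-elim (¬w w′) ; (inj₂ (inj₁ refl)) → f-z ; (inj₂ (inj₂ refl)) → f-d })
    where
    K = classColours (g z) (g d) (b z) (b d)
    c = proj₁ K
    f : Fin n → Fin 3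
    f v with W? v
    ... | yes _ = c (b v)
    ... | no _  = g v
    f-z : f z ≡ g z
    f-z with W? z
    ... | yes w = ⊥-elim (¬wz w)
    ... | no _  = refl
    f-d : f d ≡ g d
    f-d with W? d
    ... | yes w = ⊥-elim (¬wd w)
    ... | no _  = refl
    boundary : ∀ {u v} → Edge u v → W u → ¬ W v → c (b u) ≢ g v
    boundary e wu ¬wv with closed e wu
    ... | inj₁ w = ⊥-elim (¬wv w)
    ... | inj₂ (inj₁ refl) = subst (λ q → c q ≢ g z) (sym (alt (edge-sym e) (inj₂ wu))) (proj₁ (proj₂ (proj₂ K)))
    ... | inj₂ (inj₂ refl) = subst (λ q → c q ≢ g d) (sym (alt (edge-sym e) (inj₂ wu))) (proj₂ (proj₂ (proj₂ K)))
    proper : ∀ {u v} → Edge u v → touches G W? u v → f u ≢ f v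
    proper {u} {v} e t with W? u | W? v
    ... | yes a | yes a′ = λ eq → proj₁ (proj₂ K) (b u) (trans eq (cong c (alt e t)))
    ... | yes a | no a′  = boundary e a a′
    ... | no a  | yes a′ = ≢-sym (boundary (edge-sym e) a′ a)
    ... | no a  | no a′  = ⊥-elim ([ a , a′ ]′ t)

-- Distance layers

walk? : (∀ u v → Dec (E u v)) → ∀ m u v → Dec (Walk E u v m)
walk? E? zero u v with u ≟ v
... | yes refl = yes []
... | no u≢v   = no (u≢v ∘ walk₀)
walk? E? (suc m) u v with any? (λ w → E? u w ×-dec walk? E? m w v)
... | yes (w , e , p) = yes (e ∷ p)
... | no h            = no λ { (e ∷ p) → h (_ , e , p) }

snoc : Walk E u v m → E v w → Walk E u w (suc m)
snoc {m = m} p e = subst (Walk _ _ _) (+-comm m 1) (p ++ (e ∷ []))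

-- Minimisation with cutoff: the value `K` means that no smaller number satisfies `P`, and then `P`
-- is not claimed.
least : (P : ℕ → Set) → (∀ i → Dec (P i)) → ∀ K → Σ[ i ∈ ℕ ] (i < K → P i) × (∀ {j} → P j → i ≤ j) × i ≤ K
least P P? zero = 0 , (λ ()) , (λ _ → z≤n) , z≤n
least P P? (suc K) with P? 0
... | yes p0 = 0 , (λ _ → p0) , (λ _ → z≤n) , z≤n
... | no ¬p0 = let i , hit , min , i≤K = least (P ∘ suc) (P? ∘ suc) K in
  suc i , (λ { (s≤s h) → hit h }) , (λ { {zero} p0 → ⊥-elim (¬p0 p0) ; {suc j} pj → s≤s (min pj) }) , s≤s i≤K

-- φ v is the distance from p to v if that is less than K, and K otherwise.
module Distance {n} (G : Net n) (p : Fin n) (K : ℕ) where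
  open Net G

  private
    search : ∀ v → Σ[ i ∈ ℕ ] (i < K → Walk Edge p v i) × (∀ {j} → Walk Edge p v j → i ≤ j) × i ≤ K
    search v = least (Walk Edge p v) (λ i → walk? edge? i p v) K

  φ : Fin n → ℕ
  φ v = proj₁ (search v)

  geodesic : φ v < K → Walk Edge p v (φ v)
  geodesic {v = v} = proj₁ (proj₂ (search v))

  φ-min : Walk Edge p v m → φ v ≤ m
  φ-min {v = v} = proj₁ (proj₂ (proj₂ (search v)))

  φ≤K : φ v ≤ K
  φ≤K {v = v} = proj₂ (proj₂ (proj₂ (search v)))

  φ-root : φ p ≡ 0
  φ-root = n≤0⇒n≡0 (φ-min [])

  step : Edge u v → φ v ≤ suc (φ u)
  step {u = u} e with φ u <? K
  ... | yes h = φ-min (snoc (geodesic h) e)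
  ... | no h  = ≤-trans φ≤K (≤-trans (≮⇒≥ h) (n≤1+n _))

  φ-walk : Walk Edge u v m → φ v ≤ φ u + m
  φ-walk {u = u} [] = ≤-reflexive (sym (+-identityʳ (φ u)))
  φ-walk {u = u} {m = suc m} (e ∷ r) =
    ≤-trans (φ-walk r) (≤-trans (+-monoˡ-≤ m (step e)) (≤-reflexive (sym (+-suc (φ u) m))))

  -- A weak form of monotonicity along the route, just enough to show that routes in different
  -- ranges of layers meet only at their ends.
  record Ascent (u v : Fin n) (ℓ : ℕ) : Set where
    field
      route : Path Edge u v ℓ
      low   : ∀ {x} → x ∈ᵖ route → x ≡ u ⊎ φ u < φ x
      high  : ∀ {x} → x ∈ᵖ route → x ≡ v ⊎ φ x < φ v

  -- Distances grow by at most one per step, so a walk as long as the difference of levels rises at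
  -- every step.
  ascend : Walk Edge u v m → φ v ≡ φ u + m → Ascent u v m
  ascend [] _ = record { route = trivial ; low = λ { here → inj₁ refl } ; high = λ { here → inj₁ refl } }
  ascend {u = u} {v} {m = suc m} (_∷_ {w = w} e r) eq = record
    { route = cons e A.route u∉ ; low = low′ ; high = high′ }
    where
    up : φ w ≡ suc (φ u)
    up = ≤-antisym (step e) (+-cancelʳ-≤ m _ _
      (≤-trans (≤-reflexive (trans (sym (+-suc (φ u) m)) (sym eq))) (φ-walk r)))
    module A = Ascent (ascend r (trans eq (trans (+-suc (φ u) m) (cong (_+ m) (sym up)))))
    above : ∀ {x} → x ∈ᵖ A.route → φ u < φ x
    above h with A.low h
    ... | inj₁ refl = ≤-reflexive (sym up)
    ... | inj₂ lt   = ≤-trans (≤-reflexive (sym up)) (<⇒≤ lt)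
    u∉ : ¬ u ∈ᵖ A.route
    u∉ h = <-irrefl refl (above h)
    low′ : ∀ {x} → x ∈ᵖ cons e A.route u∉ → x ≡ u ⊎ φ u < φ x
    low′ here      = inj₁ refl
    low′ (there h) = inj₂ (above h)
    high′ : ∀ {x} → x ∈ᵖ cons e A.route u∉ → x ≡ v ⊎ φ x < φ v
    high′ here      = inj₂ (≤-trans (m≤m+n (suc (φ u)) m) (≤-reflexive (trans (sym (+-suc (φ u) m)) (sym eq))))
    high′ (there h) = A.high h

  climb : φ v < K → Ascent p v (φ v)
  climb {v = v} h = ascend (geodesic h) (cong (_+ φ v) (sym φ-root))

  -- The whole walk over `uv` has the minimal length `m`, so its beginning up to `v` is shortest;
  -- `m < K` keeps the cutoff out of play.
  rises : ∀ {q a b} → (∀ {i} → Walk Edge p q i → m ≤ i) → m < K →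
    Walk Edge p u a → Edge u v → Walk Edge v q b → a + suc b ≡ m → φ v ≡ suc (φ u)
  rises {m = m} {u = u} {v} {a = a} {b} far m<K r e s eq = ≤-antisym (step e) (≤-trans (s≤s (φ-min r)) a<φv)
    where
    total : suc a + b ≡ m
    total = trans (sym (+-suc a b)) eq
    φv<K : φ v < K
    φv<K = ≤-trans (s≤s (≤-trans (φ-min (snoc r e)) (m+n≤o⇒m≤o (suc a) (≤-reflexive total)))) m<K
    a<φv : suc a ≤ φ v
    a<φv = +-cancelʳ-≤ b _ _ (≤-trans (≤-reflexive total) (far (geodesic φv<K ++ s)))

-- With the edge `uv` inserted the walk has length at most `k` + 1. In the applications `k` is a
-- lower bound for the length of `p`-`q` walks.
record Near {n} (E : Edges n) (p q u v : Fin n) (k : ℕ) : Set where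
  constructor near
  field
    {a b} : ℕ
    to    : Walk E p u a
    from  : Walk E v q b
    bound : a + b ≤ k

bit : Bool → Fin 3
bit false = zero
bit true  = suc zero

two : Fin 3
two = suc (suc zero)

bit≢two : ∀ b → bit b ≢ two
bit≢two false ()
bit≢two true  ()

bit-not : ∀ b → bit b ≢ bit (not b)
bit-not false ()
bit-not true  ()

-- What a vertex `r` of the third colour supplies: a neighbour `s` at the same distance from `p`,
-- hence two paths from `p` to `r` of consecutive lengths, and a shortest continuation from `s` to
-- `q`.
record Twist {n} (E : Edges n) (p q r : Fin n) (k : ℕ) : Set where
  field
    {level}  : ℕ
    {s}      : Fin n
    rs       : E r s
    straight : Path E p r level
    bent     : Path E p r (suc level)
    q∉bent   : q ≢ s → ¬ q ∈ᵖ bent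
    onward   : Walk E s q (k ∸ level)
    r≢p      : r ≢ p
    r≢q      : r ≢ q
    s≢p      : s ≢ p

record LayerColouring {n} (E : Edges n) (p q : Fin n) (k : ℕ) : Set where
  field
    colour : Fin n → Fin 3
    proper : ∀ {u v} → E u v → colour u ≢ colour v
    at-p   : colour p ≡ zero
    at-q   : colour q ≡ bit (par k)
    twist  : ∀ {v} → colour v ≡ two → Twist E p q v k

-- Every edge lies almost on a shortest p–q walk, so an edge inside a distance layer has an end on a
-- shortest walk; a set R of such ends meets every edge inside a layer, and two adjacent vertices of R
-- would give a p–q path of length k + 2.
module Layers {n} (G : Net n) (loopless : ∀ {v} → ¬ Net.Edge G v v) (p q : Fin n) (k : ℕ)
  (close : ∀ {u v} → Net.Edge G u v → Near (Net.Edge G) p q u v k ⊎ Near (Net.Edge G) p q v u k)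
  (short : Walk (Net.Edge G) p q k) (far : ∀ {i} → Walk (Net.Edge G) p q i → k ≤ i)
  (bounded : ¬ Path (Net.Edge G) p q (2 + k)) where

  open Net G

  -- By `close`, an end of an edge has distance at most `k` + 1, so the cutoff 2 + `k` affects no
  -- such vertex.
  open Distance G p (2 + k) public

  φ-end : φ q ≡ k
  φ-end = ≤-antisym (φ-min short) (far (geodesic (≤-trans (s≤s (φ-min short)) (n≤1+n _))))

  φ-edge : Edge u v → φ u < 2 + k
  φ-edge e with close e
  ... | inj₁ (near {a} {b} to _ le) = s≤s (≤-trans (φ-min to) (≤-trans (m≤m+n a b) (≤-trans le (n≤1+n _))))
  ... | inj₂ (near {a} {b} to _ le) =
    s≤s (≤-trans (step (edge-sym e)) (s≤s (≤-trans (φ-min to) (≤-trans (m≤m+n a b) le))))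

  -- The vertices on shortest `p`-`q` walks.
  S : Subset n
  S v = φ v ≤ k × Walk Edge v q (k ∸ φ v)

  S? : Decidable S
  S? v = (φ v ≤? k) ×-dec walk? edge? (k ∸ φ v) v q

  descend : S v → Ascent v q (k ∸ φ v)
  descend (le , r) = ascend r (trans φ-end (sym (m+[n∸m]≡n le)))

  Flat : Edges n
  Flat u v = Edge u v × φ u ≡ φ v

  flat? : ∀ u v → Dec (Flat u v)
  flat? u v = edge? u v ×-dec (φ u ℕ.≟ φ v)

  flat-sym : Symm Flat
  flat-sym (e , eq) = edge-sym e , sym eq

  -- Going straight to `v` costs no more than going to `u` on the same layer, so the walk over `v`
  -- has length at most `k` and is shortest.
  flat-near : Flat u v → Near Edge p q u v k → S v
  flat-near {u = u} {v} (e , eq) (near {a} {b} to from le) =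
    m+n≤o⇒m≤o (φ v) (≤-reflexive exact) , subst (Walk Edge v q) b-eq from
    where
    φv≤a : φ v ≤ a
    φv≤a = ≤-trans (≤-reflexive (sym eq)) (φ-min to)
    exact : φ v + b ≡ k
    exact = ≤-antisym (≤-trans (+-monoˡ-≤ b φv≤a) le) (far (geodesic (φ-edge (edge-sym e)) ++ from))
    b-eq : b ≡ k ∸ φ v
    b-eq = trans (sym (m+n∸m≡n (φ v) b)) (cong (_∸ φ v) exact)

  flat-S : Flat u v → S u ⊎ S v
  flat-S h with close (proj₁ h)
  ... | inj₁ c = inj₂ (flat-near h c)
  ... | inj₂ c = inj₁ (flat-near (flat-sym h) c)

  -- From a flat edge the end outside `S` is taken or, if both ends are in `S`, the one of smaller
  -- index. Either way an element of `R` has a flat neighbour in `S`.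
  R : Subset n
  R v = (¬ S v × ∃[ u ] Flat v u) ⊎ (S v × ∃[ u ] Flat v u × S u × v Fin.< u)

  R? : Decidable R
  R? v = (¬? (S? v) ×-dec any? (flat? v))
    ⊎-dec (S? v ×-dec any? (λ u → flat? v u ×-dec S? u ×-dec (v Finₚ.<? u)))

  R-flat : R v → ∃[ u ] Flat v u × S u
  R-flat (inj₁ (¬s , u , h))         = u , h , [ ⊥-elim ∘ ¬s , id ]′ (flat-S h)
  R-flat (inj₂ (_ , u , h , s , _)) = u , h , s

  -- A shortest route to `a` stays below `M` and a shortest route from `c` stays above it, so the
  -- three pieces meet only at `a` and `c`.
  zigzag : ∀ {a c} (M : Path Edge a c m) → (∀ {x} → x ∈ᵖ M → φ a ≤ φ x × φ x ≤ φ c) → φ a < 2 + k → S c →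
    Path Edge p q (φ a + m + (k ∸ φ c))
  zigzag {a = a} {c} M between a< sc = proj₁ (join (proj₁ AM) B.route meet)
    where
    module A = Ascent (climb a<)
    module B = Ascent (descend sc)
    AM = join A.route M λ hA hM → case A.high hA of λ
      { (inj₁ eq) → eq ; (inj₂ lt) → ⊥-elim (<⇒≱ lt (proj₁ (between hM))) }
    top : ∀ {x} → x ∈ᵖ M → x ∈ᵖ B.route → x ≡ c
    top hM hB = case B.low hB of λ
      { (inj₁ eq) → eq ; (inj₂ lt) → ⊥-elim (<⇒≱ lt (proj₂ (between hM))) }
    meet : ∀ {x} → x ∈ᵖ proj₁ AM → x ∈ᵖ B.route → x ≡ c
    meet h hB with proj₂ AM h
    ... | inj₂ hM = top hM hB
    ... | inj₁ hA with A.high hA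
    ...   | inj₁ refl = top here hB
    ...   | inj₂ lt = case B.low hB of λ
      { (inj₁ eq)  → eq
      ; (inj₂ lt′) → ⊥-elim (<-asym lt (≤-trans (s≤s (proj₂ (between here))) lt′)) }

  -- Two consecutive flat edges inserted into a shortest path would make a `p`-`q` path of length
  -- `k` + 2.
  flat-bend : ∀ {a b c} → Flat a b → Flat b c → a ≢ c → ¬ S c
  flat-bend {a} {b} {c} (e , ab) (e′ , bc) a≢c sc = bounded (subst (Path Edge p q) total (zigzag M between (φ-edge e) sc))
    where
    b≢c : b ≢ c
    b≢c eq = loopless (subst (Edge b) (sym eq) e′)
    M : Path Edge a c 2
    M = cons e (edge e′ b≢c) λ h → case edge-∈ {h = b≢c} h of λ
      { (inj₁ eq) → loopless (subst (Edge a) (sym eq) e) ; (inj₂ eq) → a≢c eq }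
    between : ∀ {x} → x ∈ᵖ M → φ a ≤ φ x × φ x ≤ φ c
    between here                 = ≤-refl , ≤-reflexive (trans ab bc)
    between (there here)         = ≤-reflexive ab , ≤-reflexive bc
    between (there (there here)) = ≤-reflexive (trans ab bc) , ≤-refl
    total : φ a + 2 + (k ∸ φ c) ≡ 2 + k
    total = trans (cong (λ t → t + 2 + (k ∸ φ c)) (trans ab bc))
      (trans (cong (_+ (k ∸ φ c)) (+-comm (φ c) 2)) (cong (2 +_) (m+[n∸m]≡n (proj₁ sc))))

  -- A flat edge at `u`, the rising edge `uv` and a flat edge at `v` climb one layer in three steps,
  -- again two too many.
  slope : Edge u v → φ v ≡ suc (φ u) → R u → ¬ R v
  slope {u = u} {v} e up ru rv with R-flat ru | R-flat rv
  ... | u′ , (e₁ , eq₁) , _ | v′ , (e₂ , eq₂) , s =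
    bounded (subst (Path Edge p q) total (zigzag M between (φ-edge (edge-sym e₁)) s))
    where
    v≢v′ : v ≢ v′
    v≢v′ eq = loopless (subst (Edge v) (sym eq) e₂)
    off : ∀ {x y} → φ x ≢ φ y → x ≢ y
    off h refl = h refl
    φv≢ : φ u ≢ φ v
    φv≢ eq = 1+n≢n (sym (trans eq up))
    M₂ : Path Edge u v′ 2
    M₂ = cons e (edge e₂ v≢v′) λ h → case edge-∈ {h = v≢v′} h of λ
      { (inj₁ eq) → φv≢ (cong φ eq) ; (inj₂ eq) → φv≢ (trans (cong φ eq) (sym eq₂)) }
    M : Path Edge u′ v′ 3
    M = cons (edge-sym e₁) M₂ λ
      { here → loopless e₁
      ; (there h) → case edge-∈ {h = v≢v′} h of λ
          { (inj₁ eq) → φv≢ (trans eq₁ (cong φ eq)) ; (inj₂ eq) → φv≢ (trans eq₁ (trans (cong φ eq) (sym eq₂))) } }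
    u≤v : φ u ≤ φ v
    u≤v = ≤-trans (n≤1+n _) (≤-reflexive (sym up))
    ends : ∀ {x} → φ u ≤ φ x × φ x ≤ φ v → φ u′ ≤ φ x × φ x ≤ φ v′
    ends (l , h) = ≤-trans (≤-reflexive (sym eq₁)) l , ≤-trans h (≤-reflexive eq₂)
    between : ∀ {x} → x ∈ᵖ M → φ u′ ≤ φ x × φ x ≤ φ v′
    between here                         = ends (≤-reflexive eq₁ , ≤-trans (≤-reflexive (sym eq₁)) u≤v)
    between (there here)                 = ends (≤-refl , u≤v)
    between (there (there here))         = ends (u≤v , ≤-refl)
    between (there (there (there here))) = ends (≤-trans u≤v (≤-reflexive eq₂) , ≤-reflexive (sym eq₂))
    total : φ u′ + 3 + (k ∸ φ v′) ≡ 2 + k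
    total = trans (cong (_+ (k ∸ φ v′)) (trans (+-comm (φ u′) 3)
        (cong (λ t → 2 + t) (trans (cong suc (sym eq₁)) (trans (sym up) eq₂)))))
      (cong (2 +_) (m+[n∸m]≡n (proj₁ s)))

  R-flat-independent : Flat u v → R u → ¬ R v
  R-flat-independent {u = u} {v} h ru rv with S? u | S? v
  ... | no ¬su | no ¬sv = [ ¬su , ¬sv ]′ (flat-S h)
  ... | no ¬su | yes sv = [ (λ (¬s , _) → ¬s sv)
      , (λ { (_ , w , h′ , sw , _) → flat-bend h h′ (λ { refl → ¬su sw }) sw }) ]′ rv
  ... | yes su | no ¬sv = [ (λ (¬s , _) → ¬s su)
      , (λ { (_ , w , h′ , sw , _) → flat-bend (flat-sym h) h′ (λ { refl → ¬sv sw }) sw }) ]′ ru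
  ... | yes su | yes sv with ru | rv
  ...   | inj₁ (¬s , _) | _ = ¬s su
  ...   | _ | inj₁ (¬s , _) = ¬s sv
  -- `w` = `v` and `w′` = `u` together contradict the order of indices, so one of the two bends has
  -- distinct ends.
  ...   | inj₂ (_ , w , h₁ , sw , u<w) | inj₂ (_ , w′ , h₂ , sw′ , v<w′) with w ≟ v
  ...     | no w≢v   = flat-bend (flat-sym h) h₁ (≢-sym w≢v) sw
  ...     | yes refl = flat-bend h h₂ (λ { refl → Finₚ.<-asym u<w v<w′ }) sw′

  data Slope (u v : Fin n) : Set where
    level : φ u ≡ φ v → Slope u v
    up    : φ v ≡ suc (φ u) → Slope u v
    down  : φ u ≡ suc (φ v) → Slope u v

  compare : Edge u v → Slope u v
  compare {u = u} {v} e with <-cmp (φ u) (φ v)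
  ... | tri< lt _ _ = up (≤-antisym (step e) lt)
  ... | tri≈ _ eq _ = level eq
  ... | tri> _ _ gt = down (≤-antisym (step (edge-sym e)) gt)

  R-independent : Edge u v → R u → ¬ R v
  R-independent e ru rv with compare e
  ... | level eq = R-flat-independent (e , eq) ru rv
  ... | up eq    = slope e eq ru rv
  ... | down eq  = slope (edge-sym e) eq rv ru

  R-covers : Flat u v → R u ⊎ R v
  R-covers {u = u} {v} h with S? u | S? v
  ... | no ¬su | _      = inj₁ (inj₁ (¬su , v , h))
  ... | _      | no ¬sv = inj₂ (inj₁ (¬sv , u , flat-sym h))
  ... | yes su | yes sv with Finₚ.<-cmp u v
  ...   | tri< lt _ _   = inj₁ (inj₂ (su , v , h , sv , lt))
  ...   | tri> _ _ gt   = inj₂ (inj₂ (sv , u , flat-sym h , su , gt))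
  ...   | tri≈ _ refl _ = ⊥-elim (loopless (proj₁ h))

  colour : Fin n → Fin 3
  colour v with R? v
  ... | yes _ = two
  ... | no _  = bit (par (φ v))

  colour-two : colour v ≡ two → R v
  colour-two {v = v} eq with R? v
  ... | yes r = r
  ... | no _  = ⊥-elim (bit≢two _ eq)

  colour-bit : ¬ R v → colour v ≡ bit (par (φ v))
  colour-bit {v = v} ¬r with R? v
  ... | yes r = ⊥-elim (¬r r)
  ... | no _  = refl

  colour-proper : Edge u v → colour u ≢ colour v
  colour-proper {u = u} {v} e eq with R? u | R? v
  ... | yes ru | yes rv = R-independent e ru rv
  ... | yes ru | no _   = bit≢two _ (sym eq)
  ... | no _   | yes rv = bit≢two _ eq
  ... | no ¬ru | no ¬rv with compare e
  ...   | level flat = [ ¬ru , ¬rv ]′ (R-covers (e , flat))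
  ...   | up h       = bit-not _ (trans eq (cong (bit ∘ par) h))
  ...   | down h     = bit-not _ (trans (sym eq) (cong (bit ∘ par) h))

  root∉R : ¬ R p
  root∉R r with R-flat r
  ... | u , (e , eq) , _ with walk₀ (subst (Walk Edge p u) (trans (sym eq) φ-root) (geodesic (φ-edge (edge-sym e))))
  ... | refl = loopless e

  end∉R : ¬ R q
  end∉R r with R-flat r
  ... | u , (e , eq) , (_ , s)
    with walk₀ (subst (Walk Edge u q) (trans (cong (k ∸_) (trans (sym eq) φ-end)) (n∸n≡0 k)) s)
  ... | refl = loopless e

  colour-root : colour p ≡ zero
  colour-root = trans (colour-bit root∉R) (cong (bit ∘ par) φ-root)

  colour-end : colour q ≡ bit (par k)
  colour-end = trans (colour-bit end∉R) (cong (bit ∘ par) φ-end)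

  reached : φ v < 2 + k → φ v ≡ 0 → v ≡ p
  reached {v = v} v< eq = sym (walk₀ (subst (Walk Edge p v) eq (geodesic v<)))

  twist : R v → Twist Edge p q v k
  twist {v = r} Rr with R-flat Rr
  ... | s , (rs , same) , Ss = record
    { rs = rs ; straight = A.route ; bent = proj₁ C′ ; q∉bent = q∉bent
    ; onward = subst (λ t → Walk Edge s q (k ∸ t)) (sym same) (proj₂ Ss)
    ; r≢p = r≢p ; r≢q = r≢q ; s≢p = λ { refl → r≢p (reached φ< (trans same φ-root)) } }
    where
    φ< : φ r < 2 + k
    φ< = φ-edge rs
    r≢s : r ≢ s
    r≢s refl = loopless rs
    r≢p : r ≢ p
    r≢p refl = root∉R Rr
    r≢q : r ≢ q
    r≢q refl = end∉R Rr
    module A = Ascent (climb {v = r} φ<)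
    module B = Ascent (climb {v = s} (subst (_< 2 + k) same φ<))
    r∉B : ¬ r ∈ᵖ B.route
    r∉B h = [ r≢s , (λ lt → <-irrefl same lt) ]′ (B.high h)
    -- The bent path is a shortest path to `s` followed by `sr`; `r` is as far from `p` as `s` and
    -- hence not on that path.
    C = join B.route (edge (edge-sym rs) (≢-sym r≢s)) λ hB he →
      [ id , (λ { refl → ⊥-elim (r∉B hB) }) ]′ (edge-∈ {h = ≢-sym r≢s} he)
    C′ = cast (trans (+-comm (φ s) 1) (cong suc (sym same))) (proj₁ C)
    q∉bent : q ≢ s → ¬ q ∈ᵖ proj₁ C′
    q∉bent q≢s h with proj₂ C (proj₂ C′ h)
    ... | inj₁ hB = [ q≢s , (λ lt → <⇒≱ lt (≤-trans (proj₁ Ss) (≤-reflexive (sym φ-end)))) ]′ (B.high hB)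
    ... | inj₂ he = [ q≢s , ≢-sym r≢q ]′ (edge-∈ {h = ≢-sym r≢s} he)

  layerColouring : LayerColouring Edge p q k
  layerColouring = record
    { colour = colour ; proper = colour-proper ; at-p = colour-root ; at-q = colour-end ; twist = twist ∘ colour-two }

-- Separations by two non-adjacent vertices

OddLengths : Edges n → ℕ → Set
OddLengths E c = ∀ {m} → Cycle E m → par m ≡ true → m ≡ 3 ⊎ m ≡ c

ThroughAll : Edges n → Fin n → Fin n → Set
ThroughAll E s t = ∀ {u v} → E u v → Through E s t u v ⊎ Through E s t v u

all-on : {Q : Subset n} → (∀ {u v} → E u v → Q v) → (p : Walk E u v m) → Q u → x ∈ p → Q x
all-on h p       qu here      = qu
all-on h (e ∷ p) qu (there i) = all-on h p (h e) i

through-edge : ∀ {s t} → Symm E → (T : Through E s t u v ⊎ Through E s t v u) → E u v → ∃[ ℓ ] Path E s t ℓ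
through-edge s (inj₁ T) e = _ , whole T e
through-edge s (inj₂ T) e = _ , whole T (s e)

-- Every edge lies on a shortest s–t path, hence joins consecutive distance layers.
exactBipartition : (G : Net n) {s t : Fin n} → let open Net G in m < k → (∀ {i} → Walk Edge s t i → m ≤ i) →
  (∀ {u v} → Edge u v → Σ[ T ∈ Through Edge s t u v ] Through.ℓ₁ T + suc (Through.ℓ₂ T) ≡ m
                      ⊎ (Σ[ T ∈ Through Edge s t v u ] Through.ℓ₁ T + suc (Through.ℓ₂ T) ≡ m)) →
  let open Distance G s k in ∀ {u v} → Edge u v → φ v ≡ suc (φ u) ⊎ φ u ≡ suc (φ v)
exactBipartition G {s} m<k far exact e with exact e
... | inj₁ (T , eq) = inj₁ (Distance.rises G s _ far m<k (walk (Through.front T)) e (walk (Through.back T)) eq)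
... | inj₂ (T , eq) = inj₂ (Distance.rises G s _ far m<k (walk (Through.front T)) (Net.edge-sym G e) (walk (Through.back T)) eq)

alternate : ∀ {a b} → b ≡ suc a ⊎ a ≡ suc b → par b ≡ not (par a)
alternate (inj₁ refl) = refl
alternate (inj₂ refl) = sym (not-involutive _)

record TwoSep {n} (G : Net n) (z d : Fin n) : Set₁ where
  open Net G
  field
    W      : Subset n
    W?     : Decidable W
    z∉W    : ¬ W z
    d∉W    : ¬ W d
    closed : ∀ {u v} → Edge u v → W u → W v ⊎ ⁅ z ∣ d ⁆ v

  -- Edges with an end in `W`; an edge `zd` would lie on neither side, which is why `z` and `d` are
  -- assumed non-adjacent where both sides are used.
  side : Net n
  side = restrict G (touches? G W?) swap

  opposite : TwoSep G z d
  opposite = record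
    { W = λ v → ¬ W v × ¬ ⁅ z ∣ d ⁆ v ; W? = λ v → ¬? (W? v) ×-dec ¬? (⁅ z ∣ d ⁆? v)
    ; z∉W = λ (_ , h) → h (inj₁ refl) ; d∉W = λ (_ , h) → h (inj₂ refl)
    ; closed = λ {u} {v} e (¬wu , ¬zd) → case ⁅ z ∣ d ⁆? v of λ
        { (yes h) → inj₂ h
        ; (no h)  → inj₁ ((λ wv → [ ¬wu , ¬zd ]′ (closed (edge-sym e) wv)) , h) } }

  side-ends : ∀ {u v} → Net.Edge side u v → W v ⊎ ⁅ z ∣ d ⁆ v
  side-ends (e , inj₁ wu) = closed e wu
  side-ends (e , inj₂ wv) = inj₁ wv

  side-on : (p : Path (Net.Edge side) z d m) → x ∈ᵖ p → W x ⊎ ⁅ z ∣ d ⁆ x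
  side-on p = all-on side-ends (walk p) (inj₂ (inj₁ refl))

module SideThrough {n} (G : Net n) (loopless : ∀ {v} → ¬ Net.Edge G v v) (crit : Critical G 3) {z d : Fin n} where

  open Net G

  -- An edge on no `z`-`d` path of its side is cut off by one vertex `S.d`. Within `W` this is a cut
  -- vertex of the whole graph, and `glue₁` applies.
  sideThrough : (T : TwoSep G z d) → let open TwoSep T in ∀ {a b} → Edge a b → misses G W? a b →
    ThroughAll (Net.Edge side) z d ⊎ Colourable Edge 3
  sideThrough T {a} {b} e′ (¬wa , ¬wb) = collectEdges side each
    where
    open TwoSep T
    each : ∀ {u v} → Net.Edge side u v →
      (Through (Net.Edge side) z d u v ⊎ Through (Net.Edge side) z d v u) ⊎ Colourable Edge 3
    each {u} {v} e with throughOrSep side z d u v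
    ... | inj₁ T = inj₁ T
    ... | inj₂ S = inj₂ (glue₁ G W′? crit S.d closed′ (proj₁ e) touch e′ (¬wa ∘ proj₂ , ¬wb ∘ proj₂))
      where
      module S = Sep S
      W′? : Decidable (λ x → S.W x × W x)
      W′? x = S.W? x ×-dec W? x
      closed′ : ∀ {a b} → Edge a b → S.W a × W a → (S.W b × W b) ⊎ b ≡ S.d
      closed′ e (s , w) with S.closed (e , inj₁ w) s | closed e w
      ... | inj₂ eq | _       = inj₂ eq
      ... | inj₁ s′ | inj₁ w′ = inj₁ (s′ , w′)
      ... | inj₁ s′ | inj₂ zd = ⊥-elim (S.Y∩ zd s′)
      inner : ∀ {a b} → Net.Edge side a b → S.W b → S.W b × W b
      inner e s = s , [ id , (λ zd → ⊥-elim (S.Y∩ zd s)) ]′ (side-ends e)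
      touch : touches G W′? u v
      touch with S.X⊆ (inj₁ refl) | S.X⊆ (inj₂ refl)
      ... | inj₁ s    | _         = inj₁ (inner (Net.edge-sym side e) s)
      ... | _         | inj₁ s    = inj₂ (inner e s)
      ... | inj₂ refl | inj₂ refl = ⊥-elim (loopless (proj₁ e))

module TwoSepColour {n} (G : Net n) (loopless : ∀ {v} → ¬ Net.Edge G v v) (c : ℕ) (4≤c : 4 ≤ c)
  (c-odd : par c ≡ true) (odds : OddLengths (Net.Edge G) c) (crit : Critical G 3)
  {z d : Fin n} (z≢d : z ≢ d) (z≁d : ¬ Net.Edge G z d) (T : TwoSep G z d)
  {u₀ v₀ : Fin n} (e₀ : Net.Edge G u₀ v₀) (t₀ : touches G (TwoSep.W? T) u₀ v₀)
  {x y : Fin n} (xy : Net.Edge G x y) (zx : Net.Edge G z x) (zy : Net.Edge G z y) (¬wx : ¬ TwoSep.W T x) (¬wy : ¬ TwoSep.W T y) where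

  open Net G
  open TwoSep T

  open SideThrough G loopless crit {z} {d}
  module O = TwoSep opposite

  E₁ E₂ : Edges n
  E₁ = Net.Edge side
  E₂ = Net.Edge O.side

  x∈O : O.W x
  x∈O = ¬wx , λ { (inj₁ refl) → loopless zx ; (inj₂ refl) → z≁d zx }

  y∈O : O.W y
  y∈O = ¬wy , λ { (inj₁ refl) → loopless zy ; (inj₂ refl) → z≁d zy }

  to-E₂ : Edge u v → misses G W? u v → E₂ u v
  to-E₂ {u} {v} e (¬wu , ¬wv) with ⁅ z ∣ d ⁆? u | ⁅ z ∣ d ⁆? v
  ... | no h | _ = e , inj₁ (¬wu , h)
  ... | _ | no h = e , inj₂ (¬wv , h)
  ... | yes (inj₁ refl) | yes (inj₁ refl) = ⊥-elim (loopless e)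
  ... | yes (inj₂ refl) | yes (inj₂ refl) = ⊥-elim (loopless e)
  ... | yes (inj₁ refl) | yes (inj₂ refl) = ⊥-elim (z≁d e)
  ... | yes (inj₂ refl) | yes (inj₁ refl) = ⊥-elim (z≁d (edge-sym e))

  colour₂ : Colourable (λ u v → Edge u v × misses G W? u v) 3
  colour₂ = crit (misses? G W?) (λ (a , b) → b , a) e₀ (λ (a , b) → [ a , b ]′ t₀)

  long : {P : Edges n} → Path (λ u v → Edge u v × P u v) z d m → 2 ≤ m
  long (path [] _)            = ⊥-elim (z≢d refl)
  long (path ((e , _) ∷ []) _) = ⊥-elim (z≁d e)
  long (path (_ ∷ _ ∷ _) _)   = s≤s (s≤s z≤n)

  -- As `z` and `d` are not adjacent, both paths have length at least 2, so the cycle they form is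
  -- no triangle.
  sum : Path E₁ z d i → Path E₂ z d j → par (i + j) ≡ true → i + j ≡ c
  sum {i} {j} p q odd with odds (proj₁ Z) odd
    where
    q⁻¹ = reverse edge-sym (mapᵖ {F = Edge} proj₁ q)
    Z = closeUp (mapᵖ {F = Edge} proj₁ p) (proj₁ q⁻¹) z≢d λ hp hq →
      case side-on p (mapᵖ-∈ {f = proj₁} p hp) , O.side-on q (mapᵖ-∈ {f = proj₁} q (proj₂ q⁻¹ hq)) of λ
        { (inj₂ zd , _) → zd ; (_ , inj₂ zd) → zd ; (inj₁ w , inj₁ (¬w , _)) → ⊥-elim (¬w w) }
  ... | inj₂ eq = eq
  ... | inj₁ eq = ⊥-elim (<⇒≱ (s≤s (s≤s (s≤s (s≤s z≤n)))) (≤-trans (+-mono-≤ (long p) (long q)) (≤-reflexive eq)))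

  -- A path through the edge xy of the triangle xyz, cut short by an edge from z.
  detour : ThroughAll E₂ z d → ∃[ ℓ ] Path E₂ z d ℓ × Path E₂ z d (suc ℓ)
  detour th₂ = [ cut zx′ zy′ xy′ , cut zy′ zx′ (edge-sym xy , inj₁ y∈O) ]′ (th₂ xy′)
    where
    xy′ : E₂ x y
    xy′ = xy , inj₁ x∈O
    zx′ : E₂ z x
    zx′ = zx , inj₂ x∈O
    zy′ : E₂ z y
    zy′ = zy , inj₂ y∈O
    cut : ∀ {x y} → E₂ z x → E₂ z y → E₂ x y → Through E₂ z d x y → ∃[ ℓ ] Path E₂ z d ℓ × Path E₂ z d (suc ℓ)
    cut zx zy xy T = _ , cons zy back (disjoint here) , cons zx (cons xy back (disjoint (end∈ᵖ front)))
      λ { here → loopless (proj₁ zx) ; (there h) → disjoint here h }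
      where open Through T

  sums : Path E₂ z d j → Path E₂ z d (suc j) → Path E₁ z d i → i + j ≡ c ⊎ i + suc j ≡ c
  sums {j} {i} q₀ q₁ p with par (i + j) in eq
  ... | true  = inj₁ (sum p q₀ eq)
  ... | false = inj₂ (sum p q₁ (trans (cong par (+-suc i j)) (cong not eq)))

  -- Any path of the first side closes with one of the two given paths to a cycle of length `c`,
  -- which bounds `j` + 1 by `c`.
  complement : ThroughAll E₁ z d → Path E₂ z d j → Path E₂ z d (suc j) → ∃[ κ ] κ + suc j ≡ c
  complement {j} th₁ q₀ q₁ with through-edge (Net.edge-sym side) (th₁ (e₀ , t₀)) (e₀ , t₀)
  ... | i , p with sums q₀ q₁ p
  ...   | inj₁ eq = c ∸ suc j , m∸n+n≡m (≤-trans (+-monoˡ-≤ j (≤-trans (s≤s z≤n) (long p))) (≤-reflexive eq))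
  ...   | inj₂ eq = i , eq

  module Lengths (th₁ : ThroughAll E₁ z d) (th₂ : ThroughAll E₂ z d) {κ κ₂ : ℕ} (κ-sum : κ + suc κ₂ ≡ c)
    (q₀ : Path E₂ z d κ₂) (q₁ : Path E₂ z d (suc κ₂)) where

    lengths₁ : Path E₁ z d i → i ≡ κ ⊎ i ≡ suc κ
    lengths₁ {i} p with sums q₀ q₁ p
    ... | inj₁ eq = inj₂ (+-cancelʳ-≡ κ₂ i (suc κ) (trans eq (trans (sym κ-sum) (+-suc κ κ₂))))
    ... | inj₂ eq = inj₁ (+-cancelʳ-≡ (suc κ₂) i κ (trans eq (sym κ-sum)))

    -- If every edge of the side lies on a path of the minimal length `m`, the parity of the
    -- distance from `z` is a bipartition of the side.
    bipartiteSide : ∀ m → (∀ {i} → Walk E₁ z d i → m ≤ i) →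
      (∀ {u v} → E₁ u v → Σ[ T ∈ Through E₁ z d u v ] Through.ℓ₁ T + suc (Through.ℓ₂ T) ≡ m
                        ⊎ (Σ[ T ∈ Through E₁ z d v u ] Through.ℓ₁ T + suc (Through.ℓ₂ T) ≡ m)) → Colourable Edge 3
    bipartiteSide m far exact = extendBipartite G W? z d z≢d z∉W d∉W closed (par ∘ Distance.φ side z (suc m))
      (λ e t → alternate (exactBipartition side ≤-refl far exact (e , t))) colour₂

    far₁ : Walk E₁ z d i → κ ≤ i
    far₁ r with shorten r
    ... | j , j≤i , p , _ with lengths₁ p
    ...   | inj₁ refl = j≤i
    ...   | inj₂ refl = ≤-trans (n≤1+n κ) j≤i

    -- Paths of both lengths on the first side determine the possible lengths on the second. Both
    -- sides get a layer colouring; as `κ` + `κ₂` + 1 is odd, `κ` and `κ₂` have equal parity and the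
    -- colourings agree at `d`.
    twoLayers : Path E₁ z d κ → Path E₁ z d (suc κ) → Colourable Edge 3
    twoLayers p₀ p₁ = paste G W? L₁.colour L₂.colour
        (λ e t → L₁.proper (e , t)) (λ e a b → L₂.proper (to-E₂ e (a , b)))
        (λ e w ¬w → case closed e w of λ
          { (inj₁ w′) → ⊥-elim (¬w w′)
          ; (inj₂ (inj₁ refl)) → trans L₁.at-p (sym L₂.at-p)
          ; (inj₂ (inj₂ refl)) → trans L₁.at-q (trans (cong bit same-parity) (sym L₂.at-q)) })
      where
      lengths₂ : ∀ {j} → Path E₂ z d j → j ≡ κ₂ ⊎ j ≡ suc κ₂
      lengths₂ {j} q with par (κ + j) in eq
      ... | true  = inj₂ (+-cancelˡ-≡ κ j (suc κ₂) (trans (sum p₀ q eq) (sym κ-sum)))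
      ... | false = inj₁ (+-cancelˡ-≡ (suc κ) j κ₂ (trans (sum p₁ q (cong not eq)) (trans (sym κ-sum) (+-suc κ κ₂))))
      far₂ : ∀ {j} → Walk E₂ z d j → κ₂ ≤ j
      far₂ r with shorten r
      ... | j , j≤i , p , _ with lengths₂ p
      ...   | inj₁ refl = j≤i
      ...   | inj₂ refl = ≤-trans (n≤1+n κ₂) j≤i
      near-by : ∀ {E : Edges n} {k u v} → (∀ {j} → Path E z d j → j ≡ k ⊎ j ≡ suc k) → Symm E → E u v →
        Through E z d u v ⊎ Through E z d v u → Near E z d u v k ⊎ Near E z d v u k
      near-by {E} {k} lengths s e = [ (λ T → inj₁ (nearT T e)) , (λ T → inj₂ (nearT T (s e))) ]′
        where
        nearT : ∀ {u v} → Through E z d u v → E u v → Near E z d u v k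
        nearT T e = near (walk T.front) (walk T.back) (≤-pred (≤-trans (≤-reflexive (sym (+-suc T.ℓ₁ T.ℓ₂)))
            ([ (λ eq → ≤-trans (≤-reflexive eq) (n≤1+n k)) , ≤-reflexive ]′ (lengths (whole T e)))))
          where module T = Through T
      too-long : ∀ {k} → ¬ (2 + k ≡ k ⊎ 2 + k ≡ suc k)
      too-long (inj₁ eq) = <⇒≢ (≤-trans (n<1+n _) (n≤1+n _)) (sym eq)
      too-long (inj₂ eq) = 1+n≢n eq
      loopless₁ : ∀ {v} → ¬ E₁ v v
      loopless₁ (e , _) = loopless e
      loopless₂ : ∀ {v} → ¬ E₂ v v
      loopless₂ (e , _) = loopless e
      close₁ : ∀ {u v} → E₁ u v → Near E₁ z d u v κ ⊎ Near E₁ z d v u κ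
      close₁ e = near-by lengths₁ (Net.edge-sym side) e (th₁ e)
      close₂ : ∀ {u v} → E₂ u v → Near E₂ z d u v κ₂ ⊎ Near E₂ z d v u κ₂
      close₂ e = near-by lengths₂ (Net.edge-sym O.side) e (th₂ e)
      bounded₁ : ¬ Path E₁ z d (2 + κ)
      bounded₁ p = too-long (lengths₁ p)
      bounded₂ : ¬ Path E₂ z d (2 + κ₂)
      bounded₂ q = too-long (lengths₂ q)
      r₀ : Walk E₁ z d κ
      r₀ = walk p₀
      s₀ : Walk E₂ z d κ₂
      s₀ = walk q₀
      module L₁ = LayerColouring (Layers.layerColouring side loopless₁ z d κ close₁ r₀ far₁ bounded₁)
      module L₂ = LayerColouring (Layers.layerColouring O.side loopless₂ z d κ₂ close₂ s₀ far₂ bounded₂)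
      same-parity : par κ ≡ par κ₂
      same-parity = agree (par κ) (par κ₂) (trans (sym (trans (par-+ κ (suc κ₂)) refl)) (trans (cong par κ-sum) c-odd))
        where
        agree : ∀ a b → a xor not b ≡ true → a ≡ b
        agree false false _ = refl
        agree true  true  _ = refl

    -- Three cases: all paths of the side have length `κ` + 1; every edge lies on one of length `κ`;
    -- both lengths occur. The first two make the side bipartite.
    colour : Colourable Edge 3
    colour with walk? (Net.edge? side) κ z d
    ... | no none = bipartiteSide (suc κ) far exact
      where
      exactly : ∀ {i} → Path E₁ z d i → i ≡ suc κ
      exactly p = [ (λ { refl → ⊥-elim (none (walk p)) }) , id ]′ (lengths₁ p)
      far : ∀ {i} → Walk E₁ z d i → suc κ ≤ i
      far r with shorten r
      ... | j , j≤i , p , _ = ≤-trans (≤-reflexive (sym (exactly p))) j≤i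
      exact : ∀ {u v} → E₁ u v → Σ[ T ∈ Through E₁ z d u v ] Through.ℓ₁ T + suc (Through.ℓ₂ T) ≡ suc κ
                        ⊎ (Σ[ T ∈ Through E₁ z d v u ] Through.ℓ₁ T + suc (Through.ℓ₂ T) ≡ suc κ)
      exact e with th₁ e
      ... | inj₁ T = inj₁ (T , exactly (whole T e))
      ... | inj₂ T = inj₂ (T , exactly (whole T (Net.edge-sym side e)))
    ... | yes r with shorten r
    ...   | j , j≤κ , p , _ with lengths₁ p
    ...     | inj₂ refl = ⊥-elim (<-irrefl refl j≤κ)
    ...     | inj₁ refl with collectEdges side exactOrLonger
      where
      exactOrLonger : ∀ {u v} → E₁ u v →
        (Σ[ T ∈ Through E₁ z d u v ] Through.ℓ₁ T + suc (Through.ℓ₂ T) ≡ κ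
          ⊎ (Σ[ T ∈ Through E₁ z d v u ] Through.ℓ₁ T + suc (Through.ℓ₂ T) ≡ κ)) ⊎ Path E₁ z d (suc κ)
      exactOrLonger e with th₁ e
      ... | inj₁ T = [ (λ eq → inj₁ (inj₁ (T , eq))) , (λ eq → inj₂ (subst (Path E₁ z d) eq (whole T e))) ]′
                       (lengths₁ (whole T e))
      ... | inj₂ T = [ (λ eq → inj₁ (inj₂ (T , eq))) , (λ eq → inj₂ (subst (Path E₁ z d) eq (whole T e′))) ]′
                       (lengths₁ (whole T e′))
        where e′ = Net.edge-sym side e
    ...       | inj₁ exact = bipartiteSide κ far₁ exact
    ...       | inj₂ p₁    = twoLayers p p₁

  not-opposite : Edge u v → touches G W? u v → ¬ O.W v
  not-opposite e t (¬w , ¬zd) = [ ¬w , ¬zd ]′ (side-ends (e , t))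

  twoSepColour : Colourable Edge 3
  twoSepColour with sideThrough T xy (¬wx , ¬wy)
                  | sideThrough opposite e₀ (not-opposite (edge-sym e₀) (swap t₀) , not-opposite e₀ t₀)
  ... | inj₂ col | _        = col
  ... | _        | inj₂ col = col
  ... | inj₁ th₁ | inj₁ th₂ = let κ₂ , q₀ , q₁ = detour th₂
                                  κ , κ-sum = complement th₁ q₀ q₁
                              in Lengths.colour th₁ th₂ κ-sum q₀ q₁

-- Graphs with a triangle

record Corner {n} (E : Edges n) (x y z : Fin n) : Set where
  field
    xy         : E x y
    yz         : E y z
    xz         : E x z
    private-xy : ∀ {v} → E x v → E y v → v ≡ z
    private-yz : ∀ {v} → E y v → E z v → v ≡ x

-- The colours 0, 1, 2, 0, 1, 0, 1, and so on: one use of the third colour, at distance 2, shifts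
-- the alternation behind it.
ramp : ℕ → Fin 3
ramp 0 = zero
ramp 1 = suc zero
ramp 2 = two
ramp (suc (suc (suc m))) = bit (par m)

ramp-step : ∀ m → ramp m ≢ ramp (suc m)
ramp-step 0 ()
ramp-step 1 ()
ramp-step 2 ()
ramp-step (suc (suc (suc m))) = bit-not (par m)

ramp-tail : 3 ≤ m → ramp m ≡ bit (not (par m))
ramp-tail (s≤s (s≤s (s≤s _))) = cong bit (sym (trans (not-involutive _) (not-involutive _)))

ramp-two : ∀ m → ramp m ≡ two → m ≡ 2
ramp-two 0 ()
ramp-two 1 ()
ramp-two 2 _ = refl
ramp-two (suc (suc (suc m))) eq = ⊥-elim (bit≢two _ eq)

module Pentagon {n} (G : Net n) (k : ℕ) (5≤k : 5 ≤ k) (odds : OddLengths (Net.Edge G) (2 + k)) where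

  open Net G

  loopless : ∀ {v} → ¬ Edge v v
  loopless e with odds (cycle refl trivial e) refl
  ... | inj₁ ()
  ... | inj₂ ()

  ≢-edge : Edge u v → u ≢ v
  ≢-edge e refl = loopless e

  -- The length 5 is neither 3 nor 2 + `k`, which is at least 7.
  pentagon : ∀ {a b c d e} → Edge a b → Edge b c → Edge c d → Edge d e → Edge e a →
    a ≢ c → a ≢ d → b ≢ d → b ≢ e → c ≢ e → ⊥
  pentagon {a} {b} {c} {d} {e} ab bc cd de ea a≢c a≢d b≢d b≢e c≢e with odds (cycle refl P ea) refl
    where
    P : Path Edge a e 4
    P = path (ab ∷ bc ∷ cd ∷ de ∷ [])
      ( (λ { here → loopless ab ; (there here) → a≢c refl ; (there (there here)) → a≢d refl
           ; (there (there (there here))) → loopless ea })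
      , (λ { here → loopless bc ; (there here) → b≢d refl ; (there (there here)) → b≢e refl })
      , (λ { here → loopless cd ; (there here) → c≢e refl })
      , (λ { here → loopless de })
      , tt)
  ... | inj₁ ()
  ... | inj₂ eq = <⇒≢ (≤-trans (n≤1+n 4) 5≤k) (suc-injective (suc-injective eq))

module TriangleCase {n} (G : Net n) (k : ℕ) (5≤k : 5 ≤ k) (k-odd : par k ≡ true)
  (odds : OddLengths (Net.Edge G) (2 + k)) (crit : Critical G 3) {x y z : Fin n} (T : Corner (Net.Edge G) x y z) where

  open Net G
  open Corner T

  open Pentagon G k 5≤k odds

  x≢y : x ≢ y
  x≢y = ≢-edge xy

  Kept : Edges n
  Kept u v = (u ≢ z × v ≢ z) × ¬ (⁅ x ∣ y ⁆ u × ⁅ x ∣ y ⁆ v)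

  kept? : ∀ u v → Dec (Kept u v)
  kept? u v = (¬? (u ≟ z) ×-dec ¬? (v ≟ z)) ×-dec ¬? (⁅ x ∣ y ⁆? u ×-dec ⁅ x ∣ y ⁆? v)

  kept-sym : Symm Kept
  kept-sym ((a , b) , h) = (b , a) , λ (p , q) → h (q , p)

  H : Net n
  H = restrict G kept? kept-sym

  E′ : Edges n
  E′ = Net.Edge H

  z∉ : (p : Walk E′ x v m) → ¬ z ∈ p
  z∉ p h = all-on {Q = _≢ z} (λ (_ , (_ , h) , _) → h) p (≢-edge xz) h refl

  closeXZ : (p : Path E′ x v m) → Edge v z → Cycle Edge (2 + m)
  closeXZ p vz = cycle refl (cons (edge-sym xz) (mapᵖ proj₁ p) (z∉ (walk p) ∘ mapᵖ-∈ {f = proj₁} p)) vz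

  closeYXZ : (p : Path E′ x v m) → ¬ y ∈ᵖ p → Edge v z → Cycle Edge (3 + m)
  closeYXZ p y∉ vz = cycle refl (cons (edge-sym yz) (cons (edge-sym xy) (mapᵖ proj₁ p) (y∉ ∘ mapᵖ-∈ {f = proj₁} p))
    λ { here → loopless yz ; (there h) → z∉ (walk p) (mapᵖ-∈ {f = proj₁} p h) }) vz

  -- An odd path is closed through `z`, an even one by the edge `yx`. A triangle arising so would
  -- need the deleted edge `xy` in the first case and a second triangle on `xy` in the other.
  lengths : Path E′ x y m → m ≡ k ⊎ m ≡ suc k
  lengths {m} p with par m in eq
  ... | true with odds (closeXZ p yz) (trans (not-involutive _) eq)
  ...   | inj₂ eq′ = inj₁ (suc-injective (suc-injective eq′))
  lengths (path ((_ , _ , h) ∷ []) _) | true | inj₁ refl = ⊥-elim (h (inj₁ refl , inj₂ refl))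
  lengths {m} p | false with odds (cycle refl (mapᵖ proj₁ p) (edge-sym xy)) (cong not eq)
  ...   | inj₂ eq′ = inj₂ (suc-injective eq′)
  lengths (path ((e , (_ , h) , _) ∷ (e′ , _) ∷ []) _) | false | inj₁ refl =
    ⊥-elim (h (private-xy e (edge-sym e′)))

  -- `z` takes the third colour, so its neighbours must avoid it; the edge `xy`, absent from `H`, is
  -- a separate condition.
  capped : (f : Fin n → Fin 3) → (∀ {u v} → E′ u v → f u ≢ f v) → f x ≢ f y →
    (∀ {v} → Edge z v → f v ≢ two) → Colourable Edge 3
  capped f proper fxy fz = g , g-proper
    where
    g : Fin n → Fin 3
    g v with v ≟ z
    ... | yes _ = two
    ... | no _  = f v
    g-proper : ∀ {u v} → Edge u v → g u ≢ g v
    g-proper {u} {v} e eq with u ≟ z | v ≟ z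
    ... | yes refl | yes refl = loopless e
    ... | yes refl | no _     = fz e (sym eq)
    ... | no _     | yes refl = fz (edge-sym e) eq
    ... | no u≢z   | no v≢z with ⁅ x ∣ y ⁆? u ×-dec ⁅ x ∣ y ⁆? v
    ...   | no h = proper (e , (u≢z , v≢z) , h) eq
    ...   | yes (inj₁ refl , inj₁ refl) = loopless e
    ...   | yes (inj₂ refl , inj₂ refl) = loopless e
    ...   | yes (inj₁ refl , inj₂ refl) = fxy eq
    ...   | yes (inj₂ refl , inj₁ refl) = fxy (sym eq)

  -- Here plain parity of the distance would give `x` and `y` the same colour, since `k` + 1 is
  -- even; `ramp` corrects this. A neighbour `v` of `z` at distance 2 from `x` would complete a
  -- 5-cycle through `z`, `y`, `x`.
  rampColour : (∀ {i} → Path E′ x y i → i ≡ suc k) → ThroughAll E′ x y → Colourable Edge 3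
  rampColour exactly th = capped (ramp ∘ φ) proper ends at-z
    where
    K = 3 + k
    open Distance H x K
    far : ∀ {i} → Walk E′ x y i → suc k ≤ i
    far r with shorten r
    ... | j , j≤i , p , _ = ≤-trans (≤-reflexive (sym (exactly p))) j≤i
    exact : ∀ {u v} → E′ u v → Σ[ T ∈ Through E′ x y u v ] Through.ℓ₁ T + suc (Through.ℓ₂ T) ≡ suc k
                      ⊎ (Σ[ T ∈ Through E′ x y v u ] Through.ℓ₁ T + suc (Through.ℓ₂ T) ≡ suc k)
    exact e with th e
    ... | inj₁ T = inj₁ (T , exactly (whole T e))
    ... | inj₂ T = inj₂ (T , exactly (whole T (Net.edge-sym H e)))
    proper : ∀ {u v} → E′ u v → ramp (φ u) ≢ ramp (φ v)
    proper {u} {v} e eq with exactBipartition H (n≤1+n _) far exact e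
    ... | inj₁ up = ramp-step (φ u) (trans eq (cong ramp up))
    ... | inj₂ up = ramp-step (φ v) (trans (sym eq) (cong ramp up))
    -- If `y` is not reached, its distance is the cutoff 3 + `k`, which has the parity of `k` + 1,
    -- so `y` gets the same colour.
    φy : φ y ≡ suc k ⊎ φ y ≡ K
    φy with φ y <? K
    ... | no h  = inj₂ (≤-antisym φ≤K (≮⇒≥ h))
    ... | yes h with shorten (geodesic h)
    ...   | j , _ , p , _ = inj₁ (≤-antisym (≤-trans (φ-min (walk p)) (≤-reflexive (exactly p))) (far (geodesic h)))
    3≤k : 3 ≤ k
    3≤k = ≤-trans (s≤s (s≤s (s≤s z≤n))) 5≤k
    ramp-y : ramp (φ y) ≡ suc zero
    ramp-y with φy
    ... | inj₁ eq = trans (cong ramp eq) (trans (ramp-tail (≤-trans 3≤k (n≤1+n k)))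
                      (cong bit (trans (not-involutive (par k)) k-odd)))
    ... | inj₂ eq = trans (cong ramp eq) (cong bit k-odd)
    ends : ramp (φ x) ≢ ramp (φ y)
    ends eq with trans (sym (trans eq ramp-y)) (cong ramp φ-root)
    ... | ()
    2≢φy : ¬ φ y ≡ 2
    2≢φy eq with φy
    ... | inj₁ eq′ = <⇒≢ (≤-trans 3≤k (n≤1+n k)) (trans (sym eq) eq′)
    ... | inj₂ eq′ = <⇒≢ (m≤m+n 3 k) (trans (sym eq) eq′)
    at-z : ∀ {v} → Edge z v → ramp (φ v) ≢ two
    at-z {v} zv eq with ramp-two (φ v) eq
    ... | φv with subst (Walk E′ x v) φv (geodesic (subst (_< K) (sym φv) (m≤m+n 3 k)))
    ...   | _∷_ {w = a} (xa , (_ , a≢z) , h) ((av , _) ∷ []) =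
      pentagon (edge-sym yz) (edge-sym xy) xa av (edge-sym zv) (≢-sym (≢-edge xz)) (≢-sym a≢z)
        (λ { refl → h (inj₁ refl , inj₂ refl) }) (λ { refl → 2≢φy φv })
        (λ { refl → 0≢2 (trans (sym φ-root) φv) })
      where
      0≢2 : 0 ≢ 2
      0≢2 ()

  -- The possible levels `i` of a twist next to `z`. For even `i` there is a cycle of length `i` +
  -- 3; for odd `i` there are two, of lengths `i` + 2 and `i` + 4, which are not both admissible.
  levels : ∀ i → (par i ≡ false → 3 + i ≡ 3 ⊎ 3 + i ≡ 2 + k) →
    (par i ≡ true → (2 + i ≡ 3 ⊎ 2 + i ≡ 2 + k) × (4 + i ≡ 3 ⊎ 4 + i ≡ 2 + k)) → i ≡ 0 ⊎ suc i ≡ k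
  levels i f g with par i
  ... | false = [ inj₁ ∘ suc-injective ∘ suc-injective ∘ suc-injective , inj₂ ∘ suc-injective ∘ suc-injective ]′ (f refl)
  ... | true with g refl
  ...   | _ , inj₁ ()
  ...   | inj₁ refl , inj₂ eq = ⊥-elim (<⇒≢ (≤-trans (s≤s (s≤s (s≤s (s≤s z≤n)))) 5≤k) (suc-injective (suc-injective eq)))
  ...   | inj₂ refl , inj₂ eq = ⊥-elim (<⇒≢ (≤-trans (n<1+n _) (n≤1+n _)) (sym eq))

  -- The two paths from `x` to `r` are closed through `z`, the bent one also through `y` and `z`;
  -- `y` is off it because `yz` lies in no second triangle. Of the two levels left, 0 means `r` =
  -- `x`, and `k` - 1 makes `s` adjacent to `y`, which gives the 5-cycle `y`, `s`, `r`, `z`, `x`.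
  no-twist : ∀ {r} → Edge z r → ¬ Twist E′ x y r k
  no-twist {r} zr record { level = level ; s = s ; rs = rs ; straight = straight ; bent = bent ; q∉bent = q∉bent
                         ; onward = onward ; r≢p = r≢p ; r≢q = r≢q ; s≢p = s≢p } =
    [ bottom straight , top onward ]′ (levels level even odd)
    where
    y≢s : y ≢ s
    y≢s refl = r≢p (private-yz (edge-sym (proj₁ rs)) zr)
    rz : Edge r z
    rz = edge-sym zr
    even : par level ≡ false → 3 + level ≡ 3 ⊎ 3 + level ≡ 2 + k
    even e = odds (closeXZ bent rz) (trans (not-involutive _) (cong not e))
    odd : par level ≡ true → (2 + level ≡ 3 ⊎ 2 + level ≡ 2 + k) × (4 + level ≡ 3 ⊎ 4 + level ≡ 2 + k)
    odd e = odds (closeXZ straight rz) (trans (not-involutive _) e)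
          , odds (closeYXZ bent (q∉bent y≢s) rz) (trans (not-involutive _) (trans (not-involutive _) e))
    bottom : ∀ {i} → Path E′ x r i → i ≡ 0 → ⊥
    bottom p refl = r≢p (sym (walk₀ (walk p)))
    top : ∀ {i} → Walk E′ s y (k ∸ i) → suc i ≡ k → ⊥
    top {i} w refl with subst (Walk E′ s y) (m+n∸n≡m 1 i) w
    ... | sy ∷ [] = pentagon (edge-sym (proj₁ sy)) (edge-sym (proj₁ rs)) rz (edge-sym xz) xy
        (≢-sym r≢q) (≢-edge yz) (proj₁ (proj₁ (proj₂ sy))) s≢p r≢p

  layerColour : Walk E′ x y k → ThroughAll E′ x y → Colourable Edge 3
  layerColour short th = capped L.colour L.proper ends at-z
    where
    close : ∀ {u v} → E′ u v → Near E′ x y u v k ⊎ Near E′ x y v u k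
    close e = [ (λ T → inj₁ (nearT T e)) , (λ T → inj₂ (nearT T (Net.edge-sym H e))) ]′ (th e)
      where
      nearT : ∀ {u v} → Through E′ x y u v → E′ u v → Near E′ x y u v k
      nearT T e = near (walk T.front) (walk T.back) (≤-pred (≤-trans (≤-reflexive (sym (+-suc T.ℓ₁ T.ℓ₂)))
          ([ (λ eq → ≤-trans (≤-reflexive eq) (n≤1+n k)) , ≤-reflexive ]′ (lengths (whole T e)))))
        where module T = Through T
    far : ∀ {i} → Walk E′ x y i → k ≤ i
    far r with shorten r
    ... | j , j≤i , p , _ with lengths p
    ...   | inj₁ refl = j≤i
    ...   | inj₂ refl = ≤-trans (n≤1+n k) j≤i
    too-long : ¬ Path E′ x y (2 + k)
    too-long p = [ (λ eq → <⇒≢ (≤-trans (n<1+n _) (n≤1+n _)) (sym eq)) , 1+n≢n ]′ (lengths p)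
    loopless-H : ∀ {v} → ¬ E′ v v
    loopless-H (e , _) = loopless e
    module L = LayerColouring (Layers.layerColouring H loopless-H x y k close short far too-long)
    ends : L.colour x ≢ L.colour y
    ends eq with trans (sym L.at-p) (trans eq (trans L.at-q (cong bit k-odd)))
    ... | ()
    at-z : ∀ {v} → Edge z v → L.colour v ≢ two
    at-z zr eq = no-twist zr (L.twist eq)

  -- A cut vertex `d` of `H` becomes a separation of `G` by `z` and `d`. It is a single cut vertex
  -- if `d` = `z`, a pair of adjacent vertices, or the non-adjacent pair treated before.
  separated : E′ u v → Sep E′ ⁅ u ∣ v ⁆ ⁅ x ∣ y ⁆ → Colourable Edge 3
  separated {u} {v} uv@(_ , (u≢z , v≢z) , _) S = decide (d ≟ z) (edge? z d)
    where
    open Sep S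
    W₁? : Decidable (λ a → W a × a ≢ z)
    W₁? a = W? a ×-dec ¬? (a ≟ z)
    closed₁ : ∀ {a b} → Edge a b → W a × a ≢ z → (W b × b ≢ z) ⊎ ⁅ z ∣ d ⁆ b
    closed₁ {a} {b} e (wa , a≢z) with b ≟ z
    ... | yes eq  = inj₂ (inj₁ eq)
    -- `x` and `y` are outside `W`, so the deleted edge `xy` does not start in `W`.
    ... | no b≢z = [ (λ wb → inj₁ (wb , b≢z)) , inj₂ ∘ inj₂ ]′
                     (closed (e , (a≢z , b≢z) , λ (h , _) → Y∩ h wa) wa)
    touch : touches G W₁? u v
    touch with X⊆ (inj₁ refl) | X⊆ (inj₂ refl)
    ... | inj₁ w | _      = inj₁ (w , u≢z)
    ... | _      | inj₁ w = inj₂ (w , v≢z)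
    ... | inj₂ p | inj₂ q = ⊥-elim (≢-edge (proj₁ uv) (trans p (sym q)))
    x∉ : ¬ (W x × x ≢ z)
    x∉ = Y∩ (inj₁ refl) ∘ proj₁
    y∉ : ¬ (W y × y ≢ z)
    y∉ = Y∩ (inj₂ refl) ∘ proj₁
    decide : Dec (d ≡ z) → Dec (Edge z d) → Colourable Edge 3
    decide (yes eq) _ = glue₁ G W₁? crit d
      (λ e w → [ inj₁ , inj₂ ∘ [ (λ p → trans p (sym eq)) , id ]′ ]′ (closed₁ e w)) (proj₁ uv) touch xy (x∉ , y∉)
    decide (no _) (yes zd) = glue₂ G W₁? crit z d zd (λ (_ , h) → h refl) (d∉W ∘ proj₁) closed₁ (proj₁ uv) touch
      xy (x∉ , y∉) λ { (inj₁ eq , _) → ≢-edge xz eq ; (_ , inj₁ eq) → ≢-edge yz eq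
                     ; (inj₂ p , inj₂ q) → x≢y (trans p (sym q)) }
    decide (no d≢z) (no z≁d) = TwoSepColour.twoSepColour G loopless (2 + k)
      (s≤s (s≤s (≤-trans (s≤s (s≤s z≤n)) 5≤k))) (trans (not-involutive _) k-odd) odds crit (≢-sym d≢z) z≁d
      record { W = λ a → W a × a ≢ z ; W? = W₁? ; z∉W = λ (_ , h) → h refl ; d∉W = d∉W ∘ proj₁ ; closed = closed₁ }
      (proj₁ uv) touch xy (edge-sym xz) (edge-sym yz) x∉ y∉

  triangleColour : Colourable Edge 3
  triangleColour with collectEdges H (λ {u} {v} e → [ inj₁ , (λ S → inj₂ (separated e S)) ]′ (throughOrSep H x y u v))
  ... | inj₂ col = col
  ... | inj₁ th with walk? (Net.edge? H) k x y
  ...   | yes r   = layerColour r th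
  ...   | no none = rampColour (λ p → [ (λ { refl → ⊥-elim (none (walk p)) }) , id ]′ (lengths p)) th

-- Graphs whose odd cycles all have the same length

mapᵖ-on : {Q : Subset n} → (∀ {u v} → Q u → Q v → E u v → F u v) →
  (p : Path E u v m) → (∀ {x} → x ∈ᵖ p → Q x) → Σ[ q ∈ Path F u v m ] (∀ {x} → x ∈ᵖ q → x ∈ᵖ p)
mapᵖ-on f (path [] _) on = trivial , λ { here → here }
mapᵖ-on {Q = Q} f (path (e ∷ p) (h , s)) on =
  let q , q⊆ = mapᵖ-on {Q = Q} f (path p s) (on ∘ there)
  in cons (f (on here) (on (there here)) e) q (h ∘ q⊆) , λ { here → here ; (there i) → there (q⊆ i) }

cutAt : ∀ i (r : Walk E u v (i + j)) →
  ∃[ a ] Σ[ p ∈ Walk E u a i ] Σ[ q ∈ Walk E a v j ] (∀ {x} → x ∈ r → x ∈ p ⊎ x ∈ q)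
cutAt {j = j} zero    r       = _ , [] , r , inj₂
cutAt {j = j} (suc i) (e ∷ r) = let a , p , q , c = cutAt {j = j} i r in
  a , e ∷ p , q , λ { here → inj₁ here ; (there h) → [ inj₁ ∘ there , inj₂ ]′ (c h) }

near-end : (p : Walk E u v m) → x ∈ p → x ≡ u ⊎ (∃[ i ] i < m × Walk E x v i)
near-end p       here      = inj₁ refl
near-end {m = suc m} (e ∷ p) (there h) with near-end p h
... | inj₁ refl         = inj₂ (m , ≤-refl , p)
... | inj₂ (i , lt , q) = inj₂ (i , m≤n⇒m≤1+n lt , q)

near-start : (p : Walk E u v m) → x ∈ p → x ≡ v ⊎ (∃[ i ] i < m × Walk E u x i)
near-start []      here = inj₁ refl
near-start (e ∷ p) here = inj₂ (0 , s≤s z≤n , [])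
near-start (e ∷ p) (there h) with near-start p h
... | inj₁ refl         = inj₁ refl
... | inj₂ (i , lt , q) = inj₂ (suc i , s≤s lt , e ∷ q)

first-split : ∀ {a b} {p : Path E u v m} → (S : Split₃ p a b) → Σ[ T ∈ Split p a ] Split.ℓ₁ T ≡ Split₃.ℓ₁ S
first-split S = record
  { total = trans (sym (+-assoc S.ℓ₁ S.ℓ₂ S.ℓ₃)) S.total ; front = S.front ; back = proj₁ J
  ; front⊆ = S.front⊆ ; back⊆ = [ S.mid⊆ , S.back⊆ ]′ ∘ proj₂ J
  ; meet = λ hf hb → [ S.front∩mid hf , (λ h → ⊥-elim (S.front∩back hf h)) ]′ (proj₂ J hb) } , refl
  where
  module S = Split₃ S
  J = join S.mid S.back S.mid∩back

second-split : ∀ {a b} {p : Path E u v m} → (S : Split₃ p a b) → Σ[ T ∈ Split p b ] Split.ℓ₁ T ≡ Split₃.ℓ₁ S + Split₃.ℓ₂ S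
second-split S = record
  { total = S.total ; front = proj₁ J ; back = S.back
  ; front⊆ = [ S.front⊆ , S.mid⊆ ]′ ∘ proj₂ J ; back⊆ = S.back⊆
  ; meet = λ hf hb → [ (λ h → ⊥-elim (S.front∩back h hb)) , (λ h → S.mid∩back h hb) ]′ (proj₂ J hf) } , refl
  where
  module S = Split₃ S
  J = join S.front S.mid S.front∩mid

xor-same : ∀ {a b} → a ≡ true → a xor b ≡ false → b ≡ true
xor-same {b = true}  refl _ = refl

xor-other : ∀ {a b} → a ≡ false → a xor b ≡ true → b ≡ true
xor-other refl h = h

par-sum : ∀ a b {s} → a + b ≡ s → par a xor par b ≡ par s
par-sum a b eq = trans (sym (par-+ a b)) (cong par eq)

double-injective : ∀ a b → a + a ≡ b + b → a ≡ b
double-injective zero    zero    _  = refl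
double-injective (suc a) (suc b) eq = cong suc (double-injective a b
  (suc-injective (trans (sym (+-suc a a)) (trans (suc-injective eq) (+-suc b b)))))

-- The sum is even, so `b` is odd along with `a`, and both equal `c`.
twin : ∀ l c {a b} → a + b ≡ l + l → par a ≡ true →
  (par a ≡ true → a ≡ c) → (par b ≡ true → b ≡ c) → l ≡ c
twin l c {a} {b} eq odd f g = double-injective l c
  (trans (sym eq) (cong₂ _+_ (f odd) (g (xor-same odd (trans (par-sum a b eq) (par-double l))))))

double-total : ∀ i j c {x y} → x ≡ c → y ≡ c → (i + j) + (i + j) + (x + y) ≡ (i + j + c) + (i + j + c)
double-total i j c refl refl = arith i j c
  where
  arith : ∀ i j c → (i + j) + (i + j) + (c + c) ≡ (i + j + c) + (i + j + c)
  arith = solve-∀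

-- Replacing both arcs by their complements keeps the parity of the length, replacing one changes it.
chords-zero : ∀ c → par c ≡ true → ∀ i j s t s′ t′ → s + t ≡ c → s′ + t′ ≡ c →
  (∀ a b → (a ≡ s ⊎ a ≡ t) → (b ≡ s′ ⊎ b ≡ t′) → par ((i + b) + (j + a)) ≡ true → (i + b) + (j + a) ≡ c) → i + j ≡ 0
chords-zero c c-odd i j s t s′ t′ st st′ f with par ((i + s′) + (j + s)) in eq
-- The two cycles have total length 2(`i` + `j` + `c`) and length `c` each.
... | true = +-cancelʳ-≡ c (i + j) 0 (twin (i + j + c) c (trans (both i j s t s′ t′) (double-total i j c st st′)) eq
    (f s s′ (inj₁ refl) (inj₁ refl)) (f t t′ (inj₂ refl) (inj₂ refl)))
  where
  both : ∀ i j s t s′ t′ → ((i + s′) + (j + s)) + ((i + t′) + (j + t)) ≡ (i + j) + (i + j) + ((s + t) + (s′ + t′))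
  both = solve-∀
... | false = +-cancelʳ-≡ c (i + j) 0 (twin (i + j + c) c (trans (both i j s t s′ t′) (double-total i j c st st′)) odd
    (f s t′ (inj₁ refl) (inj₂ refl)) (f t s′ (inj₂ refl) (inj₁ refl)))
  where
  one : ∀ i j s s′ t′ → ((i + s′) + (j + s)) + ((i + t′) + (j + s)) ≡ (i + j + s) + (i + j + s) + (s′ + t′)
  one = solve-∀
  odd : par ((i + t′) + (j + s)) ≡ true
  odd = xor-other eq (trans (par-sum ((i + s′) + (j + s)) _ (one i j s s′ t′))
    (trans (par-+ ((i + j + s) + (i + j + s)) (s′ + t′))
      (cong₂ _xor_ (par-double (i + j + s)) (trans (cong par st′) c-odd))))
  both : ∀ i j s t s′ t′ → ((i + t′) + (j + s)) + ((i + s′) + (j + t)) ≡ (i + j) + (i + j) + ((s + t) + (s′ + t′))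
  both = solve-∀

module Uniform {n} (G : Net n) (h : ℕ) (2≤h : 2 ≤ h)
  (odds : ∀ {m} → Cycle (Net.Edge G) m → par m ≡ true → m ≡ suc (h + h)) (crit : Critical G 3) where

  open Net G

  c : ℕ
  c = suc (h + h)

  c-odd : par c ≡ true
  c-odd = cong not (par-double h)

  loopless : ∀ {v} → ¬ Edge v v
  loopless e = <⇒≢ (s≤s (≤-trans (≤-trans (s≤s z≤n) 2≤h) (m≤m+n h h))) (odds (cycle refl trivial e) refl)

  Common : Cycle Edge i → Cycle Edge j → Set
  Common Z Z′ = Σ[ a ∈ Fin n ] Σ[ b ∈ Fin n ] a ≢ b × (a ∈ᶜ Z × b ∈ᶜ Z) × (a ∈ᶜ Z′ × b ∈ᶜ Z′)

  module Pair (Z Z′ : Cycle Edge c) where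

    X Y : Subset n
    X v = v ∈ᶜ Z
    Y v = v ∈ᶜ Z′

    X? : Decidable X
    X? v = v ∈? walk (round Z)

    Y? : Decidable Y
    Y? v = v ∈? walk (round Z′)

    unlinked : (T : Σ (Linkage Edge X Y) Trimmed) → let open Linkage (proj₁ T) in
      (∀ {x} → X x → Y x → x ≡ x₁) → Y x₂ → ⊥
    unlinked T@(Λ , _) only yx₂ = disjoint here (subst (_∈ᵖ q) (only X₂ yx₂) here)
      where open Linkage Λ

    -- By `chords-zero` both linking paths are trivial, so `x₂` is a common vertex other than `x₁`.
    -- The condition `only` holds vacuously for disjoint cycles; if they share one vertex, `p` is
    -- the trivial path there.
    linked : (T : Σ (Linkage Edge X Y) Trimmed) → let open Linkage (proj₁ T) in
      (∀ {x} → X x → Y x → x ≡ x₁) → ⊥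
    linked T@(Λ , _) only = unlinked T only (q-zero ℓ₂ q (m+n≡0⇒n≡0 ℓ₁ none) Y₂)
      where
      open Linkage Λ
      q-zero : ∀ {x y} ℓ → Path Edge x y ℓ → ℓ ≡ 0 → Y y → Y x
      q-zero .0 (path [] _) refl yy = yy
      module A = Arcs (arcs {a = x₂} {b = x₁} Z (λ eq → disjoint here (subst (_∈ᵖ q) eq here)) X₂ X₁)
      module B = Arcs (arcs {a = y₁} {b = y₂} Z′ (λ eq → disjoint (end∈ᵖ p) (subst (_∈ᵖ q) (sym eq) (end∈ᵖ q))) Y₁ Y₂)
      arcA : ∀ {a} → a ≡ A.s ⊎ a ≡ A.t → Σ[ r ∈ Path Edge x₂ x₁ a ] (∀ {x} → x ∈ᵖ r → X x)
      arcA (inj₁ refl) = A.out , A.out⊆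
      arcA (inj₂ refl) = let r , r⊆ = reverse edge-sym A.ret in r , A.ret⊆ ∘ r⊆
      arcB : ∀ {b} → b ≡ B.s ⊎ b ≡ B.t → Σ[ r ∈ Path Edge y₁ y₂ b ] (∀ {x} → x ∈ᵖ r → Y x)
      arcB (inj₁ refl) = B.out , B.out⊆
      arcB (inj₂ refl) = let r , r⊆ = reverse edge-sym B.ret in r , B.ret⊆ ∘ r⊆
      none : ℓ₁ + ℓ₂ ≡ 0
      none = chords-zero c c-odd ℓ₁ ℓ₂ A.s A.t B.s B.t A.total B.total λ a b ha hb → odds
        (closeLink edge-sym X? Y? T (proj₁ (arcA ha)) (proj₂ (arcA ha)) (proj₁ (arcB hb)) (proj₂ (arcB hb))
          λ hA hB → inj₁ (only (proj₂ (arcA ha) hA) (proj₂ (arcB hb) hB)))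

    common : Common Z Z′ ⊎ Colourable Edge 3
    common with any? (λ a → any? (λ b → ¬? (a ≟ b) ×-dec (X? a ×-dec X? b) ×-dec (Y? a ×-dec Y? b)))
    ... | yes two = inj₁ two
    ... | no ¬two with linkageᴳ G (Cycle.a Z) X? Y?
    ...   | inj₂ S = inj₂ (glue₁ G W? crit d closed (Cycle.back Z) touch (Cycle.back Z′)
              (Y∩ (end∈ᵖ (round Z′)) , Y∩ here))
      where
      open Sep S
      touch : touches G W? (Cycle.b Z) (Cycle.a Z)
      touch with X⊆ (end∈ᵖ (round Z)) | X⊆ here
      ... | inj₁ w  | _       = inj₁ w
      ... | _       | inj₁ w  = inj₂ w
      ... | inj₂ eq | inj₂ eq′ = ⊥-elim (loopless (subst (Edge _) (trans eq′ (sym eq)) (Cycle.back Z)))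
    ...   | inj₁ T@(Λ , pX , pY , qX , qY) with any? (λ v → X? v ×-dec Y? v)
    ...     | no none = ⊥-elim (linked T λ xx yx → ⊥-elim (none (_ , xx , yx)))
    ...     | yes (w , xw , yw) = ⊥-elim (at-w (w ∈? walk (Linkage.p Λ)))
      where
      open Linkage Λ
      unique : ∀ {x} → X x → Y x → x ≡ w
      unique {x} xx yx with x ≟ w
      ... | yes eq = eq
      ... | no ne  = ⊥-elim (¬two (x , w , ne , (xx , xw) , (yx , yw)))
      -- One of the two paths avoids the only common vertex `w` and forms a linkage with the trivial
      -- path at `w`.
      start : ∀ {a b i} (r : Path Edge a b i) → X a → Y b → (∀ {x} → x ∈ᵖ r → X x → x ≡ a) →
        (∀ {x} → x ∈ᵖ r → Y x → x ≡ b) → ¬ w ∈ᵖ r → ⊥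
      start r xa yb rX rY w∉ = linked (record
        { p = trivial {u = w} ; q = r ; X₁ = xw ; Y₁ = yw ; X₂ = xa ; Y₂ = yb ; disjoint = λ { here → w∉ } }
        , (λ { here _ → refl }) , (λ { here _ → refl }) , rX , rY) unique
      at-w : Dec (w ∈ᵖ p) → ⊥
      at-w (yes w∈p) = start q X₂ Y₂ qX qY (disjoint w∈p)
      at-w (no w∉p)  = start p X₁ Y₁ pX pY w∉p

  module Ball (x₀ : Fin n) (j : ℕ) (small : suc (j + j) < c) where

    -- With cutoff `j` + 1, all vertices outside the ball of radius `j` share the value `j` + 1.
    open Distance G x₀ (suc j)

    private
      Outer : Edges n
      Outer u v = j < φ u × j < φ v

      outer? : ∀ u v → Dec (Outer u v)
      outer? u v = (j <? φ u) ×-dec (j <? φ v)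

      outside : Net n
      outside = restrict G outer? λ (a , b) → b , a

    -- Shortest walks to both ends and the edge itself form a closed walk of odd length at most 2`j`
    -- + 1, so there would be an odd cycle shorter than `c`.
    no-flat : Edge u v → φ u ≡ φ v → ¬ φ v ≤ j
    no-flat {u} {v} e eq le with oddClosed loop (cong not (par-double (φ v)))
      where
      loop : Walk Edge u u (suc (φ v + φ v))
      loop = e ∷ (reverseʷ edge-sym (geodesic (s≤s le)) ++
        subst (Walk Edge x₀ u) eq (geodesic (s≤s (≤-trans (≤-reflexive eq) le))))
    ... | m , m≤ , Z , odd = <⇒≱ small (≤-trans (≤-reflexive (sym (odds Z odd))) (≤-trans m≤ (s≤s (+-mono-≤ le le))))

    -- Outside the ball use the bipartition; the sphere of radius j is independent and gets the third colour.
    ballColour : Bipartition (Net.Edge outside) → Colourable Edge 3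
    ballColour (b , alt) = f , λ {u} {v} e eq → proper e eq
      where
      f : Fin n → Fin 3
      f v with <-cmp (φ v) j
      ... | tri< _ _ _ = bit (par (φ v))
      ... | tri≈ _ _ _ = two
      ... | tri> _ _ _ = bit (b v)
      inside : Edge u v → φ u < j → φ v < j → bit (par (φ u)) ≢ bit (par (φ v))
      inside {u} {v} e u< v< eq with <-cmp (φ u) (φ v)
      ... | tri≈ _ same _ = no-flat e same (<⇒≤ v<)
      ... | tri< lt _ _ = bit-not (par (φ u)) (trans eq (cong (bit ∘ par) (≤-antisym (step e) lt)))
      ... | tri> _ _ gt = bit-not (par (φ v)) (trans (sym eq) (cong (bit ∘ par) (≤-antisym (step (edge-sym e)) gt)))
      far-apart : Edge u v → φ u < j → ¬ j < φ v
      far-apart e u< v> = <⇒≱ v> (≤-trans (step e) u<)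
      proper : ∀ {u v} → Edge u v → f u ≢ f v
      proper {u} {v} e eq with <-cmp (φ u) j | <-cmp (φ v) j
      ... | tri< u< _ _ | tri< v< _ _ = inside e u< v< eq
      ... | tri< _ _ _  | tri≈ _ _ _  = bit≢two _ eq
      ... | tri< u< _ _ | tri> _ _ v> = far-apart e u< v>
      ... | tri≈ _ _ _  | tri< _ _ _  = bit≢two _ (sym eq)
      ... | tri≈ _ p _  | tri≈ _ q _  = no-flat e (trans p (sym q)) (≤-reflexive q)
      ... | tri≈ _ _ _  | tri> _ _ _  = bit≢two _ (sym eq)
      ... | tri> _ _ u> | tri< v< _ _ = far-apart (edge-sym e) v< u>
      ... | tri> _ _ _  | tri≈ _ _ _  = bit≢two _ eq
      ... | tri> _ _ u> | tri> _ _ v> = bit-not (b u) (trans eq (cong bit (alt (e , u> , v>))))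

    avoiding : (Σ[ Z ∈ Cycle Edge c ] (∀ {v i} → v ∈ᶜ Z → i ≤ j → ¬ Walk Edge x₀ v i)) ⊎ Colourable Edge 3
    avoiding with bipartiteᴳ outside
    ... | inj₁ B = inj₂ (ballColour B)
    ... | inj₂ (m , Z , odd) = inj₁ (proj₁ Z″ , λ h le r → <⇒≱ (proj₂ Z″ h) (≤-trans (φ-min r) le))
      where
      Z′ = mapᶜ {F = Edge} proj₁ Z
      away : ∀ {v} → v ∈ᶜ Z′ → j < φ v
      away h = all-on {Q = λ v → j < φ v} (λ (_ , _ , v>) → v>) (walk (round Z)) (proj₂ (proj₂ (Cycle.back Z)))
        (mapᵖ-∈ {f = proj₁} (round Z) h)
      retype : ∀ {m} → m ≡ c → (Z : Cycle Edge m) → {Q : Subset n} → (∀ {v} → v ∈ᶜ Z → Q v) →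
        Σ[ Z ∈ Cycle Edge c ] (∀ {v} → v ∈ᶜ Z → Q v)
      retype refl Z h = Z , h
      Z″ = retype (odds Z′ odd) Z′ {Q = λ v → j < φ v} away

  -- Two cycles of length `c` that share exactly the edge `ab`; `A` and `B` below are the interiors
  -- of the two remaining paths.
  module Theta {a b : Fin n} (ba : Edge b a) (P₁ P₂ : Path Edge a b (h + h))
    (apart : ∀ {x} → x ∈ᵖ P₁ → x ∈ᵖ P₂ → x ≡ a ⊎ x ≡ b) where

    Inner : Edges n
    Inner u v = ¬ ⁅ a ∣ b ⁆ u × ¬ ⁅ a ∣ b ⁆ v

    inner? : ∀ u v → Dec (Inner u v)
    inner? u v = ¬? (⁅ a ∣ b ⁆? u) ×-dec ¬? (⁅ a ∣ b ⁆? v)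

    H : Net n
    H = restrict G inner? λ (p , q) → q , p

    A B : Subset n
    A v = v ∈ᵖ P₁ × ¬ ⁅ a ∣ b ⁆ v
    B v = v ∈ᵖ P₂ × ¬ ⁅ a ∣ b ⁆ v

    A? : Decidable A
    A? v = (v ∈? walk P₁) ×-dec ¬? (⁅ a ∣ b ⁆? v)

    B? : Decidable B
    B? v = (v ∈? walk P₂) ×-dec ¬? (⁅ a ∣ b ⁆? v)

    record Rung {x y} (r : Path Edge x y m) : Set where
      field
        x∈A    : A x
        y∈B    : B y
        off    : ∀ {v} → v ∈ᵖ r → ¬ ⁅ a ∣ b ⁆ v
        only-x : ∀ {v} → v ∈ᵖ r → v ∈ᵖ P₁ → v ≡ x
        only-y : ∀ {v} → v ∈ᵖ r → v ∈ᵖ P₂ → v ≡ y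

    -- o is one of the ends a and b: the cycle runs from o along P₁, over the rung and back along P₂.
    bend : ∀ {x y o i j} {r : Path Edge x y m} → Rung r → ⁅ a ∣ b ⁆ o →
      (f : Path Edge o x i) → (∀ {v} → v ∈ᵖ f → v ∈ᵖ P₁) → (g : Path Edge o y j) → (∀ {v} → v ∈ᵖ g → v ∈ᵖ P₂) →
      (∀ {v} → v ∈ᵖ f → v ∈ᵖ g → v ≡ o) → Cycle Edge ((i + m) + j)
    bend {r = r} R ab f f⊆ g g⊆ fg = proj₁ (closeUp (proj₁ fr) (proj₁ g⁻¹) (λ { refl → proj₂ y∈B ab })
        λ h hg → [ (λ hf → inj₁ (fg hf (proj₂ g⁻¹ hg))) , (λ hr → inj₂ (only-y hr (g⊆ (proj₂ g⁻¹ hg)))) ]′ (proj₂ fr h))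
      where
      open Rung R
      fr = join f r λ hf hr → only-x hr (f⊆ hf)
      g⁻¹ = reverse edge-sym g

    -- From `a` along `P₁`, over the rung, along `P₂` to `b` and back by `ba`; `crossed` exchanges
    -- the two paths.
    cross : ∀ {x y} {r : Path Edge x y m} → Rung r → (S : Split P₁ x) (T : Split P₂ y) →
      Cycle Edge (suc ((Split.ℓ₁ S + m) + Split.ℓ₂ T))
    cross {r = r} R S T = cycle refl (proj₁ whole′) ba
      where
      open Rung R
      module S = Split S
      module T = Split T
      fr = join S.front r λ hf hr → only-x hr (S.front⊆ hf)
      ends : ∀ {v} → v ∈ᵖ S.front → v ∈ᵖ T.back → ¬ ⁅ a ∣ b ⁆ v
      ends hf hb (inj₁ refl) = proj₂ y∈B (inj₁ (sym (T.meet here hb)))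
      ends hf hb (inj₂ refl) = proj₂ x∈A (inj₂ (sym (S.meet hf (end∈ᵖ S.back))))
      whole′ = join (proj₁ fr) T.back λ h hb →
        [ (λ hf → ⊥-elim (ends hf hb (apart (S.front⊆ hf) (T.back⊆ hb)))) , (λ hr → only-y hr (T.back⊆ hb)) ]′ (proj₂ fr h)

    crossed : ∀ {x y} {r : Path Edge x y m} → Rung r → (S : Split P₁ x) (T : Split P₂ y) →
      Cycle Edge (suc ((Split.ℓ₁ T + m) + Split.ℓ₂ S))
    crossed {r = r} R S T = cycle refl (proj₁ whole′) ba
      where
      open Rung R
      module S = Split S
      module T = Split T
      r⁻¹ = reverse edge-sym r
      fr = join T.front (proj₁ r⁻¹) λ hf hr → only-y (proj₂ r⁻¹ hr) (T.front⊆ hf)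
      ends : ∀ {v} → v ∈ᵖ T.front → v ∈ᵖ S.back → ¬ ⁅ a ∣ b ⁆ v
      ends hf hb (inj₁ refl) = proj₂ x∈A (inj₁ (sym (S.meet here hb)))
      ends hf hb (inj₂ refl) = proj₂ y∈B (inj₂ (sym (T.meet hf (end∈ᵖ T.back))))
      whole′ = join (proj₁ fr) S.back λ h hb →
        [ (λ hf → ⊥-elim (ends hf hb (apart (S.back⊆ hb) (T.front⊆ hf))))
        , (λ hr → only-x (proj₂ r⁻¹ hr) (S.back⊆ hb)) ]′ (proj₂ fr h)

    -- `s`, `s′` and `t`, `t′` are the pieces of the two paths, `ℓ` is the length of the rung. The
    -- two bends have total length 2(2`h` + `ℓ`), the two crossings 2(`c` + `ℓ`). Odd bends force
    -- `ℓ` = 1, odd crossings the excluded `ℓ` = 0.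
    rung-arith : ∀ ℓ s s′ t t′ → s + s′ ≡ h + h → t + t′ ≡ h + h →
      (par ((s + ℓ) + t) ≡ true → (s + ℓ) + t ≡ c) → (par ((s′ + ℓ) + t′) ≡ true → (s′ + ℓ) + t′ ≡ c) →
      (par (suc ((s + ℓ) + t′)) ≡ true → suc ((s + ℓ) + t′) ≡ c) →
      (par (suc ((t + ℓ) + s′)) ≡ true → suc ((t + ℓ) + s′) ≡ c) → ℓ ≢ 0 → ℓ ≡ 1 × s + t ≡ h + h
    rung-arith ℓ s s′ t t′ ss′ tt′ f g f′ g′ ℓ≢0 with par ((s + ℓ) + t) in eq
    ... | true = one , suc-injective (trans (sym (trans (cong (λ z → (s + z) + t) one) (shift s t))) (f refl))
      where
      shift : ∀ s t → (s + 1) + t ≡ suc (s + t)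
      shift = solve-∀
      both : ∀ ℓ s s′ t t′ → ((s + ℓ) + t) + ((s′ + ℓ) + t′) ≡ (s + s′) + (t + t′) + (ℓ + ℓ)
      both = solve-∀
      regroup : ∀ h ℓ → (h + h) + (h + h) + (ℓ + ℓ) ≡ ((h + h) + ℓ) + ((h + h) + ℓ)
      regroup = solve-∀
      one : ℓ ≡ 1
      one = +-cancelˡ-≡ (h + h) ℓ 1 (trans (twin ((h + h) + ℓ) c {(s + ℓ) + t} {(s′ + ℓ) + t′}
        (trans (both ℓ s s′ t t′) (trans (cong₂ (λ x y → x + y + (ℓ + ℓ)) ss′ tt′) (regroup h ℓ))) eq (λ _ → f refl) g)
        (+-comm 1 (h + h)))
    ... | false = ⊥-elim (ℓ≢0 (+-cancelˡ-≡ c ℓ 0 (trans (twin (c + ℓ) c {suc ((s + ℓ) + t′)} {suc ((t + ℓ) + s′)}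
        (trans (both ℓ s s′ t t′) (trans (cong₂ (λ x y → 2 + (x + y + (ℓ + ℓ))) ss′ tt′) (regroup h ℓ))) odd f′ g′)
        (sym (+-identityʳ c)))))
      where
      both : ∀ ℓ s s′ t t′ → suc ((s + ℓ) + t′) + suc ((t + ℓ) + s′) ≡ 2 + ((s + s′) + (t + t′) + (ℓ + ℓ))
      both = solve-∀
      regroup : ∀ h ℓ → 2 + ((h + h) + (h + h) + (ℓ + ℓ)) ≡ (suc (h + h) + ℓ) + (suc (h + h) + ℓ)
      regroup = solve-∀
      swapped : ∀ ℓ s t t′ → ((s + ℓ) + t) + suc ((s + ℓ) + t′) ≡ suc (((s + ℓ) + (s + ℓ)) + (t + t′))
      swapped = solve-∀
      odd : par (suc ((s + ℓ) + t′)) ≡ true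
      odd = xor-other eq (trans (par-sum ((s + ℓ) + t) _ (swapped ℓ s t t′)) (cong not
        (trans (par-+ ((s + ℓ) + (s + ℓ)) (t + t′)) (cong₂ _xor_ (par-double (s + ℓ)) (trans (cong par tt′) (par-double h))))))

    rung : ∀ {x y} {r : Path Edge x y m} → Rung r → (S : Split P₁ x) (T : Split P₂ y) →
      m ≡ 1 × Split.ℓ₁ S + Split.ℓ₁ T ≡ h + h
    rung {m = m} {r = r} R S T = rung-arith m S.ℓ₁ S.ℓ₂ T.ℓ₁ T.ℓ₂ S.total T.total
        (odds (bend R (inj₁ refl) S.front S.front⊆ T.front T.front⊆ λ hS hT →
          [ id , (λ { refl → ⊥-elim (proj₂ x∈A (inj₂ (sym (S.meet hS (end∈ᵖ S.back))))) }) ]′ (apart (S.front⊆ hS) (T.front⊆ hT))))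
        (odds (bend R (inj₂ refl) (proj₁ S⁻¹) (S.back⊆ ∘ proj₂ S⁻¹) (proj₁ T⁻¹) (T.back⊆ ∘ proj₂ T⁻¹) λ hS hT →
          [ (λ { refl → ⊥-elim (proj₂ x∈A (inj₁ (sym (S.meet here (proj₂ S⁻¹ hS))))) }) , id ]′
            (apart (S.back⊆ (proj₂ S⁻¹ hS)) (T.back⊆ (proj₂ T⁻¹ hT)))))
        (odds (cross R S T)) (odds (crossed R S T)) nonzero
      where
      open Rung R
      module S = Split S
      module T = Split T
      S⁻¹ = reverse edge-sym S.back
      T⁻¹ = reverse edge-sym T.back
      nonzero : m ≢ 0
      nonzero refl with walk₀ (walk r)
      ... | refl = proj₂ x∈A (apart (proj₁ x∈A) (proj₁ y∈B))

    toRung : ∀ {x y} (r : Path (Net.Edge H) x y m) → A x → B y →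
      (∀ {v} → v ∈ᵖ r → A v → v ≡ x) → (∀ {v} → v ∈ᵖ r → B v → v ≡ y) → Rung (mapᵖ {F = Edge} proj₁ r)
    toRung {x = x} r ax by rA rB = record
      { x∈A = ax ; y∈B = by ; off = off
      ; only-x = λ hr h₁ → rA (mapᵖ-∈ {f = proj₁} r hr) (h₁ , off hr)
      ; only-y = λ hr h₂ → rB (mapᵖ-∈ {f = proj₁} r hr) (h₂ , off hr) }
      where
      off : ∀ {v} → v ∈ᵖ mapᵖ {F = Edge} proj₁ r → ¬ ⁅ a ∣ b ⁆ v
      off h = all-on {Q = λ v → ¬ ⁅ a ∣ b ⁆ v} (λ (_ , _ , o) → o) (walk r) (proj₂ ax) (mapᵖ-∈ {f = proj₁} r h)

    -- By `rung`, the distances of the ends of a rung from `a` add up to 2`h`, so the rungs reach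
    -- `P₂` in the opposite order and cut off equal middle pieces. The cycle along `P₁`, over `p`,
    -- back along the middle of `P₂`, over `q`, on along `P₁` and through `ba` has length `c` + 2.
    ladder : ∀ {x₁ x₂ y₁ y₂ i j} {p : Path Edge x₁ y₁ i} {q : Path Edge x₂ y₂ j} → Rung p → Rung q →
      (∀ {v} → v ∈ᵖ p → ¬ v ∈ᵖ q) → Split₃ P₁ x₁ x₂ → ⊥
    ladder {x₁} {x₂} {y₁} {y₂} {p = p} {q} Rp Rq dis S = ordered (split₃ P₂ y₁≢y₂ (proj₁ P.y∈B) (proj₁ Q.y∈B))
      where
      module P = Rung Rp
      module Q = Rung Rq
      module S = Split₃ S
      y₁≢y₂ : y₁ ≢ y₂
      y₁≢y₂ refl = dis (end∈ᵖ p) (end∈ᵖ q)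
      x₁≢x₂ : x₁ ≢ x₂
      x₁≢x₂ refl = dis here here
      S₁ = first-split S
      S₂ = second-split S
      rung₁ : (T : Split P₂ y₁) → _ ≡ 1 × S.ℓ₁ + Split.ℓ₁ T ≡ h + h
      rung₁ = rung Rp (proj₁ S₁)
      rung₂ : (T : Split P₂ y₂) → _ ≡ 1 × (S.ℓ₁ + S.ℓ₂) + Split.ℓ₁ T ≡ h + h
      rung₂ = rung Rq (proj₁ S₂)
      point : ∀ {ℓ} → ℓ ≡ 0 → Path Edge x₁ x₂ ℓ → ⊥
      point refl r = x₁≢x₂ (walk₀ (walk r))
      ordered : Split₃ P₂ y₁ y₂ ⊎ Split₃ P₂ y₂ y₁ → ⊥
      ordered (inj₁ T) = point (m+n≡0⇒m≡0 S.ℓ₂ zero-gap) S.mid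
        where
        module T = Split₃ T
        gap : ∀ s m t k → (s + m) + (t + k) ≡ (s + t) + (m + k)
        gap = solve-∀
        zero-gap : S.ℓ₂ + T.ℓ₂ ≡ 0
        zero-gap = +-cancelˡ-≡ (S.ℓ₁ + T.ℓ₁) (S.ℓ₂ + T.ℓ₂) 0
          (trans (sym (gap S.ℓ₁ S.ℓ₂ T.ℓ₁ T.ℓ₂)) (trans (proj₂ (rung₂ (proj₁ (second-split T))))
            (trans (sym (proj₂ (rung₁ (proj₁ (first-split T))))) (sym (+-identityʳ _)))))
      ordered (inj₂ T) = too-long (odds Z (trans (cong par long) (trans (not-involutive _) c-odd)))
        where
        module T = Split₃ T
        mid⁻¹ = reverse edge-sym T.mid
        q⁻¹ = reverse edge-sym q
        off : ∀ {v} → v ∈ᵖ T.mid → ¬ ⁅ a ∣ b ⁆ v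
        off hm (inj₁ refl) = proj₂ Q.y∈B (inj₁ (sym (T.front∩mid here hm)))
        off hm (inj₂ refl) = proj₂ P.y∈B (inj₂ (sym (T.mid∩back hm (end∈ᵖ T.back))))
        J₁ = join S.front p λ hf hp → P.only-x hp (S.front⊆ hf)
        J₂ = join (proj₁ J₁) (proj₁ mid⁻¹) λ h hm → case proj₂ J₁ h of λ
          { (inj₁ hf) → ⊥-elim (off (proj₂ mid⁻¹ hm) (apart (S.front⊆ hf) (T.mid⊆ (proj₂ mid⁻¹ hm))))
          ; (inj₂ hp) → P.only-y hp (T.mid⊆ (proj₂ mid⁻¹ hm)) }
        x₂∉front : ¬ x₂ ∈ᵖ S.front
        x₂∉front hf = x₁≢x₂ (sym (S.front∩mid hf (end∈ᵖ S.mid)))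
        J₃ = join (proj₁ J₂) (proj₁ q⁻¹) λ h hq → let hq = proj₂ q⁻¹ hq in case proj₂ J₂ h of λ
          { (inj₂ hm) → Q.only-y hq (T.mid⊆ (proj₂ mid⁻¹ hm))
          ; (inj₁ h₁) → case proj₂ J₁ h₁ of λ
              { (inj₁ hf) → ⊥-elim (x₂∉front (subst (_∈ᵖ S.front) (Q.only-x hq (S.front⊆ hf)) hf))
              ; (inj₂ hp) → ⊥-elim (dis hp hq) } }
        x₁∉back : ¬ x₁ ∈ᵖ S.back
        x₁∉back hb = x₁≢x₂ (S.mid∩back here hb)
        J₄ = join (proj₁ J₃) S.back λ h hb → case proj₂ J₃ h of λ
          { (inj₂ hq) → Q.only-x (proj₂ q⁻¹ hq) (S.back⊆ hb)
          ; (inj₁ h₂) → case proj₂ J₂ h₂ of λ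
              { (inj₂ hm) → ⊥-elim (off (proj₂ mid⁻¹ hm) (apart (S.back⊆ hb) (T.mid⊆ (proj₂ mid⁻¹ hm))))
              ; (inj₁ h₁) → case proj₂ J₁ h₁ of λ
                  { (inj₁ hf) → ⊥-elim (S.front∩back hf hb)
                  ; (inj₂ hp) → ⊥-elim (x₁∉back (subst (_∈ᵖ S.back) (P.only-x hp (S.back⊆ hb)) hb)) } } }
        Z = cycle refl (proj₁ J₄) ba
        equal : S.ℓ₂ ≡ T.ℓ₂
        equal = +-cancelˡ-≡ (S.ℓ₁ + T.ℓ₁) S.ℓ₂ T.ℓ₂ (trans (left S.ℓ₁ S.ℓ₂ T.ℓ₁)
          (trans (proj₂ (rung₂ (proj₁ (first-split T)))) (trans (sym (proj₂ (rung₁ (proj₁ (second-split T)))))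
            (sym (+-assoc S.ℓ₁ T.ℓ₁ T.ℓ₂)))))
          where
          left : ∀ s m t → (s + t) + m ≡ (s + m) + t
          left = solve-∀
        arith : ∀ s m k → suc ((((s + 1) + m) + 1) + k) ≡ 3 + (s + m + k)
        arith = solve-∀
        long = trans (cong₂ (λ x y → suc ((((S.ℓ₁ + x) + T.ℓ₂) + y) + S.ℓ₃)) (proj₁ (rung₁ (proj₁ (second-split T)))) (proj₁ (rung₂ (proj₁ (first-split T)))))
          (trans (arith S.ℓ₁ T.ℓ₂ S.ℓ₃) (cong (3 +_) (trans (cong (λ m → S.ℓ₁ + m + S.ℓ₃) (sym equal)) S.total)))
        too-long : suc _ ≡ c → ⊥
        too-long eq = <⇒≢ (≤-trans (n<1+n _) (n≤1+n _)) (trans (sym eq) long)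

    untwisted : Σ (Linkage (Net.Edge H) A B) Trimmed → ⊥
    untwisted (Λ , pA , pB , qA , qB) =
      [ ladder Rp Rq (λ hp hq → disjoint (mapᵖ-∈ {f = proj₁} p hp) (mapᵖ-∈ {f = proj₁} q hq))
      , ladder Rq Rp (λ hq hp → disjoint (mapᵖ-∈ {f = proj₁} p hp) (mapᵖ-∈ {f = proj₁} q hq)) ]′
        (split₃ P₁ (λ eq → disjoint here (subst (_∈ᵖ q) (sym eq) here)) (proj₁ X₁) (proj₁ X₂))
      where
      open Linkage Λ
      Rp = toRung p X₁ Y₁ pA pB
      Rq = toRung q X₂ Y₂ qA qB

    -- `Z` shares two vertices with each interior, so it has a vertex in `W` and one that is neither
    -- in `W` nor `d`. Both arcs between them would have to pass through `d`.
    unseparated : (Z : Cycle Edge c) → (∀ {v} → v ∈ᶜ Z → ¬ ⁅ a ∣ b ⁆ v) → Common (cycle refl P₁ ba) Z →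
      Common (cycle refl P₂ ba) Z → ¬ Sep (Net.Edge H) A B
    unseparated Z off (a₁ , a₂ , a₁≢a₂ , (a₁∈ , a₂∈) , (a₁∈Z , a₂∈Z)) (b₁ , b₂ , b₁≢b₂ , (b₁∈ , b₂∈) , (b₁∈Z , b₂∈Z)) S =
      crossing inA outB
      where
      open Sep S
      inA : ∃[ α ] α ∈ᶜ Z × W α
      inA with X⊆ (a₁∈ , off a₁∈Z) | X⊆ (a₂∈ , off a₂∈Z)
      ... | inj₁ w  | _       = a₁ , a₁∈Z , w
      ... | _       | inj₁ w  = a₂ , a₂∈Z , w
      ... | inj₂ eq | inj₂ eq′ = ⊥-elim (a₁≢a₂ (trans eq (sym eq′)))
      outB : ∃[ β ] β ∈ᶜ Z × ¬ W β × β ≢ d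
      outB with b₁ ≟ d
      ... | no b₁≢d  = b₁ , b₁∈Z , Y∩ (b₁∈ , off b₁∈Z) , b₁≢d
      ... | yes refl = b₂ , b₂∈Z , Y∩ (b₂∈ , off b₂∈Z) , ≢-sym b₁≢b₂
      crosses : ∀ {α β i} → (r : Path Edge α β i) → (∀ {v} → v ∈ᵖ r → v ∈ᶜ Z) → W α → ¬ W β → d ∈ᵖ r
      crosses r r⊆ wα ¬wβ with mapᵖ-on {F = Net.Edge H} {Q = λ v → ¬ ⁅ a ∣ b ⁆ v} (λ p q e → e , p , q) r (off ∘ r⊆)
      ... | r′ , r′⊆ with d ∈? walk r′
      ...   | yes d∈ = r′⊆ d∈
      ...   | no d∉  = ⊥-elim (¬wβ (stays closed (walk r′) wα d∉ (end∈ᵖ r′)))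
      crossing : ∃[ α ] α ∈ᶜ Z × W α → ∃[ β ] β ∈ᶜ Z × ¬ W β × β ≢ d → ⊥
      crossing (α , α∈ , wα) (β , β∈ , ¬wβ , β≢d) =
        [ (λ eq → d∉W (subst W (sym eq) wα)) , (λ eq → β≢d (sym eq)) ]′
          (Q.meet (crosses Q.out Q.out⊆ wα ¬wβ)
                  (proj₂ ret⁻¹ (crosses (proj₁ ret⁻¹) (Q.ret⊆ ∘ proj₂ ret⁻¹) wα ¬wβ)))
        where
        α≢β : α ≢ β
        α≢β refl = ¬wβ wα
        module Q = Arcs (arcs {a = α} {b = β} Z α≢β α∈ β∈)
        ret⁻¹ = reverse edge-sym Q.ret

    -- The ball of radius 1 about `b` contains `a` as well, so an odd cycle outside it meets both
    -- paths in interior vertices.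
    thetaColour : Colourable Edge 3
    thetaColour with Ball.avoiding b 1 (s≤s (+-mono-≤ 2≤h (≤-trans (s≤s z≤n) 2≤h)))
    ... | inj₂ col = col
    ... | inj₁ (Z , away) with Pair.common (cycle refl P₁ ba) Z | Pair.common (cycle refl P₂ ba) Z
    ...   | inj₂ col | _        = col
    ...   | _        | inj₂ col = col
    ...   | inj₁ C₁  | inj₁ C₂ with linkageᴳ H a A? B?
    ...     | inj₁ T = ⊥-elim (untwisted T)
    ...     | inj₂ S = ⊥-elim (unseparated Z off C₁ C₂ S)
      where
      off : ∀ {v} → v ∈ᶜ Z → ¬ ⁅ a ∣ b ⁆ v
      off h (inj₁ refl) = away h ≤-refl (ba ∷ [])
      off h (inj₂ refl) = away h z≤n []

  -- `x₀` is the vertex opposite to the edge `ba`. The ball of radius `h` - 1 about it contains all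
  -- of the cycle but `a` and `b`, so an odd cycle avoiding the ball shares exactly these two. Its
  -- even arc between them has length 2`h` and is the second path of `Theta`.
  fromCycle : Cycle Edge c → Colourable Edge 3
  fromCycle C@(cycle {a = a} {b} refl P ba) = go h 2≤h refl
    where
    go : ∀ h′ → 2 ≤ h′ → h′ ≡ h → Colourable Edge 3
    go zero    () _
    go (suc j) _  refl with cutAt (suc j) (walk P)
    ... | x₀ , p , q , cover with Ball.avoiding x₀ j (s≤s (s≤s (+-monoʳ-≤ j (n≤1+n j))))
    ...   | inj₂ col = col
    ...   | inj₁ (Z , away) with Pair.common C Z
    ...     | inj₂ col = col
    ...     | inj₁ (s , t , s≢t , (s∈ , t∈) , (s∈Z , t∈Z)) = second (arcs {a = a} {b = b} Z a≢b (proj₁ both) (proj₂ both))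
      where
      a≢b : a ≢ b
      a≢b refl = loopless ba
      ends : ∀ {v} → v ∈ᵖ P → v ∈ᶜ Z → ⁅ a ∣ b ⁆ v
      ends hP hZ with cover hP
      ... | inj₁ hp with near-end p hp
      ...   | inj₁ eq              = inj₁ eq
      ...   | inj₂ (_ , s≤s le , r) = ⊥-elim (away hZ le (reverseʷ edge-sym r))
      ends hP hZ | inj₂ hq with near-start q hq
      ...   | inj₁ eq              = inj₂ eq
      ...   | inj₂ (_ , s≤s le , r) = ⊥-elim (away hZ le r)
      both : a ∈ᶜ Z × b ∈ᶜ Z
      both with ends s∈ s∈Z | ends t∈ t∈Z
      ... | inj₁ refl | inj₁ refl = ⊥-elim (s≢t refl)
      ... | inj₂ refl | inj₂ refl = ⊥-elim (s≢t refl)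
      ... | inj₁ refl | inj₂ refl = s∈Z , t∈Z
      ... | inj₂ refl | inj₁ refl = t∈Z , s∈Z
      theta : ∀ {ℓ} → (r : Path Edge a b ℓ) → (∀ {v} → v ∈ᵖ r → v ∈ᶜ Z) → par (suc ℓ) ≡ true → Colourable Edge 3
      theta {ℓ} r r⊆ odd = uniform (suc-injective (odds (cycle refl r ba) odd)) r r⊆
        where
        uniform : ∀ {ℓ} → ℓ ≡ h + h → (r : Path Edge a b ℓ) → (∀ {v} → v ∈ᵖ r → v ∈ᶜ Z) → Colourable Edge 3
        uniform refl r r⊆ = Theta.thetaColour ba P r λ hP hr → ends hP (r⊆ hr)
      second : Arcs Z a b → Colourable Edge 3
      second Q with par (Arcs.s Q) in eq
      ... | false = theta (Arcs.out Q) (Arcs.out⊆ Q) (cong not eq)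
      ... | true  = theta (proj₁ ret⁻¹) (Arcs.ret⊆ Q ∘ proj₂ ret⁻¹)
            (cong not (xor-even eq (trans (par-sum (Arcs.s Q) (Arcs.t Q) (Arcs.total Q)) c-odd)))
        where
        ret⁻¹ = reverse edge-sym (Arcs.ret Q)
        xor-even : ∀ {a b} → a ≡ true → a xor b ≡ true → b ≡ false
        xor-even {b = false} refl _ = refl

  uniformColour : Colourable Edge 3
  uniformColour with bipartiteᴳ G
  ... | inj₁ (f , alt) = bit ∘ f , λ {u} {v} e eq → bit-not (f u) (trans eq (cong bit (alt e)))
  ... | inj₂ (m , Z , odd) = retype (odds Z odd) Z
    where
    retype : ∀ {m} → m ≡ c → Cycle Edge m → Colourable Edge 3
    retype refl = fromCycle

-- The two colouring theorems

NoK₄ : Edges n → Set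
NoK₄ E = ∀ {a b c d} → E a b → E a c → E a d → E b c → E b d → E c d → ⊥

filter-≤ : ∀ {A : Set} {P Q : A → Set} (P? : Decidable P) (Q? : Decidable Q) → (∀ {x} → P x → Q x) →
  ∀ xs → length (filter P? xs) ≤ length (filter Q? xs)
filter-≤ P? Q? P⊆Q [] = z≤n
filter-≤ P? Q? P⊆Q (x ∷ xs) with P? x | Q? x
... | yes _ | yes _ = s≤s (filter-≤ P? Q? P⊆Q xs)
... | yes p | no ¬q = ⊥-elim (¬q (P⊆Q p))
... | no _  | yes _ = m≤n⇒m≤1+n (filter-≤ P? Q? P⊆Q xs)
... | no _  | no _  = filter-≤ P? Q? P⊆Q xs

filter-< : ∀ {A : Set} {P Q : A → Set} (P? : Decidable P) (Q? : Decidable Q) → (∀ {x} → P x → Q x) →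
  ∀ {x xs} → x List.∈ xs → Q x → ¬ P x → length (filter P? xs) < length (filter Q? xs)
filter-< P? Q? P⊆Q {x} {xs = _ ∷ xs} (here refl) q ¬p with P? x | Q? x
... | yes p | _     = ⊥-elim (¬p p)
... | no _  | no ¬q = ⊥-elim (¬q q)
... | no _  | yes _ = s≤s (filter-≤ P? Q? P⊆Q xs)
filter-< P? Q? P⊆Q {xs = y ∷ _} (there h) q ¬p with P? y | Q? y
... | yes _ | yes _ = s≤s (filter-< P? Q? P⊆Q h q ¬p)
... | yes p | no ¬q = ⊥-elim (¬q (P⊆Q p))
... | no _  | yes _ = m≤n⇒m≤1+n (filter-< P? Q? P⊆Q h q ¬p)
... | no _  | no _  = filter-< P? Q? P⊆Q h q ¬p

-- Induction on the number of edges: as `Φ` passes to subgraphs, the induction hypothesis is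
-- precisely criticality.
byCriticality : (Φ : Edges n → Set) → (∀ {E F : Edges n} → (∀ {u v} → F u v → E u v) → Φ E → Φ F) →
  (∀ (G : Net n) → Φ (Net.Edge G) → Critical G k → Colourable (Net.Edge G) k) →
  ∀ (G : Net n) → Φ (Net.Edge G) → Colourable (Net.Edge G) k
byCriticality {n} {k} Φ mono step G = go G (<-wellFounded _)
  where
  go : ∀ G → Acc _<_ (length (edges G)) → Φ (Net.Edge G) → Colourable (Net.Edge G) k
  go G (acc rs) φ = step G φ λ P? s {u} {v} e ¬p → go (restrict G P? s)
    (rs (filter-< (λ (u , v) → Net.edge? (restrict G P? s) u v) (λ (u , v) → Net.edge? G u v) proj₁
      (∈-cartesianProduct⁺ (∈-allFin u) (∈-allFin v)) e (¬p ∘ proj₂)))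
    (mono proj₁ φ)

fourVertices : (a b c d : Fin n) → Fin 4 → Fin n
fourVertices a b c d zero                   = a
fourVertices a b c d (suc zero)             = b
fourVertices a b c d (suc (suc zero))       = c
fourVertices a b c d (suc (suc (suc zero))) = d

fourEdges : ∀ {a b c d : Fin n} → Symm E → E a b → E a c → E a d → E b c → E b d → E c d →
  ∀ {i j} → i ≢ j → E (fourVertices a b c d i) (fourVertices a b c d j)
fourEdges s ab ac ad bc bd cd {zero} {zero} h = ⊥-elim (h refl)
fourEdges s ab ac ad bc bd cd {zero} {suc zero} h = ab
fourEdges s ab ac ad bc bd cd {zero} {suc (suc zero)} h = ac
fourEdges s ab ac ad bc bd cd {zero} {suc (suc (suc zero))} h = ad
fourEdges s ab ac ad bc bd cd {suc zero} {zero} h = s ab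
fourEdges s ab ac ad bc bd cd {suc zero} {suc zero} h = ⊥-elim (h refl)
fourEdges s ab ac ad bc bd cd {suc zero} {suc (suc zero)} h = bc
fourEdges s ab ac ad bc bd cd {suc zero} {suc (suc (suc zero))} h = bd
fourEdges s ab ac ad bc bd cd {suc (suc zero)} {zero} h = s ac
fourEdges s ab ac ad bc bd cd {suc (suc zero)} {suc zero} h = s bc
fourEdges s ab ac ad bc bd cd {suc (suc zero)} {suc (suc zero)} h = ⊥-elim (h refl)
fourEdges s ab ac ad bc bd cd {suc (suc zero)} {suc (suc (suc zero))} h = cd
fourEdges s ab ac ad bc bd cd {suc (suc (suc zero))} {zero} h = s ad
fourEdges s ab ac ad bc bd cd {suc (suc (suc zero))} {suc zero} h = s bd
fourEdges s ab ac ad bc bd cd {suc (suc (suc zero))} {suc (suc zero)} h = s cd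
fourEdges s ab ac ad bc bd cd {suc (suc (suc zero))} {suc (suc (suc zero))} h = ⊥-elim (h refl)

module Main (l : ℕ) (2≤l : 2 ≤ l) where

  -- The longer odd length 3 + 2`l` is 2 + `k₀`.
  k₀ : ℕ
  k₀ = l + suc l

  5≤k : 5 ≤ k₀
  5≤k = +-mono-≤ 2≤l (s≤s 2≤l)

  k-odd : par k₀ ≡ true
  k-odd = trans (cong par (+-suc l l)) (cong not (par-double l))

  Odds : Edges n → Set
  Odds E = OddLengths E (2 + k₀)

  odds-mono : ∀ {E F : Edges n} → (∀ {u v} → F u v → E u v) → Odds E → Odds F
  odds-mono f odds Z = odds (mapᶜ f Z)

  module _ {n} (G : Net n) (odds : Odds (Net.Edge G)) where

    open Net G

    open Pentagon G k₀ 5≤k odds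

    -- If ab lies in two triangles, a second triangle on bc would give K₄ or a 5-cycle.
    private-edge : NoK₄ Edge → ∀ {a b c c′} → Edge a b → Edge b c → Edge a c → Edge a c′ → Edge b c′ → c′ ≢ c →
      ∀ {w} → Edge b w → Edge c w → w ≡ a
    private-edge noK₄ {a} {c′ = c′} ab bc ac ac′ bc′ c′≢c {w} bw cw with w ≟ a | w ≟ c′
    ... | yes eq | _        = eq
    ... | no _   | yes refl = ⊥-elim (noK₄ ab ac ac′ bc bc′ cw)
    ... | no w≢a | no w≢c′  = ⊥-elim (pentagon (edge-sym cw) (edge-sym ac) ac′ (edge-sym bc′) bw
        w≢a w≢c′ (≢-sym c′≢c) (≢-sym (≢-edge bc)) (≢-edge ab))

    -- If `ab` or `bc` lies in a second triangle, `private-edge` shows that the other two edges of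
    -- `abc` do not; otherwise `ab` and `bc` serve.
    corner : NoK₄ Edge → ∀ {a b c} → Edge a b → Edge b c → Edge a c → ∃[ x ] ∃[ y ] ∃[ z ] Corner Edge x y z
    corner noK₄ {a} {b} {c} ab bc ac with any? (λ v → edge? a v ×-dec edge? b v ×-dec ¬? (v ≟ c))
                                          | any? (λ v → edge? b v ×-dec edge? c v ×-dec ¬? (v ≟ a))
    ... | yes (c′ , ac′ , bc′ , c′≢c) | _ = a , c , b , record
      { xy = ac ; yz = edge-sym bc ; xz = ab
      ; private-xy = private-edge noK₄ (edge-sym ab) ac bc bc′ ac′ c′≢c
      ; private-yz = λ cw bw → private-edge noK₄ ab bc ac ac′ bc′ c′≢c bw cw }
    ... | _ | yes (a′ , ba′ , ca′ , a′≢a) = b , a , c , record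
      { xy = edge-sym ab ; yz = ac ; xz = bc
      ; private-xy = λ bw aw → private-edge noK₄ (edge-sym bc) (edge-sym ab) (edge-sym ac) ca′ ba′ a′≢a bw aw
      ; private-yz = λ aw cw → private-edge noK₄ bc (edge-sym ac) (edge-sym ab) ba′ ca′ a′≢a cw aw }
    ... | no ¬ab | no ¬bc = a , b , c , record
      { xy = ab ; yz = bc ; xz = ac
      ; private-xy = λ {v} av bv → case v ≟ c of λ { (yes eq) → eq ; (no ne) → ⊥-elim (¬ab (v , av , bv , ne)) }
      ; private-yz = λ {v} bv cv → case v ≟ a of λ { (yes eq) → eq ; (no ne) → ⊥-elim (¬bc (v , bv , cv , ne)) } }

    threeStep : NoK₄ Edge → Critical G 3 → Colourable Edge 3
    threeStep noK₄ crit with any? (λ a → any? (λ b → any? (λ c → edge? a b ×-dec edge? b c ×-dec edge? a c)))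
    ... | yes (a , b , c , ab , bc , ac) = TriangleCase.triangleColour G k₀ 5≤k k-odd odds crit
            (proj₂ (proj₂ (proj₂ (corner noK₄ ab bc ac))))
    -- With `h` = `l` + 1 the length 2`h` + 1 computes to 2 + `k₀`.
    ... | no none = Uniform.uniformColour G (suc l) (≤-trans 2≤l (n≤1+n l)) odds′ crit
      where
      odds′ : ∀ {m} → Cycle Edge m → par m ≡ true → m ≡ 2 + k₀
      odds′ Z odd with odds Z odd
      ... | inj₂ eq = eq
      odds′ (cycle refl (path (e ∷ e′ ∷ []) _) back) odd | inj₁ refl = ⊥-elim (none (_ , _ , _ , e , e′ , edge-sym back))

  threeColour : (G : Net n) → Odds (Net.Edge G) → NoK₄ (Net.Edge G) → Colourable (Net.Edge G) 3
  threeColour G odds noK₄ = byCriticality (λ E → Odds E × NoK₄ E)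
    (λ f (o , h) → odds-mono f o , λ ab ac ad bc bd cd → h (f ab) (f ac) (f ad) (f bc) (f bd) (f cd))
    (λ G (o , h) → threeStep G o h) G (odds , noK₄)

  spare : ∀ (i j : Fin 4) → ∃[ r ] ∃[ s ] r ≢ s × (r ≢ i × r ≢ j) × (s ≢ i × s ≢ j)
  spare = toWitness {a? = all? λ i → all? λ j → any? λ r → any? λ s →
    ¬? (r ≟ s) ×-dec (¬? (r ≟ i) ×-dec ¬? (r ≟ j)) ×-dec (¬? (s ≟ i) ×-dec ¬? (s ≟ j))} tt

  module _ {n} (G : Net n) (odds : Odds (Net.Edge G)) (crit : Critical G 4)
    (q : Fin 4 → Fin n) (q-adj : ∀ {i j} → i ≢ j → Net.Edge G (q i) (q j)) where

    open Net G

    open Pentagon G k₀ 5≤k odds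

    private
      q-inj : ∀ {i j} → i ≢ j → q i ≢ q j
      q-inj i≢j eq = loopless (subst (Edge _) (sym eq) (q-adj i≢j))

    Q : Subset n
    Q v = ∃[ i ] v ≡ q i

    Q? : Decidable Q
    Q? v = any? (λ i → v ≟ q i)

    -- Two neighbours in the clique, joined through the other two clique vertices, would give a
    -- 5-cycle.
    one-neighbour : ∀ {v i j} → i ≢ j → ¬ Q v → Edge v (q i) → ¬ Edge v (q j)
    one-neighbour {v} {i} {j} i≢j ¬Qv vi vj with spare i j
    ... | r , s , r≢s , (r≢i , r≢j) , (s≢i , s≢j) = pentagon vi (q-adj (≢-sym r≢i)) (q-adj r≢s) (q-adj s≢j) (edge-sym vj)
      (λ eq → ¬Qv (r , eq)) (λ eq → ¬Qv (s , eq)) (q-inj (≢-sym s≢i)) (q-inj i≢j) (q-inj r≢j)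

    -- The four colours in two pairs, one pair for each class of the bipartition.
    low high : Bool → Fin 4
    low false  = zero
    low true   = suc (suc zero)
    high false = suc zero
    high true  = suc (suc (suc zero))

    half : Fin 4 → Bool
    half zero             = false
    half (suc zero)       = false
    half (suc (suc _))    = true

    half-low : ∀ b → half (low b) ≡ b
    half-low false = refl
    half-low true  = refl

    half-high : ∀ b → half (high b) ≡ b
    half-high false = refl
    half-high true  = refl

    low≢high : ∀ b → low b ≢ high b
    low≢high false ()
    low≢high true  ()

    -- A vertex outside the clique Q has at most one neighbour in Q, so each side of the bipartition
    -- of the rest can be coloured with two of the four colours of Q.
    fromBipartition : Bipartition (Net.Edge (restrict G (misses? G Q?) (λ (a , b) → b , a))) → Colourable Edge 4
    fromBipartition (b , alt) = f , λ {u} {v} → proper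
      where
      pick : Fin n → Fin 4
      pick v with edge? v (q (low (b v)))
      ... | yes _ = high (b v)
      ... | no _  = low (b v)
      pick-free : ∀ {v} → ¬ Q v → ¬ Edge v (q (pick v))
      pick-free {v} ¬Qv e with edge? v (q (low (b v)))
      ... | yes e′ = one-neighbour (low≢high (b v)) ¬Qv e′ e
      ... | no ¬e  = ¬e e
      pick-half : ∀ v → half (pick v) ≡ b v
      pick-half v with edge? v (q (low (b v)))
      ... | yes _ = half-high (b v)
      ... | no _  = half-low (b v)
      f : Fin n → Fin 4
      f v with Q? v
      ... | yes (i , _) = i
      ... | no _        = pick v
      proper : ∀ {u v} → Edge u v → f u ≢ f v
      proper {u} {v} e eq with Q? u | Q? v
      ... | yes (i , refl) | yes (j , refl) = loopless (subst (λ i → Edge (q i) (q j)) eq e)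
      ... | yes (i , refl) | no ¬Qv = pick-free ¬Qv (subst (λ i → Edge v (q i)) eq (edge-sym e))
      ... | no ¬Qu | yes (j , refl) = pick-free ¬Qu (subst (λ i → Edge u (q i)) (sym eq) e)
      ... | no ¬Qu | no ¬Qv with trans (sym (pick-half u)) (trans (cong half eq) (pick-half v))
      ...   | same = not≢ (trans (sym (alt (e , ¬Qu , ¬Qv))) (sym same))
        where
        not≢ : ∀ {a} → ¬ not a ≡ a
        not≢ {false} ()
        not≢ {true}  ()

    module _ (Z : Cycle Edge m) (odd : par m ≡ true) (avoids-Q : ∀ {v} → v ∈ᶜ Z → ¬ Q v) where

      Y : Subset n
      Y v = v ∈ᶜ Z

      Y? : Decidable Y
      Y? v = v ∈? walk (round Z)

      jump : ∀ {m} → m ≡ 3 ⊎ m ≡ 2 + k₀ → ¬ (2 + m ≡ 3 ⊎ 2 + m ≡ 2 + k₀)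
      jump (inj₁ refl) (inj₁ ())
      jump (inj₁ refl) (inj₂ eq) = <⇒≢ (≤-trans (n≤1+n 4) 5≤k) (suc-injective (suc-injective eq))
      jump (inj₂ refl) (inj₁ ())
      jump (inj₂ refl) (inj₂ eq) = <⇒≢ (≤-trans (n<1+n _) (n≤1+n _)) (sym eq)

      -- The clique offers both an edge and a path of length 3, giving odd cycles whose lengths differ by 2.
      unlinkedQ : ¬ Σ (Linkage Edge Q Y) Trimmed
      unlinkedQ T@(Λ , _) = go X₁ X₂
        where
        open Linkage Λ renaming (p to π₁; q to π₂)
        module A = Arcs (arcs {a = y₁} {b = y₂} Z (λ eq → disjoint (end∈ᵖ π₁) (subst (_∈ᵖ π₂) (sym eq) (end∈ᵖ π₂))) Y₁ Y₂)
        go : Q x₁ → Q x₂ → ⊥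
        go (i , x₁≡) (j , x₂≡) with spare i j
        ... | r , s , r≢s , (r≢i , r≢j) , (s≢i , s≢j) = both (par ((ℓ₁ + A.s) + (ℓ₂ + 1))) refl
          where
          i≢j : i ≢ j
          i≢j refl = disjoint here (subst (_∈ᵖ π₂) (trans x₂≡ (sym x₁≡)) here)
          segment : ∀ {m} → (P : Path Edge (q j) (q i) m) → (∀ {v} → v ∈ᵖ P → Q v) →
            Σ[ P ∈ Path Edge x₂ x₁ m ] (∀ {v} → v ∈ᵖ P → Q v)
          segment {m} P P⊆ = retype (sym x₂≡) (sym x₁≡) P P⊆
            where
            retype : ∀ {a b a′ b′} → a ≡ a′ → b ≡ b′ → (P : Path Edge a b m) → (∀ {v} → v ∈ᵖ P → Q v) →
              Σ[ P ∈ Path Edge a′ b′ m ] (∀ {v} → v ∈ᵖ P → Q v)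
            retype refl refl P P⊆ = P , P⊆
          direct = segment (edge (q-adj (≢-sym i≢j)) (q-inj (≢-sym i≢j)))
            λ h → [ (λ eq → j , eq) , (λ eq → i , eq) ]′ (edge-∈ {h = q-inj (≢-sym i≢j)} h)
          P₁ = edge (q-adj s≢i) (q-inj s≢i)
          r∉P₁ : ¬ q r ∈ᵖ P₁
          r∉P₁ h = [ q-inj r≢s , q-inj r≢i ]′ (edge-∈ {h = q-inj s≢i} h)
          P₂ = cons (q-adj r≢s) P₁ r∉P₁
          P₃ = cons (q-adj (≢-sym r≢j)) P₂ λ h → [ q-inj (≢-sym r≢j)
            , (λ h → [ q-inj (≢-sym s≢j) , q-inj (≢-sym i≢j) ]′ (edge-∈ {h = q-inj s≢i} h)) ]′ (cons-∈ {e = q-adj r≢s} {p = P₁} {h = r∉P₁} h)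
          around = segment P₃ λ { here → j , refl ; (there here) → r , refl ; (there (there here)) → s , refl
                                ; (there (there (there here))) → i , refl }
          close : ∀ {a b} (A : Σ[ P ∈ Path Edge x₂ x₁ a ] (∀ {v} → v ∈ᵖ P → Q v)) (B : Path Edge y₁ y₂ b) →
            (∀ {v} → v ∈ᵖ B → Y v) → Cycle Edge ((ℓ₁ + b) + (ℓ₂ + a))
          close (A , A⊆) B B⊆ = closeLink edge-sym Q? Y? T A A⊆ B B⊆ λ hA hB → ⊥-elim (avoids-Q (B⊆ hB) (A⊆ hA))
          shift : ∀ x b y → (x + b) + (y + 3) ≡ 2 + ((x + b) + (y + 1))
          shift = solve-∀
          even : ∀ {b} (B : Path Edge y₁ y₂ b) → (∀ {v} → v ∈ᵖ B → Y v) → ¬ par ((ℓ₁ + b) + (ℓ₂ + 1)) ≡ true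
          even {b} B B⊆ odd = jump (odds (close direct B B⊆) odd)
            (subst (λ m → m ≡ 3 ⊎ m ≡ 2 + k₀) (shift ℓ₁ b ℓ₂) (odds (close around B B⊆)
              (trans (cong par (shift ℓ₁ b ℓ₂)) (trans (not-involutive _) odd))))
          ret⁻¹ = reverse edge-sym A.ret
          swapped : ∀ x y s t → ((x + s) + (y + 1)) + ((x + t) + (y + 1)) ≡ ((x + y + 1) + (x + y + 1)) + (s + t)
          swapped = solve-∀
          -- `Z` is odd, so exchanging its two arcs changes the parity; one of them makes the cycle
          -- over the direct clique edge odd.
          both : ∀ β → par ((ℓ₁ + A.s) + (ℓ₂ + 1)) ≡ β → ⊥
          both true  eq = even A.out A.out⊆ eq
          both false eq = even (proj₁ ret⁻¹) (A.ret⊆ ∘ proj₂ ret⁻¹) (xor-other eq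
            (trans (par-sum ((ℓ₁ + A.s) + (ℓ₂ + 1)) _ (swapped ℓ₁ ℓ₂ A.s A.t))
              (trans (par-+ ((ℓ₁ + ℓ₂ + 1) + (ℓ₁ + ℓ₂ + 1)) (A.s + A.t))
                (cong₂ _xor_ (par-double (ℓ₁ + ℓ₂ + 1)) (trans (cong par A.total) odd)))))

      -- Two disjoint paths being impossible, a cut vertex separates the clique from the odd cycle.
      offClique : Colourable Edge 4
      offClique with linkageᴳ G (Cycle.a Z) Q? Y?
      ... | inj₁ T = ⊥-elim (unlinkedQ T)
      ... | inj₂ S = glue₁ G W? crit d closed (q-adj 0≢1) touch (Cycle.back Z) (Y∩ (end∈ᵖ (round Z)) , Y∩ here)
        where
        open Sep S
        0≢1 : _≢_ {A = Fin 4} zero (suc zero)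
        0≢1 ()
        touch : touches G W? (q zero) (q (suc zero))
        touch with X⊆ (zero , refl) | X⊆ (suc zero , refl)
        ... | inj₁ w  | _       = inj₁ w
        ... | _       | inj₁ w  = inj₂ w
        ... | inj₂ eq | inj₂ eq′ = ⊥-elim (q-inj 0≢1 (trans eq (sym eq′)))

    fourStep : Colourable Edge 4
    fourStep with bipartiteᴳ (restrict G (misses? G Q?) (λ (a , b) → b , a))
    ... | inj₁ B = fromBipartition B
    ... | inj₂ (m , Z , odd) = offClique (mapᶜ {F = Edge} proj₁ Z) odd λ h →
      all-on {Q = λ v → ¬ Q v} (λ (_ , _ , ¬q) → ¬q) (walk (round Z)) (proj₂ (proj₂ (Cycle.back Z)))
        (mapᵖ-∈ {f = proj₁} (round Z) h)

  fourColour : (G : Net n) → Odds (Net.Edge G) → Colourable (Net.Edge G) 4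
  fourColour G odds = byCriticality Odds odds-mono step G odds
    where
    step : ∀ (G : Net n) → Odds (Net.Edge G) → Critical G 4 → Colourable (Net.Edge G) 4
    step {n} G odds crit with any? (λ a → any? (λ b → any? (λ c → any? (λ d →
        (edge? a b ×-dec edge? a c ×-dec edge? a d) ×-dec (edge? b c ×-dec edge? b d ×-dec edge? c d)))))
      where open Net G
    ... | no none = let f , proper = threeColour G odds λ ab ac ad bc bd cd → none (_ , _ , _ , _ , (ab , ac , ad) , (bc , bd , cd))
                    in inject₁ ∘ f , λ e → proper e ∘ inject₁-injective
    ... | yes (a , b , c , d , (ab , ac , ad) , (bc , bd , cd)) = fourStep G odds crit (fourVertices a b c d) (fourEdges {E = Net.Edge G} (Net.edge-sym G) ab ac ad bc bd cd)

-- Transfer to the graphs of the statement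

at : Walk E u v m → Fin (suc m) → Fin _
at {u = u} _       zero    = u
at         (e ∷ p) (suc i) = at p i

at-∈ : (p : Walk E u v m) (i : Fin (suc m)) → at p i ∈ p
at-∈ p       zero    = here
at-∈ (e ∷ p) (suc i) = there (at-∈ p i)

at-injective : (p : Walk E u v m) → Simple p → Injective _≡_ _≡_ (at p)
at-injective p       _       {zero}  {zero}  _  = refl
at-injective (e ∷ p) (h , _) {zero}  {suc j} eq = ⊥-elim (h (subst (_∈ p) (sym eq) (at-∈ p j)))
at-injective (e ∷ p) (h , _) {suc i} {zero}  eq = ⊥-elim (h (subst (_∈ p) eq (at-∈ p i)))
at-injective (e ∷ p) (_ , s) {suc i} {suc j} eq = cong suc (at-injective p s eq)

at-step : (p : Walk E u v m) (i : Fin m) → E (at p (inject₁ i)) (at p (suc i))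
at-step (e ∷ p) zero    = e
at-step (e ∷ p) (suc i) = at-step p i

at-end : (p : Walk E u v m) → at p (fromℕ m) ≡ v
at-end []      = refl
at-end (e ∷ p) = at-end p

odd-half : ∀ m → par m ≡ true → Odd m
odd-half (suc zero)    _   = 0 , refl
odd-half (suc (suc m)) odd with odd-half m (trans (sym (not-involutive _)) odd)
... | j , refl = suc j , cong suc (arith j)
  where
  arith : ∀ j → 2 + 2 * j ≡ 2 * suc j
  arith = solve-∀

module _ (G : Graph) where

  net : Net (Graph.n G)
  net = record
    { Edge = Adj G ; edge? = λ u v → adj G u v Bool.≟ true
    ; edge-sym = λ {u} {v} e → trans (Graph.sym G v u) e }

  adj-≢ : ∀ {u v} → Adj G u v → u ≢ v
  adj-≢ {u} e refl with () ← trans (sym e) (irrefl G u)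

  -- Irreflexivity excludes the degenerate length 1, and oddness excludes 2.
  toCycleOfLength : Cycle (Adj G) m → par m ≡ true → CycleOfLength G m
  toCycleOfLength (cycle {b = b} {ℓ} refl p e) odd = record
    { m = ℓ ; len = refl ; long = long ℓ p e odd ; vtx = at (walk p) ; distinct = at-injective (walk p) (simple p)
    ; step = at-step (walk p) ; close = subst (λ x → Adj G x _) (sym (at-end (walk p))) e }
    where
    long : ∀ {a b} ℓ → Path (Adj G) a b ℓ → Adj G b a → par (suc ℓ) ≡ true → 3 ≤ suc ℓ
    long zero          p e _ = ⊥-elim (adj-≢ e (sym (walk₀ (walk p))))
    long (suc zero)    p e ()
    long (suc (suc ℓ)) p e _ = s≤s (s≤s (s≤s z≤n))

  triangle : CycleOfLength G 3 → Clique G 3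
  triangle record { m = _ ; len = refl ; vtx = x ; distinct = inj ; step = step ; close = close } = x , inj , joined
    where
    flip : ∀ {u v} → Adj G u v → Adj G v u
    flip = Net.edge-sym net
    joined : ∀ i j → i ≢ j → Adj G (x i) (x j)
    joined zero             zero             h = ⊥-elim (h refl)
    joined zero             (suc zero)       h = step zero
    joined zero             (suc (suc zero)) h = flip close
    joined (suc zero)       zero             h = flip (step zero)
    joined (suc zero)       (suc zero)       h = ⊥-elim (h refl)
    joined (suc zero)       (suc (suc zero)) h = step (suc zero)
    joined (suc (suc zero)) zero             h = close
    joined (suc (suc zero)) (suc zero)       h = flip (step (suc zero))
    joined (suc (suc zero)) (suc (suc zero)) h = ⊥-elim (h refl)

  -- Pigeonhole on the colours of the clique.
  clique-bound : Clique G k → ∀ j → j < k → ¬ Colouring G j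
  clique-bound (q , _ , q-adj) j j<k (f , proper) with pigeonhole j<k (f ∘ q)
  ... | i , i′ , i<i′ , eq = proper (q i) (q i′) (q-adj i i′ (Finₚ.<⇒≢ i<i′)) eq

  K₄-clique : ∀ {a b c d} → Adj G a b → Adj G a c → Adj G a d → Adj G b c → Adj G b d → Adj G c d → Clique G 4
  K₄-clique {a} {b} {c} {d} ab ac ad bc bd cd = q , (λ {i} {j} eq → distinct i j eq) , q-adj
    where
    q : Fin 4 → Vertex G
    q = fourVertices a b c d
    q-adj : ∀ i j → i ≢ j → Adj G (q i) (q j)
    q-adj i j = fourEdges {E = Adj G} (Net.edge-sym net) ab ac ad bc bd cd
    distinct : ∀ i j → q i ≡ q j → i ≡ j
    distinct i j eq with i ≟ j
    ... | yes h = h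
    ... | no h  = ⊥-elim (adj-≢ (q-adj i j h) eq)

  widen : ∀ {j k} → j ≤ k → Colourable (Adj G) j → Colouring G k
  widen j≤k (f , proper) = (λ v → Fin.inject≤ (f v) j≤k) , λ u v e → proper e ∘ Finₚ.inject≤-injective j≤k j≤k _ _

theorem1 : (l : ℕ) → 2 ≤ l → (G : Graph)
    → (∀ k → (InL G k → (k ≡ 3 ⊎ k ≡ 3 + 2 * l)) × ((k ≡ 3 ⊎ k ≡ 3 + 2 * l) → InL G k))
    → (w : ℕ) → IsCliqueNumber G w → IsChromaticNumber G (3 ⊔ w)
theorem1 l 2≤l G hyp w (clique , maximal) =
  -- A cycle of length 3 is a clique, so `w` is at least 3 and the maximum is `w`.
  subst (IsChromaticNumber G) (sym (m≤n⇒m⊔n≡n 3≤w)) (colouring , clique-bound G clique)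
  where
  open Main l 2≤l
  arith : ∀ l → 3 + 2 * l ≡ 2 + (l + suc l)
  arith = solve-∀
  odds : Odds (Adj G)
  odds {m} Z odd = [ inj₁ , (λ eq → inj₂ (trans eq (arith l))) ]′
    (proj₁ (hyp m) (odd-half m odd , toCycleOfLength G Z odd))
  3≤w : 3 ≤ w
  3≤w = ≮⇒≥ λ w<3 → maximal 3 w<3 (triangle G (proj₂ (proj₂ (hyp 3) (inj₁ refl))))
  colouring : Colouring G w
  -- For `w` ≥ 4 four colours are available; otherwise maximality of `w` excludes K₄ and three
  -- suffice.
  colouring with 4 ≤? w
  ... | yes 4≤w = widen G 4≤w (fourColour (net G) odds)
  ... | no 4≰w  = widen G 3≤w (threeColour (net G) odds λ ab ac ad bc bd cd →
    maximal 4 (≰⇒> 4≰w) (K₄-clique G ab ac ad bc bd cd))
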